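{- Let $M$ be a $4\times 2$ integer matrix, and let $X=M^{\mathrm{SACG}}$ be the associated standardized abelian Cayley graph. Suppose that $X$ is nonbipartite and has no loops, and that $M$ has no zero rows. Then $\chi(X)=4$ if there exist a $4\times 4$ signed permutation matrix $P$ and a $2\times 2$ unimodular matrix $U$ such that $$PMU=\begin{pmatrix} 1 & a\\ 1 & b\\ 1 & c\\ 0 & 1\end{pmatrix}$$ for some integers $a,b,c$ with $3\mid a+b+c$, and $\chi(X)=3$ otherwise. (In particular, $\chi(X)=4$ if and only if such $P$, $U$, $a,b,c$ exist.)
   Context: For a group $G$ (here abelian, written additively) with a symmetric subset $S$ (i.e. $-x\in S$ whenever $x\in S$), the Cayley graph $\mathrm{Cay}(G,S)$ is the graph with vertex set $G$ in which $x$ and $y$ are adjacent if and only if $y-x\in S$. Standardized abelian Cayley graph (SACG): given an $m\times r$ integer matrix $M$, let $H$ be the subgroup of $\mathbb{Z}^m$ generated by the columns of $M$, let $G=\mathbb{Z}^m/H$, and let $S=\{H\pm e_1,\dots,H\pm e_m\}$, where $e_i\in\mathbb{Z}^m$ is the column vector with $1$ in the $i$th position and $0$ elsewhere. Then $M^{\mathrm{SACG}}$ denotes $\mathrm{Cay}(G,S)$. A loop in a graph is an edge from a vertex to itself (so $M^{\mathrm{SACG}}$ has a loop exactly when $0\in S$, and a graph with a loop has no proper coloring). A proper coloring assigns a color to each vertex so that adjacent vertices receive different colors; $\chi(X)$ is the smallest number of colors in a proper coloring of $X$. A graph here is bipartite if and only if it has chromatic number $2$. A row of a matrix is a zero row if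 every entry in it is $0$. A square integer matrix is a signed permutation matrix if each row and each column has exactly one nonzero entry, which is $\pm 1$. A unimodular matrix is a square integer matrix with determinant $\pm 1$. -}

module Defs where

open import Algebra.Bundles using (AbelianGroup)
import Algebra.Construct.Pointwise as Pointwise
import Algebra.Definitions.RawMonoid as RawMonoidDefs
import Algebra.Properties.AbelianGroup as AbelianGroupProperties
open import Data.Bool.Base using (if_then_else_)
open import Data.Fin.Base using (Fin; zero; suc; toℕ; punchIn)
open import Data.Fin.Properties using (_≟_)
open import Data.Integer.Base as ℤ using (ℤ; 0ℤ; 1ℤ; -1ℤ)
open import Data.Integer.Divisibility using (_∣_)
import Data.Integer.Properties as ℤ
open import Data.Nat.Base as ℕ using (ℕ; zero; suc)
open import Data.Product using (_×_; _,_; ∃!; ∃-syntax)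
open import Data.Sum.Base using (_⊎_; inj₁; inj₂)
open import Data.Vec.Functional using (Vector; []; _∷_)
open import Function.Bundles using (Func)
open import Level using (Level; _⊔_; 0ℓ) renaming (suc to lsuc)
open import Relation.Binary.Bundles using (Setoid)
open import Relation.Binary.Core using (Rel)
open import Relation.Binary.Definitions using (Symmetric; _Respects_; _Respects₂_)
open import Relation.Binary.PropositionalEquality using (_≡_; _≢_)
import Relation.Binary.PropositionalEquality as ≡
import Relation.Binary.Reasoning.Setoid as SetoidReasoning
open import Relation.Nullary using (¬_; does)
open import Relation.Unary using (Pred; _∈_)

private
  variable
    a c ℓ p : Level
    m n r : ℕ

------------------------------------------------------------------------
-- Graphs (undirected, loops allowed) and their colorings

record Graph (c ℓ p : Level) : Set (lsuc (c ⊔ ℓ ⊔ p)) where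
  field
    vertices : Setoid c ℓ
  open Setoid vertices public using (_≈_) renaming (Carrier to Vertex)
  field
    Adj      : Rel Vertex p
    adj-resp : Adj Respects₂ _≈_
    adj-sym  : Symmetric Adj

Loopless : Graph c ℓ p → Set (c ⊔ p)
Loopless X = ∀ x → ¬ Adj x x
  where open Graph X

-- A color is assigned to a vertex, not to a representative of it, so a
-- coloring has to be a setoid morphism.
record ProperColoring (X : Graph c ℓ p) (k : ℕ) : Set (c ⊔ ℓ ⊔ p) where
  open Graph X
  field
    coloring : Func vertices (≡.setoid (Fin k))
  open Func coloring public renaming (to to color)
  field
    proper : ∀ {x y} → Adj x y → color x ≢ color y

HasChromaticNumber : Graph c ℓ p → ℕ → Set (c ⊔ ℓ ⊔ p)
HasChromaticNumber X k =
  ProperColoring X k × (∀ j → ProperColoring X j → k ℕ.≤ j)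

Bipartite : Graph c ℓ p → Set (c ⊔ ℓ ⊔ p)
Bipartite X = HasChromaticNumber X 2

------------------------------------------------------------------------
-- Abelian groups: subgroups, quotients, Cayley graphs

module _ (G : AbelianGroup c ℓ) where

  open AbelianGroup G
    renaming (_∙_ to _+_; ε to 0#; _⁻¹ to -_; ∙-cong to +-cong;
              ⁻¹-cong to -‿cong; inverseʳ to -‿inverseʳ)
    hiding (_-_)
  open AbelianGroupProperties G
    using (⁻¹-involutive; ⁻¹-∙-comm; ⁻¹-anti-homo-∙)
  open SetoidReasoning setoid

  record Subgroup (p : Level) : Set (c ⊔ ℓ ⊔ lsuc p) where
    field
      Member   : Pred Carrier p
      resp     : Member Respects _≈_
      0-closed : 0# ∈ Member
      +-closed : ∀ {x y} → x ∈ Member → y ∈ Member → (x + y) ∈ Member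
      neg-closed : ∀ {x} → x ∈ Member → (- x) ∈ Member

  data Generated {I : Set a} (g : I → Carrier) : Pred Carrier (a ⊔ c ⊔ ℓ) where
    generator : ∀ i → g i ∈ Generated g
    respects  : (Generated g) Respects _≈_
    zeroᴳ     : 0# ∈ Generated g
    addᴳ      : ∀ {x y} → x ∈ Generated g → y ∈ Generated g →
                (x + y) ∈ Generated g
    negᴳ      : ∀ {x} → x ∈ Generated g → (- x) ∈ Generated g

  subgroupGeneratedBy : {I : Set a} → (I → Carrier) → Subgroup (a ⊔ c ⊔ ℓ)
  subgroupGeneratedBy g = record
    { Member     = Generated g
    ; resp       = respects
    ; 0-closed   = zeroᴳ
    ; +-closed   = addᴳ
    ; neg-closed = negᴳ
    }

  -- The quotient has the same carrier; x and y are equal when x - y ∈ H.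
  quotient : Subgroup p → AbelianGroup c p
  quotient H = record
    { Carrier = Carrier
    ; _≈_     = _∼_
    ; _∙_     = _+_
    ; ε       = 0#
    ; _⁻¹     = -_
    ; isAbelianGroup = record
      { isGroup = record
        { isMonoid = record
          { isSemigroup = record
            { isMagma = record
              { isEquivalence = record
                { refl  = ∼-reflexive refl
                ; sym   = ∼-sym
                ; trans = ∼-trans
                }
              ; ∙-cong = ∼-+-cong
              }
            ; assoc = λ x y z → ∼-reflexive (assoc x y z)
            }
          ; identity = (λ x → ∼-reflexive (identityˡ x)) ,
                       (λ x → ∼-reflexive (identityʳ x))
          }
        ; inverse = (λ x → ∼-reflexive (inverseˡ x)) ,
                    (λ x → ∼-reflexive (-‿inverseʳ x))
        ; ⁻¹-cong = ∼-neg-cong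
        }
      ; comm = λ x y → ∼-reflexive (comm x y)
      }
    }
    where
    open Subgroup H

    _∼_ : Rel Carrier _
    x ∼ y = (x + (- y)) ∈ Member

    ∼-reflexive : ∀ {x y} → x ≈ y → x ∼ y
    ∼-reflexive {x} {y} x≈y = resp (begin
      0#        ≈⟨ -‿inverseʳ y ⟨
      y + (- y) ≈⟨ +-cong x≈y refl ⟨
      x + (- y) ∎) 0-closed

    flip-sub : ∀ x y → - (x + (- y)) ≈ y + (- x)
    flip-sub x y = begin
      - (x + (- y))   ≈⟨ ⁻¹-anti-homo-∙ x (- y) ⟩
      (- (- y)) + - x ≈⟨ +-cong (⁻¹-involutive y) refl ⟩
      y + (- x)       ∎

    ∼-sym : ∀ {x y} → x ∼ y → y ∼ x
    ∼-sym {x} {y} x∼y = resp (flip-sub x y) (neg-closed x∼y)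

    ∼-trans : ∀ {x y z} → x ∼ y → y ∼ z → x ∼ z
    ∼-trans {x} {y} {z} x∼y y∼z = resp (begin
      (x + (- y)) + (y + (- z)) ≈⟨ assoc x (- y) (y + (- z)) ⟩
      x + ((- y) + (y + (- z))) ≈⟨ +-cong refl (assoc (- y) y (- z)) ⟨
      x + (((- y) + y) + (- z)) ≈⟨ +-cong refl (+-cong (inverseˡ y) refl) ⟩
      x + (0# + (- z))          ≈⟨ +-cong refl (identityˡ (- z)) ⟩
      x + (- z)                 ∎) (+-closed x∼y y∼z)

    ∼-+-cong : ∀ {x y u v} → x ∼ y → u ∼ v → (x + u) ∼ (y + v)
    ∼-+-cong {x} {y} {u} {v} x∼y u∼v = resp (begin
      (x + (- y)) + (u + (- v)) ≈⟨ assoc x (- y) (u + (- v)) ⟩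
      x + ((- y) + (u + (- v))) ≈⟨ +-cong refl (assoc (- y) u (- v)) ⟨
      x + (((- y) + u) + (- v)) ≈⟨ +-cong refl (+-cong (comm (- y) u) refl) ⟩
      x + ((u + (- y)) + (- v)) ≈⟨ +-cong refl (assoc u (- y) (- v)) ⟩
      x + (u + ((- y) + (- v))) ≈⟨ assoc x u ((- y) + (- v)) ⟨
      (x + u) + ((- y) + (- v)) ≈⟨ +-cong refl (⁻¹-∙-comm y v) ⟩
      (x + u) + (- (y + v))     ∎) (+-closed x∼y u∼v)

    ∼-neg-cong : ∀ {x y} → x ∼ y → (- x) ∼ (- y)
    ∼-neg-cong {x} {y} x∼y =
      resp (sym (⁻¹-∙-comm x (- y))) (neg-closed x∼y)

  record SymmetricSubset (p : Level) : Set (c ⊔ ℓ ⊔ lsuc p) where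
    field
      Member    : Pred Carrier p
      resp      : Member Respects _≈_
      symmetric : ∀ {x} → x ∈ Member → (- x) ∈ Member

  Cay : SymmetricSubset p → Graph c ℓ p
  Cay S = record
    { vertices = setoid
    ; Adj      = λ x y → (y + (- x)) ∈ Member
    ; adj-resp = (λ y≈z → resp (+-cong y≈z refl)) ,
                 (λ x≈z → resp (+-cong refl (-‿cong x≈z)))
    ; adj-sym  = λ {x} {y} adj → resp (begin
        - (y + (- x))   ≈⟨ ⁻¹-anti-homo-∙ y (- x) ⟩
        (- (- x)) + - y ≈⟨ +-cong (⁻¹-involutive x) refl ⟩
        x + (- y)       ∎) (symmetric adj)
    }
    where open SymmetricSubset S

  plusMinus : {I : Set} → (I → Carrier) → SymmetricSubset ℓ
  plusMinus g = record
    { Member    = λ x → ∃[ i ] (x ≈ g i ⊎ x ≈ - g i)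
    ; resp      = λ where
        x≈y (i , inj₁ x≈g)  → i , inj₁ (trans (sym x≈y) x≈g)
        x≈y (i , inj₂ x≈-g) → i , inj₂ (trans (sym x≈y) x≈-g)
    ; symmetric = λ where
        (i , inj₁ x≈g)  → i , inj₂ (-‿cong x≈g)
        (i , inj₂ x≈-g) →
          i , inj₁ (trans (-‿cong x≈-g) (⁻¹-involutive (g i)))
    }

------------------------------------------------------------------------
-- Integer matrices

-- M i j is the entry in row i and column j.
Matrix : ℕ → ℕ → Set
Matrix m n = Vector (Vector ℤ n) m

open RawMonoidDefs ℤ.+-0-rawMonoid using (sum)

infix  4 _≈ᴹ_
infixl 7 _*ᴹ_

-- Functions are not extensional here, so matrices are compared entrywise.
_≈ᴹ_ : Matrix m n → Matrix m n → Set
A ≈ᴹ B = ∀ i j → A i j ≡ B i j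

_*ᴹ_ : Matrix m n → Matrix n r → Matrix m r
(A *ᴹ B) i k = sum (λ j → A i j ℤ.* B j k)

NoZeroRows : Matrix m n → Set
NoZeroRows A = ∀ i → ¬ (∀ j → A i j ≡ 0ℤ)

-- Laplace expansion along the first row.
det : Matrix n n → ℤ
det {zero}  A = 1ℤ
det {suc n} A = sum (λ j →
  (-1ℤ ℤ.^ toℕ j) ℤ.* A zero j ℤ.* det (λ i k → A (suc i) (punchIn j k)))

Unimodular : Matrix n n → Set
Unimodular A = det A ≡ 1ℤ ⊎ det A ≡ -1ℤ

record SignedPermutation (A : Matrix n n) : Set where
  field
    row     : ∀ i → ∃! _≡_ (λ j → A i j ≢ 0ℤ)
    column  : ∀ j → ∃! _≡_ (λ i → A i j ≢ 0ℤ)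
    nonzero : ∀ i j → A i j ≢ 0ℤ → A i j ≡ 1ℤ ⊎ A i j ≡ -1ℤ

------------------------------------------------------------------------
-- Standardized abelian Cayley graphs

ℤ^ : ℕ → AbelianGroup 0ℓ 0ℓ
ℤ^ m = Pointwise.abelianGroup (Fin m) ℤ.+-0-abelianGroup

e : Fin m → Vector ℤ m
e i j = if does (i ≟ j) then 1ℤ else 0ℤ

columnSubgroup : Matrix m r → Subgroup (ℤ^ m) 0ℓ
columnSubgroup {m} M = subgroupGeneratedBy (ℤ^ m) (λ j i → M i j)

SACG : Matrix m r → Graph 0ℓ 0ℓ 0ℓ
SACG {m} M = Cay G (plusMinus G e)
  where G = quotient (ℤ^ m) (columnSubgroup M)

exceptionalMatrix : ℤ → ℤ → ℤ → Matrix 4 2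
exceptionalMatrix a b c =
  (1ℤ ∷ a  ∷ []) ∷
  (1ℤ ∷ b  ∷ []) ∷
  (1ℤ ∷ c  ∷ []) ∷
  (0ℤ ∷ 1ℤ ∷ []) ∷ []

Exceptional : Matrix 4 2 → Set
Exceptional M =
  ∃[ P ] ∃[ U ] ∃[ a ] ∃[ b ] ∃[ c ]
    SignedPermutation {4} P × Unimodular {2} U ×
    P *ᴹ M *ᴹ U ≈ᴹ exceptionalMatrix a b c ×
    ℤ.+ 3 ∣ a ℤ.+ b ℤ.+ c

{-# OPTIONS --safe #-}

-- Write r₁ , … , r₄ ∈ ℤ² for the rows of M.  Weights w and a unit n with n ≤ |wᵢ| ≤ (k - 1) n and
-- w ⊥ columns modulo k n give the proper k-coloring z ↦ ⌊((w · z) mod k n) / n⌋.  For k = 3 they exist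
-- as soon as the zonotope Z = Σ [-1 , 1] rᵢ contains some 3p with p ∈ ℤ² and p ≡ Σ rᵢ (mod 2).
-- The norm h(a , b) = Σ |(a , b) · rᵢ| is the support function of Z.  The graph has no loops only if
-- h ≠ 1, and it is nonbipartite only if h takes odd values.  Choose a basis of ℤ² reduced for h, with
-- norms A ≤ B ≤ h(1 , ±1).  If A ≠ 3 ≠ B, convexity puts (3 , 0), (0 , 3) or (3 , ±3) into Z, according
-- to the parities of A and B, except that the case A = B = 5 needs a finite search.  If A or B is 3, the
-- face of Z at height 3 is a segment, which misses all suitable 3p exactly in the exceptional case.
-- In that case e₁ , e₂ , e₃ span triangles, so that any 3-coloring has the periods eᵢ - eⱼ and 3e₁ and
-- therefore, as 3 ∣ a + b + c, also the period e₄; weights for k = 4 exist nevertheless.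
module Submission where

open import Defs
import Algebra.Definitions.RawMonoid as RawMonoidDefs
import Algebra.Properties.CommutativeMonoid.Sum as Sum
open import Data.Bool.Base using (Bool; true; false; _∧_; _∨_; T)
open import Data.Bool.Properties using (T-∧; T-∨; T-≡)
open import Data.Empty using (⊥-elim)
open import Data.Fin.Base using (Fin; zero; suc; fromℕ<; punchIn)
import Data.Fin.Properties as Fin
open import Data.Integer.Base hiding (suc; _/_; _%_; _⊔_)
import Data.Integer.Divisibility as Unsigned
open import Data.Integer.Divisibility.Signed
import Data.Integer.DivMod as ℤ
import Data.Integer.Properties as ℤ
open import Data.Integer.Tactic.RingSolver using (solve-∀)
open import Data.Nat.Base as ℕ using (ℕ; zero; suc; z≤n; s≤s; _/_; _%_)
import Data.Nat.Divisibility as ℕ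
import Data.Nat.DivMod as ℕ
import Data.Nat.Properties as ℕ
import Data.Nat.Tactic.RingSolver as ℕ-Solver
open import Data.Product using (_×_; _,_; proj₁; proj₂; ∃; ∃₂; ∃-syntax; ∃!)
open import Data.Sum.Base as ⊎ using (_⊎_; inj₁; inj₂)
open import Data.Vec.Base as Vec using (Vec; tabulate)
open import Data.Vec.Functional using (Vector; removeAt; []; _∷_)
open import Function.Base using (_∘_; id)
open import Function.Bundles using (_⇔_; mk⇔; Equivalence)
open import Level using (0ℓ)
open import Relation.Binary.PropositionalEquality hiding (resp)
open import Relation.Nullary using (¬_; Dec; yes; no)
open import Relation.Nullary.Decidable using (from-yes; from-no; _→-dec_; ¬?)

open RawMonoidDefs +-0-rawMonoid using (sum)
open RawMonoidDefs ℕ.+-0-rawMonoid using () renaming (sum to sumℕ)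

-- Parity supplies the slack. The norm of a lattice vector is congruent modulo 2 to the sum of its
-- entries, so `h(1 , ±1) ≡ A + B`; if `A` is odd, neither value equals `B`, and the inequalities of
-- a reduced basis become strict. This one unit is what pushes the extremal points of Z far enough
-- for an edge to pass beyond (3 , 0) or (0 , 3). Similarly, when a norm is odd, the corresponding
-- coordinate of each sign sum of rows is odd, hence ±1 or at least 3 in absolute value. One such
-- point with both coordinates large puts (3 , ±3) into Z; otherwise the points at hand are pinned
-- to forms like (a , ±1) and (±1 , b). For the pair (a , -1), (1 , a) the point (3 , 3) is on the
-- near side of their line exactly when 6 a ≤ a² + 1, which holds for a = 6 and fails for a = 5:
-- this is the origin of the finite search. Norm 3 is separate because the candidates then lie on
-- the boundary of Z, where only the length of a face and residues modulo 3 count. Convexity is used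
-- over the rationals with cleared denominators, so each membership is a polynomial identity
-- together with one inequality between weights.

private
  variable
    k m : ℕ

-- Circular colorings

infix 8 _·_

_·_ : Vector ℤ m → Vector ℤ m → ℤ
w · x = sum (λ i → w i * x i)

·-congʳ : ∀ (w : Vector ℤ m) {x y} → (∀ i → x i ≡ y i) → w · x ≡ w · y
·-congʳ {zero}  w x≡y = refl
·-congʳ {suc m} w x≡y =
  cong₂ _+_ (cong (w zero *_) (x≡y zero)) (·-congʳ (w ∘ suc) (x≡y ∘ suc))

·-comm : ∀ (w x : Vector ℤ m) → w · x ≡ x · w
·-comm {zero}  w x = refl
·-comm {suc m} w x =
  cong₂ _+_ (ℤ.*-comm (w zero) (x zero)) (·-comm (w ∘ suc) (x ∘ suc))

·-linearʳ : ∀ (w : Vector ℤ m) a x b y →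
            w · (λ i → a * x i + b * y i) ≡ a * (w · x) + b * (w · y)
·-linearʳ {zero}  w a x b y = sym (cong₂ _+_ (ℤ.*-zeroʳ a) (ℤ.*-zeroʳ b))
·-linearʳ {suc m} w a x b y = begin
  w zero * (a * x zero + b * y zero) + w′ · (λ i → a * x′ i + b * y′ i)
    ≡⟨ cong (_+_ (w zero * (a * x zero + b * y zero))) (·-linearʳ w′ a x′ b y′) ⟩
  w zero * (a * x zero + b * y zero) + (a * (w′ · x′) + b * (w′ · y′))
    ≡⟨ rearrange (w zero) (x zero) (y zero) (w′ · x′) (w′ · y′) a b ⟩
  a * (w zero * x zero + w′ · x′) + b * (w zero * y zero + w′ · y′) ∎
  where
  open ≡-Reasoning
  w′ = w ∘ suc
  x′ = x ∘ suc
  y′ = y ∘ suc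
  rearrange : ∀ w x y s t a b →
    w * (a * x + b * y) + (a * s + b * t) ≡ a * (w * x + s) + b * (w * y + t)
  rearrange = solve-∀

·-linearˡ : ∀ a (w : Vector ℤ m) b w′ x →
            (λ i → a * w i + b * w′ i) · x ≡ a * (w · x) + b * (w′ · x)
·-linearˡ a w b w′ x = begin
  (λ i → a * w i + b * w′ i) · x ≡⟨ ·-comm _ x ⟩
  x · (λ i → a * w i + b * w′ i) ≡⟨ ·-linearʳ x a w b w′ ⟩
  a * (x · w) + b * (x · w′)     ≡⟨ cong₂ (λ s t → a * s + b * t) (·-comm x w) (·-comm x w′) ⟩
  a * (w · x) + b * (w′ · x)     ∎
  where open ≡-Reasoning

·-zeroʳ : ∀ (w : Vector ℤ m) → w · (λ _ → 0ℤ) ≡ 0ℤ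
·-zeroʳ {zero}  w = refl
·-zeroʳ {suc m} w = cong₂ _+_ (ℤ.*-zeroʳ (w zero)) (·-zeroʳ (w ∘ suc))

·-+ʳ : ∀ (w x y : Vector ℤ m) → w · (λ i → x i + y i) ≡ w · x + w · y
·-+ʳ w x y = begin
  w · (λ i → x i + y i)           ≡⟨ ·-congʳ w (λ i → cong₂ _+_ (sym (ℤ.*-identityˡ (x i))) (sym (ℤ.*-identityˡ (y i)))) ⟩
  w · (λ i → 1ℤ * x i + 1ℤ * y i) ≡⟨ ·-linearʳ w 1ℤ x 1ℤ y ⟩
  1ℤ * (w · x) + 1ℤ * (w · y)     ≡⟨ cong₂ _+_ (ℤ.*-identityˡ (w · x)) (ℤ.*-identityˡ (w · y)) ⟩
  w · x + w · y                   ∎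
  where open ≡-Reasoning

·-negʳ : ∀ (w x : Vector ℤ m) → w · (λ i → - x i) ≡ - (w · x)
·-negʳ w x = begin
  w · (λ i → - x i)               ≡⟨ ·-congʳ w (λ i → sym (negate (x i))) ⟩
  w · (λ i → -1ℤ * x i + 0ℤ * x i) ≡⟨ ·-linearʳ w -1ℤ x 0ℤ x ⟩
  -1ℤ * (w · x) + 0ℤ * (w · x)    ≡⟨ negate (w · x) ⟩
  - (w · x)                       ∎
  where
  open ≡-Reasoning
  negate : ∀ a → -1ℤ * a + 0ℤ * a ≡ - a
  negate = solve-∀

·-subʳ : ∀ (w x y : Vector ℤ m) → w · (λ i → x i + - y i) ≡ w · x - w · y
·-subʳ w x y = trans (·-+ʳ w x (λ i → - y i)) (cong (_+_ (w · x)) (·-negʳ w y))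

·-e : ∀ (w : Vector ℤ m) i → w · e i ≡ w i
·-e {suc m} w zero =
  trans (cong₂ _+_ (ℤ.*-identityʳ (w zero)) (·-zeroʳ (w ∘ suc))) (ℤ.+-identityʳ (w zero))
·-e {suc m} w (suc i) =
  trans (cong₂ _+_ (ℤ.*-zeroʳ (w zero)) (trans (·-congʳ (w ∘ suc) (e-suc i)) (·-e (w ∘ suc) i)))
        (ℤ.+-identityˡ (w (suc i)))
  where
  e-suc : ∀ {m} (i : Fin m) j → e (suc i) (suc j) ≡ e i j
  e-suc i j with i Fin.≟ j
  ... | yes _ = refl
  ... | no  _ = refl

e-diagonal : ∀ (j : Fin m) → e j j ≡ 1ℤ
e-diagonal j with j Fin.≟ j
... | yes _   = refl
... | no  j≢j = ⊥-elim (j≢j refl)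

e-off-diagonal : ∀ {j i : Fin m} → i ≢ j → e j i ≡ 0ℤ
e-off-diagonal {j = j} {i} i≢j with j Fin.≟ i
... | yes j≡i = ⊥-elim (i≢j (sym j≡i))
... | no  _   = refl

-- Equivalently, a homomorphism from the group to the integers modulo `k * unit` that keeps every
-- generator at circular distance at least `unit` from 0. The k blocks of `unit` consecutive
-- residues become the colors.
record CircularColoring (k : ℕ) (u v : Vector ℤ m) : Set where
  field
    unit     : ℕ
    unit≥1   : 1 ℕ.≤ unit
    weight   : Vector ℤ m
    weight≥  : ∀ i → unit ℕ.≤ ∣ weight i ∣
    weight≤  : ∀ i → unit ℕ.+ ∣ weight i ∣ ℕ.≤ k ℕ.* unit
    ∣weight·u : + (k ℕ.* unit) ∣ weight · u
    ∣weight·v : + (k ℕ.* unit) ∣ weight · v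

-- Residues and integer division

small-multiple : ∀ {n z} → + n ∣ z → ∣ z ∣ ℕ.< n → z ≡ 0ℤ
small-multiple {n} {z} n∣z z<n with ∣ z ∣ in eq
... | zero  = ℤ.∣i∣≡0⇒i≡0 eq
... | suc t = ⊥-elim (ℕ.<⇒≱ z<n (ℕ.∣⇒≤ (subst (n ℕ.∣_) eq (∣⇒∣ᵤ n∣z))))

%ℕ-∣ : ∀ i n .{{_ : ℕ.NonZero n}} → + n ∣ i - + (i %ℕ n)
%ℕ-∣ i n = divides (i /ℕ n) (begin
  i - + (i %ℕ n)                                ≡⟨ cong (_- + (i %ℕ n)) (ℤ.a≡a%ℕn+[a/ℕn]*n i n) ⟩
  + (i %ℕ n) + (i /ℕ n) * + n - + (i %ℕ n)       ≡⟨ cancel (+ (i %ℕ n)) ((i /ℕ n) * + n) ⟩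
  (i /ℕ n) * + n                                ∎)
  where
  open ≡-Reasoning
  cancel : ∀ a b → a + b - a ≡ b
  cancel = solve-∀

∣-%ℕ : ∀ i j n .{{_ : ℕ.NonZero n}} → ∀ {z} → + n ∣ i - j - z →
       + n ∣ + (i %ℕ n) - + (j %ℕ n) - z
∣-%ℕ i j n {z} h = subst (+ n ∣_) (shift i j z (+ (i %ℕ n)) (+ (j %ℕ n)))
  (∣m∣n⇒∣m-n h (∣m∣n⇒∣m-n (%ℕ-∣ i n) (%ℕ-∣ j n)))
  where
  shift : ∀ i j z r s → i - j - z - ((i - r) - (j - s)) ≡ r - s - z
  shift = solve-∀

∣+-+∣< : ∀ {n a b} → a ℕ.< n → b ℕ.< n → ∣ + a - + b ∣ ℕ.< n
∣+-+∣< {n} {a} {b} a<n b<n = begin-strict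
  ∣ + a - + b ∣ ≡⟨ cong ∣_∣ (ℤ.m-n≡m⊖n a b) ⟩
  ∣ a ⊖ b ∣     ≤⟨ ℤ.∣m⊝n∣≤m⊔n a b ⟩
  a ℕ.⊔ b       <⟨ ℕ.⊔-lub a<n b<n ⟩
  n             ∎
  where open ℕ.≤-Reasoning

sameQuotient : ∀ {a b} n .{{_ : ℕ.NonZero n}} → a / n ≡ b / n → ∣ + a - + b ∣ ℕ.< n
sameQuotient {a} {b} n eq = subst (λ z → ∣ z ∣ ℕ.< n) (begin
  + (a % n) - + (b % n) ≡⟨ cancel (+ (a % n)) (+ (b % n)) (+ ((b / n) ℕ.* n)) ⟩
  (+ (a % n) + + ((b / n) ℕ.* n)) - (+ (b % n) + + ((b / n) ℕ.* n))
    ≡⟨ cong (λ q → + (a % n ℕ.+ q ℕ.* n) - + (b % n ℕ.+ (b / n) ℕ.* n)) (sym eq) ⟩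
  + (a % n ℕ.+ (a / n) ℕ.* n) - + (b % n ℕ.+ (b / n) ℕ.* n)
    ≡⟨ cong₂ (λ s t → + s - + t) (sym (ℕ.m≡m%n+[m/n]*n a n)) (sym (ℕ.m≡m%n+[m/n]*n b n)) ⟩
  + a - + b ∎) (∣+-+∣< (ℕ.m%n<n a n) (ℕ.m%n<n b n))
  where
  open ≡-Reasoning
  cancel : ∀ r s t → r - s ≡ (r + t) - (s + t)
  cancel = solve-∀

-- From weights to proper colorings

module _ (M : Matrix m 2) where

  column₀ column₁ : Vector ℤ m
  column₀ i = M i zero
  column₁ i = M i (suc zero)

  InColumns : Vector ℤ m → Set
  InColumns = Subgroup.Member (columnSubgroup M)

  ∣-inColumns : ∀ w {N} → N ∣ w · column₀ → N ∣ w · column₁ →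
                ∀ {h} → InColumns h → N ∣ w · h
  ∣-inColumns w {N} N∣u N∣v = go
    where
    go : ∀ {h} → InColumns h → N ∣ w · h
    go (generator zero)       = N∣u
    go (generator (suc zero)) = N∣v
    go (respects x≈y h)       = subst (N ∣_) (·-congʳ w x≈y) (go h)
    go zeroᴳ                  = subst (N ∣_) (sym (·-zeroʳ w)) (divides 0ℤ refl)
    go (addᴳ g h)             = subst (N ∣_) (sym (·-+ʳ w _ _)) (∣m∣n⇒∣m+n (go g) (go h))
    go (negᴳ h)               = subst (N ∣_) (sym (·-negʳ w _)) (∣m⇒∣-m (go h))

  circular⇒proper : 1 ℕ.≤ k → CircularColoring k column₀ column₁ → ProperColoring (SACG M) k
  circular⇒proper {k} 1≤k cc = record
    { coloring = record { to = color ; cong = λ {x} {y} x≈y → cong quot (residue-cong x y x≈y) }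
    ; proper   = λ {x} {y} adj → proper x y adj
    }
    where
    open CircularColoring cc renaming (weight to w)
    n = unit
    N = k ℕ.* n
    instance
      n≢0 : ℕ.NonZero n
      n≢0 = ℕ.>-nonZero unit≥1
      N≢0 : ℕ.NonZero N
      N≢0 = ℕ.>-nonZero (ℕ.*-mono-≤ 1≤k unit≥1)

    residue : Vector ℤ m → ℕ
    residue x = w · x %ℕ N

    residue< : ∀ x → residue x ℕ.< k ℕ.* n
    residue< x = ℤ.n%ℕd<d (w · x) N

    -- The bound travels with the residue, so that respecting equality of vertices reduces to an
    -- equality of pairs, where proofs of the bound are irrelevant.
    quot : (∃[ r ] r ℕ.< k ℕ.* n) → Fin k
    quot (r , r<N) = fromℕ< {r / n} (ℕ.m<n*o⇒m/o<n r<N)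

    color : Vector ℤ m → Fin k
    color x = quot (residue x , residue< x)

    residue-cong : ∀ x y → InColumns (λ i → x i + - y i) →
                   (residue x , residue< x) ≡ (residue y , residue< y)
    residue-cong x y h = pairs (sameResidue) (residue< x) (residue< y)
      where
      sameResidue : residue x ≡ residue y
      sameResidue = ℤ.+-injective (ℤ.i-j≡0⇒i≡j _ _ (small-multiple
        (subst (+ N ∣_) (ℤ.+-identityʳ (+ residue x - + residue y))
          (∣-%ℕ (w · x) (w · y) N {0ℤ}
            (subst (+ N ∣_) (trans (·-subʳ w x y) (sym (ℤ.+-identityʳ _))) (∣-inColumns w ∣weight·u ∣weight·v h))))
        (∣+-+∣< (residue< x) (residue< y))))
      pairs : ∀ {r s} → r ≡ s → (p : r ℕ.< N) (q : s ℕ.< N) → (r , p) ≡ (s , q)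
      pairs refl p q = cong (_ ,_) (ℕ.≤-irrelevant p q)

    -- Two residues in one block differ by less than n. Their difference is congruent to z modulo N,
    -- and n + |z| ≤ N leaves room for no other representative, so it equals z, against n ≤ |z|.
    distinct : ∀ x y {z} → + N ∣ w · y - w · x - z → n ℕ.≤ ∣ z ∣ → n ℕ.+ ∣ z ∣ ℕ.≤ N →
               color x ≢ color y
    distinct x y {z} N∣ n≤z n+z≤N same = ℕ.<⇒≱ close (ℕ.≤-trans n≤z (ℕ.≤-reflexive (cong ∣_∣ (sym diff≡z))))
      where
      diff = + residue y - + residue x
      close : ∣ diff ∣ ℕ.< n
      close = sameQuotient n (Fin.fromℕ<-injective _ _ _ _ (sym same))
      diff≡z : diff ≡ z
      diff≡z = ℤ.i-j≡0⇒i≡j diff z (small-multiple (∣-%ℕ (w · y) (w · x) N N∣)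
        (ℕ.<-≤-trans (ℕ.≤-<-trans (ℤ.∣i-j∣≤∣i∣+∣j∣ diff z) (ℕ.+-monoˡ-< ∣ z ∣ close)) n+z≤N))

    proper : ∀ x y → Graph.Adj (SACG M) x y → color x ≢ color y
    proper x y (i , inj₁ h) = distinct x y
      (subst (+ N ∣_) (begin
         w · (λ j → (y j + - x j) + - e i j) ≡⟨ ·-subʳ w _ (e i) ⟩
         w · (λ j → y j + - x j) - w · e i   ≡⟨ cong₂ _-_ (·-subʳ w y x) (·-e w i) ⟩
         w · y - w · x - w i                 ∎)
        (∣-inColumns w ∣weight·u ∣weight·v h))
      (weight≥ i) (weight≤ i)
      where open ≡-Reasoning
    proper x y (i , inj₂ h) = distinct x y
      (subst (+ N ∣_) (begin
         w · (λ j → (y j + - x j) + - - e i j)       ≡⟨ ·-subʳ w _ (λ j → - e i j) ⟩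
         w · (λ j → y j + - x j) - w · (λ j → - e i j) ≡⟨ cong₂ _-_ (·-subʳ w y x) (trans (·-negʳ w (e i)) (cong -_ (·-e w i))) ⟩
         w · y - w · x - - w i                       ∎)
        (∣-inColumns w ∣weight·u ∣weight·v h))
      (subst (n ℕ.≤_) (sym (ℤ.∣-i∣≡∣i∣ (w i))) (weight≥ i))
      (subst (λ t → n ℕ.+ t ℕ.≤ N) (sym (ℤ.∣-i∣≡∣i∣ (w i))) (weight≤ i))
      where open ≡-Reasoning

-- Bases of the column lattice

ℓ¹ : Vector ℤ m → ℕ
ℓ¹ x = sumℕ (λ i → ∣ x i ∣)

ℓ¹-cong : ∀ {x y : Vector ℤ m} → (∀ i → x i ≡ y i) → ℓ¹ x ≡ ℓ¹ y
ℓ¹-cong {zero}  x≡y = refl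
ℓ¹-cong {suc m} x≡y = cong₂ ℕ._+_ (cong ∣_∣ (x≡y zero)) (ℓ¹-cong (x≡y ∘ suc))

IsUnit : ℤ → Set
IsUnit d = d ≡ 1ℤ ⊎ d ≡ -1ℤ

∣z∣≡1⇒unit : ∀ z → ∣ z ∣ ≡ 1 → IsUnit z
∣z∣≡1⇒unit (+ .1)    refl = inj₁ refl
∣z∣≡1⇒unit -[1+ .0 ] refl = inj₂ refl

unit-* : ∀ {c d} → IsUnit c → IsUnit d → IsUnit (c * d)
unit-* (inj₁ refl) (inj₁ refl) = inj₁ refl
unit-* (inj₁ refl) (inj₂ refl) = inj₂ refl
unit-* (inj₂ refl) (inj₁ refl) = inj₂ refl
unit-* (inj₂ refl) (inj₂ refl) = inj₁ refl

∣-unit-* : ∀ {n d a} → IsUnit d → n ∣ d * a → n ∣ a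
∣-unit-* {n} {a = a} (inj₁ refl) n∣a = subst (n ∣_) (ℤ.*-identityˡ a) n∣a
∣-unit-* {n} {a = a} (inj₂ refl) n∣a =
  subst (n ∣_) (trans (cong -_ (ℤ.-1*i≡-i a)) (ℤ.neg-involutive a)) (∣m⇒∣-m n∣a)

record BasisChange (u v x y : Vector ℤ m) : Set where
  field
    p q r s   : ℤ
    invertible : IsUnit (p * s - q * r)
    x≡ : ∀ i → x i ≡ p * u i + q * v i
    y≡ : ∀ i → y i ≡ r * u i + s * v i

  ·x : ∀ w → w · x ≡ p * (w · u) + q * (w · v)
  ·x w = trans (·-congʳ w x≡) (·-linearʳ w p u q v)

  ·y : ∀ w → w · y ≡ r * (w · u) + s * (w · v)
  ·y w = trans (·-congʳ w y≡) (·-linearʳ w r u s v)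

basis-refl : ∀ {u v : Vector ℤ m} → BasisChange u v u v
basis-refl {u = u} {v} = record
  { p = 1ℤ ; q = 0ℤ ; r = 0ℤ ; s = 1ℤ ; invertible = inj₁ refl
  ; x≡ = λ i → first (u i) (v i) ; y≡ = λ i → second (u i) (v i) }
  where
  first : ∀ a b → a ≡ 1ℤ * a + 0ℤ * b
  first = solve-∀
  second : ∀ a b → b ≡ 0ℤ * a + 1ℤ * b
  second = solve-∀

basis-trans : ∀ {u v x y x′ y′ : Vector ℤ m} →
              BasisChange u v x y → BasisChange x y x′ y′ → BasisChange u v x′ y′
basis-trans {u = u} {v} B C = record
  { p = C.p * B.p + C.q * B.r ; q = C.p * B.q + C.q * B.s
  ; r = C.r * B.p + C.s * B.r ; s = C.r * B.q + C.s * B.s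
  ; invertible = subst IsUnit (det-* C.p C.q C.r C.s B.p B.q B.r B.s)
                   (unit-* C.invertible B.invertible)
  ; x≡ = λ i → trans (C.x≡ i) (trans (cong₂ (λ a b → C.p * a + C.q * b) (B.x≡ i) (B.y≡ i))
                 (expand C.p C.q B.p B.q B.r B.s (u i) (v i)))
  ; y≡ = λ i → trans (C.y≡ i) (trans (cong₂ (λ a b → C.r * a + C.s * b) (B.x≡ i) (B.y≡ i))
                 (expand C.r C.s B.p B.q B.r B.s (u i) (v i)))
  }
  where
  module B = BasisChange B
  module C = BasisChange C
  det-* : ∀ p q r s p′ q′ r′ s′ →
    (p * s - q * r) * (p′ * s′ - q′ * r′) ≡
    (p * p′ + q * r′) * (r * q′ + s * s′) - (p * q′ + q * s′) * (r * p′ + s * r′)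
  det-* = solve-∀
  expand : ∀ a b p q r s u v →
    a * (p * u + q * v) + b * (r * u + s * v) ≡ (a * p + b * r) * u + (a * q + b * s) * v
  expand = solve-∀

basis-swap : ∀ {u v : Vector ℤ m} → BasisChange u v v u
basis-swap {u = u} {v} = record
  { p = 0ℤ ; q = 1ℤ ; r = 1ℤ ; s = 0ℤ ; invertible = inj₂ refl
  ; x≡ = λ i → first (u i) (v i) ; y≡ = λ i → second (u i) (v i) }
  where
  first : ∀ a b → b ≡ 0ℤ * a + 1ℤ * b
  first = solve-∀
  second : ∀ a b → a ≡ 1ℤ * a + 0ℤ * b
  second = solve-∀

basis-shear : ∀ {u v : Vector ℤ m} {c d} → IsUnit d →
              BasisChange u v u (λ i → c * u i + d * v i)
basis-shear {u = u} {v} {c} {d} unit = record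
  { p = 1ℤ ; q = 0ℤ ; r = c ; s = d ; invertible = subst IsUnit (det-shear d c) unit
  ; x≡ = λ i → first (u i) (v i) ; y≡ = λ i → refl }
  where
  det-shear : ∀ d c → d ≡ 1ℤ * d - 0ℤ * c
  det-shear = solve-∀
  first : ∀ a b → a ≡ 1ℤ * a + 0ℤ * b
  first = solve-∀

module _ {u v x y : Vector ℤ m} (B : BasisChange u v x y) where
  open BasisChange B

  -- Cramer's rule: a combination of the two hypotheses is the determinant times `a`, and the
  -- determinant is a unit.
  ∣-basisˡ : ∀ {n a b} → n ∣ p * a + q * b → n ∣ r * a + s * b → n ∣ a
  ∣-basisˡ {n} {a} {b} n∣x n∣y = ∣-unit-* invertible (subst (n ∣_) (cramer p q r s a b)
    (∣m∣n⇒∣m-n (∣n⇒∣m*n s n∣x) (∣n⇒∣m*n q n∣y)))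
    where
    cramer : ∀ p q r s a b → s * (p * a + q * b) - q * (r * a + s * b) ≡ (p * s - q * r) * a
    cramer = solve-∀

  ∣-basisʳ : ∀ {n a b} → n ∣ p * a + q * b → n ∣ r * a + s * b → n ∣ b
  ∣-basisʳ {n} {a} {b} n∣x n∣y = ∣-unit-* invertible (subst (n ∣_) (cramer p q r s a b)
    (∣m∣n⇒∣m-n (∣n⇒∣m*n p n∣y) (∣n⇒∣m*n r n∣x)))
    where
    cramer : ∀ p q r s a b → p * (r * a + s * b) - r * (p * a + q * b) ≡ (p * s - q * r) * b
    cramer = solve-∀

  circular-basis : CircularColoring k x y → CircularColoring k u v
  circular-basis {k} cc = record
    { unit = unit ; unit≥1 = unit≥1 ; weight = weight ; weight≥ = weight≥ ; weight≤ = weight≤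
    ; ∣weight·u = ∣-basisˡ n∣x n∣y
    ; ∣weight·v = ∣-basisʳ n∣x n∣y
    }
    where
    open CircularColoring cc
    n∣x = subst (+ (k ℕ.* unit) ∣_) (·x weight) ∣weight·u
    n∣y = subst (+ (k ℕ.* unit) ∣_) (·y weight) ∣weight·v

  nonzeroRows-basis : (∀ i → ¬ (u i ≡ 0ℤ × v i ≡ 0ℤ)) → ∀ i → ¬ (x i ≡ 0ℤ × y i ≡ 0ℤ)
  nonzeroRows-basis nz i (xi≡0 , yi≡0) = nz i
    -- Divisibility by 0 is vanishing, so Cramer's rule for divisibility, taken at n = 0, also
    -- transports zero rows.
    (0∣⇒≡0 (∣-basisˡ (zero∣ xi≡0 (x≡ i)) (zero∣ yi≡0 (y≡ i))) ,
     0∣⇒≡0 (∣-basisʳ (zero∣ xi≡0 (x≡ i)) (zero∣ yi≡0 (y≡ i))))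
    where
    zero∣ : ∀ {a b} → a ≡ 0ℤ → a ≡ b → 0ℤ ∣ b
    zero∣ refl refl = ∣-refl

-- Lagrange-Gauss reduction with respect to the norm (a , b) ↦ ℓ¹ (a u + b v).
record Reduced (u v : Vector ℤ m) : Set where
  field
    ordered : ℓ¹ u ℕ.≤ ℓ¹ v
    sum≥    : ℓ¹ v ℕ.≤ ℓ¹ (λ i → u i + v i)
    diff≥   : ℓ¹ v ℕ.≤ ℓ¹ (λ i → u i - v i)

ReducedBasis : (u v : Vector ℤ m) → Set
ReducedBasis u v = ∃₂ λ x y → BasisChange u v x y × Reduced x y

rebase : ∀ {u v x y : Vector ℤ m} → BasisChange u v x y → ReducedBasis x y → ReducedBasis u v
rebase B (x , y , C , red) = x , y , basis-trans B C , red

shorter : ∀ {a b c n} → a ℕ.+ b ℕ.≤ n → c ℕ.< b → a ℕ.+ c ℕ.< n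
shorter {a} a+b≤n c<b = ℕ.<-≤-trans (ℕ.+-monoʳ-< a c<b) a+b≤n

mutual
  -- The bound `n` on the sum of the norms is the recursion measure: v is replaced by u ± v only if
  -- that is strictly shorter, and swapping leaves the sum unchanged.
  reduce : ∀ n (u v : Vector ℤ m) → ℓ¹ u ℕ.+ ℓ¹ v ℕ.< n → ReducedBasis u v
  reduce n u v <n with ℓ¹ u ℕ.≤? ℓ¹ v
  ... | yes u≤v = reduceOrdered n u v u≤v <n
  ... | no  u≰v = rebase basis-swap
    (reduceOrdered n v u (ℕ.<⇒≤ (ℕ.≰⇒> u≰v)) (subst (ℕ._< n) (ℕ.+-comm (ℓ¹ u) (ℓ¹ v)) <n))

  reduceOrdered : ∀ n (u v : Vector ℤ m) → ℓ¹ u ℕ.≤ ℓ¹ v → ℓ¹ u ℕ.+ ℓ¹ v ℕ.< n → ReducedBasis u v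
  reduceOrdered (suc n) u v u≤v (ℕ.s≤s ≤n)
    with ℓ¹ v ℕ.≤? ℓ¹ (λ i → u i + v i) | ℓ¹ v ℕ.≤? ℓ¹ (λ i → u i - v i)
  ... | yes p | yes q = u , v , basis-refl , record { ordered = u≤v ; sum≥ = p ; diff≥ = q }
  ... | no v≰ | _     = rebase (basis-shear {c = 1ℤ} (inj₁ refl)) (reduce n u _ (shorter ≤n
    (subst (ℕ._< ℓ¹ v) (ℓ¹-cong (λ i → plus (u i) (v i))) (ℕ.≰⇒> v≰))))
    where
    plus : ∀ a b → a + b ≡ 1ℤ * a + 1ℤ * b
    plus = solve-∀
  ... | yes _ | no v≰ = rebase (basis-shear {c = 1ℤ} (inj₂ refl)) (reduce n u _ (shorter ≤n
    (subst (ℕ._< ℓ¹ v) (ℓ¹-cong (λ i → minus (u i) (v i))) (ℕ.≰⇒> v≰))))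
    where
    minus : ∀ a b → a - b ≡ 1ℤ * a + -1ℤ * b
    minus = solve-∀

-- Symmetric convex sets in the plane

-- All that the convexity arguments use of an odd coordinate.
OneOrBig : ℤ → Set
OneOrBig z = ∣ z ∣ ≡ 1 ⊎ 3 ℕ.≤ ∣ z ∣

Diagonal : (ℤ → ℤ → Set) → Set
Diagonal In = In (+ 3) (+ 3) ⊎ In (+ 3) (- + 3)

record OddPoint (In : ℤ → ℤ → Set) (X Y : ℤ) : Set where
  field
    inside : In X Y
    oddX   : OneOrBig X
    oddY   : OneOrBig Y

Reflected : (ℤ → ℤ → Set) → ℤ → ℤ → Set
Reflected In X Y = In X (- Y)

-- Absolute convexity with rational weights a/D, b/D, c/D. Signs are allowed and the weights may sum
-- to less than 1, which builds in central symmetry and shrinking towards the origin. Three points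
-- are enough for a triangle, the largest configuration that occurs.
ConvexSymmetric : (ℤ → ℤ → Set) → Set
ConvexSymmetric In =
  ∀ {X₁ Y₁ X₂ Y₂ X₃ Y₃ X Y} → In X₁ Y₁ → In X₂ Y₂ → In X₃ Y₃ →
  ∀ a b c D → 1 ℕ.≤ D → ∣ a ∣ ℕ.+ ∣ b ∣ ℕ.+ ∣ c ∣ ℕ.≤ D →
  a * X₁ + b * X₂ + c * X₃ ≡ + D * X →
  a * Y₁ + b * Y₂ + c * Y₃ ≡ + D * Y → In X Y

-- A negative summand would leave the sum below `s`, as the other one is at most `s`.
nonneg-summands : ∀ {s X Y} → ∣ X ∣ ℕ.≤ s → ∣ Y ∣ ℕ.≤ s → + s ≤ X + Y →
                  ∃₂ λ m n → X ≡ + m × Y ≡ + n × s ℕ.≤ m ℕ.+ n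
nonneg-summands {X = + m}      {+ n}      _ _ s≤ = m , n , refl , refl , ℤ.drop‿+≤+ s≤
nonneg-summands {s} {+ m}      { -[1+ n ]} m≤s _ s≤ =
  ⊥-elim (ℤ.<⇒≱ (ℤ.<-≤-trans (ℤ.+-monoʳ-< (+ m) -<+) (ℤ.≤-trans (ℤ.≤-reflexive (ℤ.+-identityʳ (+ m))) (+≤+ m≤s))) s≤)
nonneg-summands {s} { -[1+ m ]} {+ n}      _ n≤s s≤ =
  ⊥-elim (ℤ.<⇒≱ (ℤ.<-≤-trans (ℤ.+-monoˡ-< (+ n) -<+) (ℤ.≤-trans (ℤ.≤-reflexive (ℤ.+-identityˡ (+ n))) (+≤+ n≤s))) s≤)
nonneg-summands {X = -[1+ m ]} { -[1+ n ]} _ _ ()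

pos-+*+* : ∀ a b c d → + (a ℕ.* b ℕ.+ c ℕ.* d) ≡ + a * + b + + c * + d
pos-+*+* a b c d = cong₂ _+_ (ℤ.pos-* a b) (ℤ.pos-* c d)

module _ {In : ℤ → ℤ → Set} (convex : ConvexSymmetric In) where

  reflect : ConvexSymmetric (Reflected In)
  reflect {Y₁ = Y₁} {Y₂ = Y₂} {Y₃ = Y₃} {Y = Y} P Q R a b c D D≥1 ≤D X≡ Y≡ =
    convex P Q R a b c D D≥1 ≤D X≡ (trans (negate a Y₁ b Y₂ c Y₃) (trans (cong -_ Y≡) (ℤ.neg-distribʳ-* (+ D) Y)))
    where
    negate : ∀ a Y₁ b Y₂ c Y₃ → a * - Y₁ + b * - Y₂ + c * - Y₃ ≡ - (a * Y₁ + b * Y₂ + c * Y₃)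
    negate = solve-∀

  transpose : ConvexSymmetric (λ X Y → In Y X)
  transpose P Q R a b c D D≥1 ≤D X≡ Y≡ = convex P Q R a b c D D≥1 ≤D Y≡ X≡

  negate : ∀ {X Y} → In X Y → In (- X) (- Y)
  negate {X} {Y} P = convex P P P -1ℤ 0ℤ 0ℤ 1 ℕ.≤-refl ℕ.≤-refl (eq X) (eq Y)
    where
    eq : ∀ X → -1ℤ * X + 0ℤ * X + 0ℤ * X ≡ 1ℤ * - X
    eq = solve-∀

  -- The segment between the two points meets the horizontal axis at abscissa (z a + s m) / (z + s),
  -- so the task is 3 (z + s) ≤ z a + s m. Because of 5 ≤ a it suffices that 3 s ≤ 2 z + s m. This
  -- is clear for m ≥ 3; for m = 1 and m = 2 it follows from s ≤ b < m + z, and m = 0 contradicts z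
  -- ≤ b. If z = 0, the second point is itself on the axis.
  axis⁺ : ∀ {a b s m z} → 5 ℕ.≤ a → 2 ℕ.≤ b → s ℕ.≤ b → z ℕ.≤ b → suc b ℕ.≤ m ℕ.+ z →
          In (+ a) (+ s) → In (+ m) (- + z) → In (+ 3) (+ 0)
  axis⁺ {a} {b} {s} {m} {zero} 5≤a 2≤b s≤b z≤b b<m+z P Q =
    convex Q Q Q (+ 3) 0ℤ 0ℤ m (ℕ.≤-trans (s≤s z≤n) 3≤m) 3≤m (eq (+ m)) (eq′ (+ m))
    where
    3≤m : 3 ℕ.≤ m
    3≤m = ℕ.≤-trans (s≤s 2≤b) (subst (suc b ℕ.≤_) (ℕ.+-identityʳ m) b<m+z)
    eq : ∀ m → + 3 * m + 0ℤ * m + 0ℤ * m ≡ m * + 3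
    eq = solve-∀
    eq′ : ∀ m → 0ℤ ≡ m * 0ℤ
    eq′ = solve-∀
  axis⁺ {a} {b} {s} {m} {z@(suc _)} 5≤a 2≤b s≤b z≤b b<m+z P Q =
    convex P Q Q (+ (z ℕ.+ z ℕ.+ z)) (+ (s ℕ.+ s ℕ.+ s)) 0ℤ (z ℕ.* a ℕ.+ s ℕ.* m)
      (ℕ.≤-trans (ℕ.*-mono-≤ {1} {z} {1} {a} (s≤s z≤n) (ℕ.≤-trans (s≤s z≤n) 5≤a)) (ℕ.m≤m+n _ _))
      (ℕ.≤-trans (ℕ.≤-reflexive (ℕ.+-identityʳ _)) (weights m b<m+z))
      (trans (eqX (+ z) (+ a) (+ s) (+ m)) (cong (_* + 3) (sym (pos-+*+* z a s m))))
      (trans (eqY (+ z) (+ s)) (sym (ℤ.*-zeroʳ (+ (z ℕ.* a ℕ.+ s ℕ.* m)))))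
    where
    eqX : ∀ z a s m → (z + z + z) * a + (s + s + s) * m + 0ℤ * m ≡ (z * a + s * m) * + 3
    eqX = solve-∀
    eqY : ∀ z s → (z + z + z) * s + (s + s + s) * - z + 0ℤ * - z ≡ 0ℤ
    eqY = solve-∀
    bound : ∀ m → s ℕ.+ s ℕ.+ s ℕ.≤ z ℕ.+ z ℕ.+ s ℕ.* m → z ℕ.+ z ℕ.+ z ℕ.+ (s ℕ.+ s ℕ.+ s) ℕ.≤ z ℕ.* a ℕ.+ s ℕ.* m
    bound m h = begin
      z ℕ.+ z ℕ.+ z ℕ.+ (s ℕ.+ s ℕ.+ s)           ≤⟨ ℕ.+-monoʳ-≤ (z ℕ.+ z ℕ.+ z) h ⟩
      z ℕ.+ z ℕ.+ z ℕ.+ (z ℕ.+ z ℕ.+ s ℕ.* m)     ≡⟨ regroup z (s ℕ.* m) ⟩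
      z ℕ.* 5 ℕ.+ s ℕ.* m                         ≤⟨ ℕ.+-monoˡ-≤ (s ℕ.* m) (ℕ.*-monoʳ-≤ z 5≤a) ⟩
      z ℕ.* a ℕ.+ s ℕ.* m                         ∎
      where
      open ℕ.≤-Reasoning
      regroup : ∀ z t → z ℕ.+ z ℕ.+ z ℕ.+ (z ℕ.+ z ℕ.+ t) ≡ z ℕ.* 5 ℕ.+ t
      regroup = ℕ-Solver.solve-∀
    weights : ∀ m → suc b ℕ.≤ m ℕ.+ z → z ℕ.+ z ℕ.+ z ℕ.+ (s ℕ.+ s ℕ.+ s) ℕ.≤ z ℕ.* a ℕ.+ s ℕ.* m
    weights zero b<z = ⊥-elim (ℕ.<⇒≱ b<z z≤b)
    weights (suc zero) (s≤s b≤z) = bound 1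
      (ℕ.+-mono-≤ (ℕ.+-mono-≤ s≤z s≤z) (ℕ.≤-reflexive (sym (ℕ.*-identityʳ s))))
      where s≤z = ℕ.≤-trans s≤b b≤z
    weights (suc (suc zero)) (s≤s b≤1+z) = bound 2 (begin
      s ℕ.+ s ℕ.+ s          ≤⟨ ℕ.+-monoˡ-≤ s (ℕ.+-monoˡ-≤ s (ℕ.≤-trans s≤b (ℕ.≤-trans b≤1+z (ℕ.+-monoˡ-≤ z {1} {z} (s≤s z≤n))))) ⟩
      z ℕ.+ z ℕ.+ s ℕ.+ s    ≡⟨ regroup z s ⟩
      z ℕ.+ z ℕ.+ s ℕ.* 2    ∎)
      where
      open ℕ.≤-Reasoning
      regroup : ∀ z s → z ℕ.+ z ℕ.+ s ℕ.+ s ≡ z ℕ.+ z ℕ.+ s ℕ.* 2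
      regroup = ℕ-Solver.solve-∀
    weights m@(suc (suc (suc _))) _ = bound m (begin
      s ℕ.+ s ℕ.+ s          ≡⟨ regroup s ⟩
      s ℕ.* 3                ≤⟨ ℕ.*-monoʳ-≤ s {3} {m} (s≤s (s≤s (s≤s z≤n))) ⟩
      s ℕ.* m                ≤⟨ ℕ.m≤n+m _ _ ⟩
      z ℕ.+ z ℕ.+ s ℕ.* m    ∎)
      where
      open ℕ.≤-Reasoning
      regroup : ∀ s → s ℕ.+ s ℕ.+ s ≡ s ℕ.* 3
      regroup = ℕ-Solver.solve-∀

  -- The point (3 , 3) lies in the triangle of the three given points; the weights are its
  -- barycentric coordinates.
  corner⁺ : ∀ {x y} → 3 ℕ.≤ x → 3 ℕ.≤ y → In (+ 3) (+ 0) → In (+ 0) (+ 3) →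
            In (+ x) (+ y) → In (+ 3) (+ 3)
  corner⁺ {suc (suc (suc x))} {suc (suc (suc y))} (s≤s (s≤s (s≤s _))) (s≤s (s≤s (s≤s _))) P Q R =
    convex R P Q (+ 3) (+ y) (+ x) (3 ℕ.+ y ℕ.+ x) (s≤s z≤n) ℕ.≤-refl
      (eqX (+ x) (+ y)) (eqY (+ x) (+ y))
    where
    eqX : ∀ x y → + 3 * (+ 3 + x) + y * + 3 + x * + 0 ≡ (+ 3 + y + x) * + 3
    eqX = solve-∀
    eqY : ∀ x y → + 3 * (+ 3 + y) + y * + 0 + x * + 3 ≡ (+ 3 + y + x) * + 3
    eqY = solve-∀

  -- Cramer's rule gives the weights 3 (b - 1) and 3 (a - 1) over a b - 1. Their sum is small enough
  -- exactly when (a - 3) (b - 3) ≥ 4.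
  twoVertices : ∀ {a b} → 5 ℕ.≤ a → 5 ℕ.≤ b → In (+ a) (+ 1) → In (+ 1) (+ b) → In (+ 3) (+ 3)
  twoVertices {suc (suc (suc (suc (suc a))))} {suc (suc (suc (suc (suc b))))}
    (s≤s (s≤s (s≤s (s≤s (s≤s _))))) (s≤s (s≤s (s≤s (s≤s (s≤s _))))) P Q =
    convex P Q Q (+ (12 ℕ.+ b ℕ.+ b ℕ.+ b)) (+ (12 ℕ.+ a ℕ.+ a ℕ.+ a)) 0ℤ D (s≤s z≤n)
      (ℕ.≤-trans (ℕ.m≤m+n _ (a ℕ.+ a ℕ.+ b ℕ.+ b ℕ.+ a ℕ.* b)) (ℕ.≤-reflexive (weights a b (a ℕ.* b))))
      (trans (eqX (+ a) (+ b)) (cong (_* + 3) (sym D≡)))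
      (trans (eqY (+ a) (+ b)) (cong (_* + 3) (sym D≡)))
    where
    D = 24 ℕ.+ a ℕ.+ a ℕ.+ a ℕ.+ a ℕ.+ a ℕ.+ b ℕ.+ b ℕ.+ b ℕ.+ b ℕ.+ b ℕ.+ a ℕ.* b
    D≡ : + D ≡ + 24 + + a + + a + + a + + a + + a + + b + + b + + b + + b + + b + + a * + b
    D≡ = cong (_+_ (+ (24 ℕ.+ a ℕ.+ a ℕ.+ a ℕ.+ a ℕ.+ a ℕ.+ b ℕ.+ b ℕ.+ b ℕ.+ b ℕ.+ b))) (ℤ.pos-* a b)
    weights : ∀ a b c → 12 ℕ.+ b ℕ.+ b ℕ.+ b ℕ.+ (12 ℕ.+ a ℕ.+ a ℕ.+ a) ℕ.+ 0 ℕ.+ (a ℕ.+ a ℕ.+ b ℕ.+ b ℕ.+ c) ≡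
      24 ℕ.+ a ℕ.+ a ℕ.+ a ℕ.+ a ℕ.+ a ℕ.+ b ℕ.+ b ℕ.+ b ℕ.+ b ℕ.+ b ℕ.+ c
    weights = ℕ-Solver.solve-∀
    eqX : ∀ a b → (+ 12 + b + b + b) * (+ 5 + a) + (+ 12 + a + a + a) * + 1 + 0ℤ * + 1 ≡
      (+ 24 + a + a + a + a + a + b + b + b + b + b + a * b) * + 3
    eqX = solve-∀
    eqY : ∀ a b → (+ 12 + b + b + b) * + 1 + (+ 12 + a + a + a) * (+ 5 + b) + 0ℤ * (+ 5 + b) ≡
      (+ 24 + a + a + a + a + a + b + b + b + b + b + a * b) * + 3
    eqY = solve-∀

  -- Here the weights are 3 (a - 1) and 3 (a + 1) over a² + 1, so the condition is 6 a ≤ a² + 1,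
  -- with 6 as the least admissible value above 5.
  twoVertices′ : ∀ {a} → 6 ℕ.≤ a → In (+ a) -1ℤ → In (+ 1) (+ a) → In (+ 3) (+ 3)
  twoVertices′ {suc (suc (suc (suc (suc (suc a)))))} (s≤s (s≤s (s≤s (s≤s (s≤s (s≤s _)))))) P Q =
    convex P Q Q (+ (15 ℕ.+ a ℕ.+ a ℕ.+ a)) (+ (21 ℕ.+ a ℕ.+ a ℕ.+ a)) 0ℤ D (s≤s z≤n)
      (ℕ.≤-trans (ℕ.m≤m+n _ (1 ℕ.+ 6 ℕ.* a ℕ.+ a ℕ.* a)) (ℕ.≤-reflexive (weights a (a ℕ.* a))))
      (trans (eqX (+ a)) (cong (_* + 3) (sym D≡)))
      (trans (eqY (+ a)) (cong (_* + 3) (sym D≡)))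
    where
    D = 37 ℕ.+ (12 ℕ.* a ℕ.+ a ℕ.* a)
    D≡ : + D ≡ + 37 + (+ 12 * + a + + a * + a)
    D≡ = cong (_+_ (+ 37)) (pos-+*+* 12 a a a)
    weights : ∀ a c → 15 ℕ.+ a ℕ.+ a ℕ.+ a ℕ.+ (21 ℕ.+ a ℕ.+ a ℕ.+ a) ℕ.+ 0 ℕ.+ (1 ℕ.+ 6 ℕ.* a ℕ.+ c) ≡
      37 ℕ.+ (12 ℕ.* a ℕ.+ c)
    weights = ℕ-Solver.solve-∀
    eqX : ∀ a → (+ 15 + a + a + a) * (+ 6 + a) + (+ 21 + a + a + a) * + 1 + 0ℤ * + 1 ≡
      (+ 37 + (+ 12 * a + a * a)) * + 3
    eqX = solve-∀
    eqY : ∀ a → (+ 15 + a + a + a) * -1ℤ + (+ 21 + a + a + a) * (+ 6 + a) + 0ℤ * (+ 6 + a) ≡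
      (+ 37 + (+ 12 * a + a * a)) * + 3
    eqY = solve-∀

module _ {In : ℤ → ℤ → Set} (convex : ConvexSymmetric In) where

  -- Whichever side of the axis (a , Y₀) lies on, one of the points with large X + Y or large X - Y
  -- lies weakly on the other side and serves as the second end of the segment.
  axis : ∀ {a b Y₀ X₁ Y₁ X₂ Y₂} → 5 ℕ.≤ a → 2 ℕ.≤ b →
         In (+ a) Y₀ → ∣ Y₀ ∣ ℕ.≤ b →
         In X₁ Y₁ → ∣ X₁ ∣ ℕ.≤ suc b → ∣ Y₁ ∣ ℕ.≤ b → + suc b ≤ X₁ + Y₁ →
         In X₂ Y₂ → ∣ X₂ ∣ ℕ.≤ suc b → ∣ Y₂ ∣ ℕ.≤ b → + suc b ≤ X₂ - Y₂ →
         In (+ 3) (+ 0)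
  axis {b = b} {Y₀ = + s} {X₂ = X₂} {Y₂} 5≤a 2≤b P s≤b _ _ _ _ Q X≤ Y≤ b<
    with nonneg-summands {suc b} {X₂} { - Y₂} X≤ (ℕ.m≤n⇒m≤1+n (subst (ℕ._≤ b) (sym (ℤ.∣-i∣≡∣i∣ Y₂)) Y≤)) b<
  ... | m , z , refl , Y₂≡ , b<m+z = axis⁺ convex 5≤a 2≤b s≤b
    (subst (ℕ._≤ b) (trans (sym (ℤ.∣-i∣≡∣i∣ Y₂)) (cong ∣_∣ Y₂≡)) Y≤) b<m+z P
    (subst (In (+ m)) (trans (sym (ℤ.neg-involutive Y₂)) (cong -_ Y₂≡)) Q)
  axis {b = b} {Y₀ = -[1+ s ]} {X₁} {Y₁} 5≤a 2≤b P s≤b Q X≤ Y≤ b< _ _ _ _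
    with nonneg-summands {suc b} {X₁} {Y₁} X≤ (ℕ.m≤n⇒m≤1+n Y≤) b<
  ... | m , z , refl , refl , b<m+z = axis⁺ (reflect convex) 5≤a 2≤b s≤b Y≤ b<m+z P
    (subst (In (+ m)) (sym (ℤ.neg-involutive (+ z))) Q)

  corner : In (+ 3) (+ 0) → In (+ 0) (+ 3) → ∀ {X Y} → 3 ℕ.≤ ∣ X ∣ → 3 ℕ.≤ ∣ Y ∣ → In X Y → Diagonal In
  corner P Q {+ _}      {+ _}      3≤x 3≤y R = inj₁ (corner⁺ convex 3≤x 3≤y P Q R)
  corner P Q {+ _}      { -[1+ _ ]} 3≤x 3≤y R = inj₂ (corner⁺ (reflect convex) 3≤x 3≤y P (negate convex Q) R)
  corner P Q { -[1+ _ ]} {+ y}      3≤x 3≤y R = inj₂ (corner⁺ (reflect convex) 3≤x 3≤y P (negate convex Q) (negate convex R))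
  corner P Q { -[1+ _ ]} { -[1+ _ ]} 3≤x 3≤y R = inj₁ (corner⁺ convex 3≤x 3≤y P Q (negate convex R))

  cornerOrUnit : In (+ 3) (+ 0) → In (+ 0) (+ 3) → ∀ {X Y} → OddPoint In X Y → Diagonal In ⊎ (∣ X ∣ ≡ 1 ⊎ ∣ Y ∣ ≡ 1)
  cornerOrUnit P Q R with OddPoint.oddX R | OddPoint.oddY R
  ... | inj₁ x≡1 | _        = inj₂ (inj₁ x≡1)
  ... | inj₂ _   | inj₁ y≡1 = inj₂ (inj₂ y≡1)
  ... | inj₂ 3≤x | inj₂ 3≤y = inj₁ (corner P Q 3≤x 3≤y (OddPoint.inside R))

  -- Without a far point one coordinate is 1. It cannot be Y, since that would require X ≥ b > a;
  -- and X = 1 forces Y up to its bound b.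
  topVertex : In (+ 3) (+ 0) → In (+ 0) (+ 3) → ∀ {a b X Y} → a ℕ.< b → ∣ X ∣ ℕ.≤ a → ∣ Y ∣ ℕ.≤ b → + suc b ≤ X + Y →
          OddPoint In X Y → Diagonal In ⊎ In (+ 1) (+ b)
  topVertex P Q {a} {b} {X} {Y} a<b X≤ Y≤ b< R with cornerOrUnit P Q R
    | nonneg-summands {suc b} {X} {Y} (ℕ.≤-trans X≤ (ℕ.<⇒≤ (ℕ.m≤n⇒m≤1+n a<b))) (ℕ.m≤n⇒m≤1+n Y≤) b<
  ... | inj₁ done        | _ = inj₁ done
  ... | inj₂ (inj₁ refl) | .1 , z , refl , refl , s≤s b≤z = inj₂ (subst (λ t → In (+ 1) (+ t)) (ℕ.≤-antisym Y≤ b≤z) (OddPoint.inside R))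
  ... | inj₂ (inj₂ refl) | m , .1 , refl , refl , b<m+1 =
    ⊥-elim (ℕ.<⇒≱ a<b (ℕ.≤-trans (ℕ.s≤s⁻¹ (subst (suc b ℕ.≤_) (ℕ.+-comm m 1) b<m+1)) X≤))

reflectDiagonal : ∀ {In} → Diagonal (Reflected In) → Diagonal In
reflectDiagonal (inj₁ P) = inj₂ P
reflectDiagonal (inj₂ P) = inj₁ P

module _ {In : ℤ → ℤ → Set} (convex : ConvexSymmetric In)
         (P₁ : In (+ 3) (+ 0)) (P₂ : In (+ 0) (+ 3)) where

  -- If no odd point is far, the right vertex is (a , ±1), while both (1 , b) and (1 , -b) belong to
  -- the set. The one on the same side as the right vertex completes the pair for `twoVertices`.
  diagonal-< : ∀ {a b Y₀ X₁ Y₁ X₂ Y₂} → 5 ℕ.≤ a → a ℕ.< b →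
    OddPoint In (+ a) Y₀ →
    OddPoint In X₁ Y₁ → ∣ X₁ ∣ ℕ.≤ a → ∣ Y₁ ∣ ℕ.≤ b → + suc b ≤ X₁ + Y₁ →
    OddPoint (Reflected In) X₂ Y₂ → ∣ X₂ ∣ ℕ.≤ a → ∣ Y₂ ∣ ℕ.≤ b → + suc b ≤ X₂ + Y₂ →
    Diagonal In
  diagonal-< {a} {b} 5≤a a<b R R₁ X₁≤ Y₁≤ b<₁ R₂ X₂≤ Y₂≤ b<₂ =
    combine (OddPoint.inside R) (cornerOrUnit convex P₁ P₂ R)
      (topVertex convex P₁ P₂ a<b X₁≤ Y₁≤ b<₁ R₁)
      (topVertex (reflect convex) P₁ (negate convex P₂) a<b X₂≤ Y₂≤ b<₂ R₂)
    where
    5≤b = ℕ.≤-trans 5≤a (ℕ.<⇒≤ a<b)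
    combine : ∀ {Y} → In (+ a) Y → Diagonal In ⊎ (a ≡ 1 ⊎ ∣ Y ∣ ≡ 1) →
              Diagonal In ⊎ In (+ 1) (+ b) →
              Diagonal (Reflected In) ⊎ In (+ 1) (- + b) → Diagonal In
    combine _ (inj₁ done)         _           _           = done
    combine _ (inj₂ _)            (inj₁ done) _           = done
    combine _ (inj₂ _)            (inj₂ _)    (inj₁ done) = reflectDiagonal {In} done
    combine _ (inj₂ (inj₁ a≡1))   (inj₂ _)    (inj₂ _)    =
      ⊥-elim (ℕ.<⇒≱ (s≤s (s≤s z≤n)) (subst (5 ℕ.≤_) a≡1 5≤a))
    combine {+ _}       P (inj₂ (inj₂ refl)) (inj₂ Q) (inj₂ _) = inj₁ (twoVertices convex 5≤a 5≤b P Q)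
    combine { -[1+ _ ]} P (inj₂ (inj₂ refl)) (inj₂ _) (inj₂ Q) =
      inj₂ (twoVertices (reflect convex) 5≤a 5≤b P Q)

  -- With equal bounds the argument of `topVertex` breaks down, so the right and top vertices (a ,
  -- ±1) and (±1 , a) are compared directly. Equal signs lead to `twoVertices`; opposite signs need
  -- `twoVertices′`, whence 6 ≤ a.
  diagonal-≡ : ∀ {a X₀ Y₀} → 6 ℕ.≤ a → OddPoint In (+ a) Y₀ → OddPoint In X₀ (+ a) →
    Diagonal In
  diagonal-≡ {a} {X₀} {Y₀} 6≤a R S
    with cornerOrUnit convex P₁ P₂ R | cornerOrUnit convex P₁ P₂ S
  ... | inj₁ done | _ = done
  ... | inj₂ _ | inj₁ done = done
  ... | inj₂ (inj₁ refl) | _ = ⊥-elim (ℕ.<⇒≱ (s≤s (s≤s z≤n)) 6≤a)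
  ... | inj₂ _ | inj₂ (inj₂ refl) = ⊥-elim (ℕ.<⇒≱ (s≤s (s≤s z≤n)) 6≤a)
  ... | inj₂ (inj₂ Y₀≡) | inj₂ (inj₁ X₀≡) with X₀ | Y₀ | OddPoint.inside R | OddPoint.inside S
  ...   | + _      | + _      | P | Q with refl ← X₀≡ | refl ← Y₀≡ = inj₁ (twoVertices convex 5≤a 5≤a P Q)
    where 5≤a = ℕ.<⇒≤ 6≤a
  ...   | + _      | -[1+ _ ] | P | Q with refl ← X₀≡ | refl ← Y₀≡ = inj₁ (twoVertices′ convex 6≤a P Q)
  ...   | -[1+ _ ] | + _      | P | Q with refl ← X₀≡ | refl ← Y₀≡ =
    inj₂ (twoVertices′ (reflect convex) 6≤a P (negate convex Q))
  ...   | -[1+ _ ] | -[1+ _ ] | P | Q with refl ← X₀≡ | refl ← Y₀≡ =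
    inj₂ (twoVertices (reflect convex) 5≤a 5≤a P (negate convex Q))
    where 5≤a = ℕ.<⇒≤ 6≤a

-- The zonotope of the rows

𝟙 : Vector ℤ m
𝟙 _ = 1ℤ

IsSign : Vector ℤ m → Set
IsSign σ = ∀ i → ∣ σ i ∣ ≡ 1

sgn : ℤ → ℤ
sgn (+ _)    = 1ℤ
sgn -[1+ _ ] = -1ℤ

∣sgn∣ : ∀ z → ∣ sgn z ∣ ≡ 1
∣sgn∣ (+ _)    = refl
∣sgn∣ -[1+ _ ] = refl

sgn-* : ∀ z → sgn z * z ≡ + ∣ z ∣
sgn-* (+ n)    = ℤ.*-identityˡ (+ n)
sgn-* -[1+ n ] = ℤ.-1*i≡-i -[1+ n ]

support : ∀ (z : Vector ℤ m) → (sgn ∘ z) · z ≡ + ℓ¹ z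
support {zero}  z = refl
support {suc m} z = cong₂ _+_ (sgn-* (z zero)) (support (z ∘ suc))

∣·∣≤ℓ¹ : ∀ (d x : Vector ℤ m) → (∀ i → ∣ d i ∣ ℕ.≤ 1) → ∣ d · x ∣ ℕ.≤ ℓ¹ x
∣·∣≤ℓ¹ {zero}  d x d≤1 = z≤n
∣·∣≤ℓ¹ {suc m} d x d≤1 = begin
  ∣ d zero * x zero + (d ∘ suc) · (x ∘ suc) ∣          ≤⟨ ℤ.∣i+j∣≤∣i∣+∣j∣ (d zero * x zero) _ ⟩
  ∣ d zero * x zero ∣ ℕ.+ ∣ (d ∘ suc) · (x ∘ suc) ∣    ≤⟨ ℕ.+-mono-≤ head≤ (∣·∣≤ℓ¹ (d ∘ suc) (x ∘ suc) (d≤1 ∘ suc)) ⟩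
  ℓ¹ x                                               ∎
  where
  open ℕ.≤-Reasoning
  head≤ : ∣ d zero * x zero ∣ ℕ.≤ ∣ x zero ∣
  head≤ = begin
    ∣ d zero * x zero ∣         ≡⟨ ℤ.abs-* (d zero) (x zero) ⟩
    ∣ d zero ∣ ℕ.* ∣ x zero ∣   ≤⟨ ℕ.*-monoˡ-≤ ∣ x zero ∣ (d≤1 zero) ⟩
    1 ℕ.* ∣ x zero ∣            ≡⟨ ℕ.*-identityˡ ∣ x zero ∣ ⟩
    ∣ x zero ∣                  ∎

∣·∣-sign≤ℓ¹ : ∀ (σ x : Vector ℤ m) → IsSign σ → ∣ σ · x ∣ ℕ.≤ ℓ¹ x
∣·∣-sign≤ℓ¹ σ x sign = ∣·∣≤ℓ¹ σ x (λ i → ℕ.≤-reflexive (sign i))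

-- Signs are invisible modulo 2. Thus every sign sum of the rows has the parity that the coloring
-- criterion asks of its point.
sign-parity : ∀ (σ x : Vector ℤ m) → IsSign σ → + 2 ∣ 𝟙 · x + σ · x
sign-parity {zero}  σ x sign = divides 0ℤ refl
sign-parity {suc m} σ x sign = subst (+ 2 ∣_)
  (interchange (σ zero) (x zero) (𝟙 · (x ∘ suc)) ((σ ∘ suc) · (x ∘ suc)))
  (∣m∣n⇒∣m+n (even (σ zero) (sign zero)) (sign-parity (σ ∘ suc) (x ∘ suc) (sign ∘ suc)))
  where
  interchange : ∀ σ x a b → (x + σ * x) + (a + b) ≡ (1ℤ * x + a) + (σ * x + b)
  interchange = solve-∀
  double : ∀ a → a + 1ℤ * a ≡ a * + 2
  double = solve-∀
  cancel : ∀ a → a + -1ℤ * a ≡ 0ℤ * + 2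
  cancel = solve-∀
  even : ∀ s → ∣ s ∣ ≡ 1 → + 2 ∣ x zero + s * x zero
  even (+ .1)    refl = divides (x zero) (double (x zero))
  even -[1+ .0 ] refl = divides 0ℤ (cancel (x zero))

-- (X , Y) lies in the zonotope { Σ δᵢ (xᵢ , yᵢ) : -1 ≤ δᵢ ≤ 1 }, with δᵢ = coeff i / denom.
record Zonotope (x y : Vector ℤ m) (X Y : ℤ) : Set where
  field
    denom   : ℕ
    denom≥1 : 1 ℕ.≤ denom
    coeff   : Vector ℤ m
    coeff≤  : ∀ i → ∣ coeff i ∣ ℕ.≤ denom
    coeff·x : coeff · x ≡ + denom * X
    coeff·y : coeff · y ≡ + denom * Y

zonotope-vertex : ∀ (x y σ : Vector ℤ m) → (∀ i → ∣ σ i ∣ ℕ.≤ 1) → Zonotope x y (σ · x) (σ · y)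
zonotope-vertex x y σ σ≤1 = record
  { denom = 1 ; denom≥1 = ℕ.≤-refl ; coeff = σ ; coeff≤ = σ≤1
  ; coeff·x = sym (ℤ.*-identityˡ _) ; coeff·y = sym (ℤ.*-identityˡ _) }

zonotope-convex : ∀ (x y : Vector ℤ m) → ConvexSymmetric (Zonotope x y)
zonotope-convex x y P Q R a b c D D≥1 ≤D X≡ Y≡ = record
  { denom   = D ℕ.* E
  ; denom≥1 = ℕ.*-mono-≤ D≥1 (ℕ.*-mono-≤ P.denom≥1 (ℕ.*-mono-≤ Q.denom≥1 R.denom≥1))
  ; coeff   = coeff
  ; coeff≤  = coeff≤
  ; coeff·x = combine x P.coeff·x Q.coeff·x R.coeff·x X≡
  ; coeff·y = combine y P.coeff·y Q.coeff·y R.coeff·y Y≡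
  }
  where
  module P = Zonotope P
  module Q = Zonotope Q
  module R = Zonotope R
  p = P.denom
  q = Q.denom
  r = R.denom
  E = p ℕ.* (q ℕ.* r)
  -- Over the common denominator D p q r each coefficient is scaled by the other two denominators.
  -- The factor `1ℤ` below only gives the sum the shape to which `·-linearˡ` applies twice.
  α = a * (+ q * + r)
  β = b * (+ p * + r)
  γ = c * (+ p * + q)
  coeff : Vector ℤ _
  coeff i = 1ℤ * (α * P.coeff i + β * Q.coeff i) + γ * R.coeff i

  ∣term∣≤ : ∀ a q r {d p} → ∣ d ∣ ℕ.≤ p → ∣ a * (+ q * + r) * d ∣ ℕ.≤ ∣ a ∣ ℕ.* (q ℕ.* r) ℕ.* p
  ∣term∣≤ a q r {d} {p} d≤p = begin
    ∣ a * (+ q * + r) * d ∣          ≡⟨ ℤ.abs-* (a * (+ q * + r)) d ⟩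
    ∣ a * (+ q * + r) ∣ ℕ.* ∣ d ∣    ≡⟨ cong (ℕ._* ∣ d ∣) (trans (ℤ.abs-* a (+ q * + r)) (cong (∣ a ∣ ℕ.*_) (ℤ.abs-* (+ q) (+ r)))) ⟩
    ∣ a ∣ ℕ.* (q ℕ.* r) ℕ.* ∣ d ∣    ≤⟨ ℕ.*-monoʳ-≤ (∣ a ∣ ℕ.* (q ℕ.* r)) d≤p ⟩
    ∣ a ∣ ℕ.* (q ℕ.* r) ℕ.* p        ∎
    where open ℕ.≤-Reasoning

  coeff≤ : ∀ i → ∣ coeff i ∣ ℕ.≤ D ℕ.* E
  coeff≤ i = begin
    ∣ coeff i ∣
      ≤⟨ ℤ.∣i+j∣≤∣i∣+∣j∣ (1ℤ * (α * P.coeff i + β * Q.coeff i)) (γ * R.coeff i) ⟩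
    ∣ 1ℤ * (α * P.coeff i + β * Q.coeff i) ∣ ℕ.+ ∣ γ * R.coeff i ∣
      ≡⟨ cong (λ z → ∣ z ∣ ℕ.+ ∣ γ * R.coeff i ∣) (ℤ.*-identityˡ (α * P.coeff i + β * Q.coeff i)) ⟩
    ∣ α * P.coeff i + β * Q.coeff i ∣ ℕ.+ ∣ γ * R.coeff i ∣
      ≤⟨ ℕ.+-monoˡ-≤ _ (ℤ.∣i+j∣≤∣i∣+∣j∣ (α * P.coeff i) (β * Q.coeff i)) ⟩
    ∣ α * P.coeff i ∣ ℕ.+ ∣ β * Q.coeff i ∣ ℕ.+ ∣ γ * R.coeff i ∣
      ≤⟨ ℕ.+-mono-≤ (ℕ.+-mono-≤ (∣term∣≤ a q r (P.coeff≤ i)) (∣term∣≤ b p r (Q.coeff≤ i))) (∣term∣≤ c p q (R.coeff≤ i)) ⟩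
    ∣ a ∣ ℕ.* (q ℕ.* r) ℕ.* p ℕ.+ ∣ b ∣ ℕ.* (p ℕ.* r) ℕ.* q ℕ.+ ∣ c ∣ ℕ.* (p ℕ.* q) ℕ.* r
      ≡⟨ collect (∣ a ∣) (∣ b ∣) (∣ c ∣) p q r ⟩
    (∣ a ∣ ℕ.+ ∣ b ∣ ℕ.+ ∣ c ∣) ℕ.* E
      ≤⟨ ℕ.*-monoˡ-≤ E ≤D ⟩
    D ℕ.* E ∎
    where
    open ℕ.≤-Reasoning
    collect : ∀ a b c p q r → a ℕ.* (q ℕ.* r) ℕ.* p ℕ.+ b ℕ.* (p ℕ.* r) ℕ.* q ℕ.+ c ℕ.* (p ℕ.* q) ℕ.* r ≡
      (a ℕ.+ b ℕ.+ c) ℕ.* (p ℕ.* (q ℕ.* r))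
    collect = ℕ-Solver.solve-∀

  combine : ∀ z {Z₁ Z₂ Z₃ Z} → P.coeff · z ≡ + p * Z₁ → Q.coeff · z ≡ + q * Z₂ → R.coeff · z ≡ + r * Z₃ →
            a * Z₁ + b * Z₂ + c * Z₃ ≡ + D * Z → coeff · z ≡ + (D ℕ.* E) * Z
  combine z {Z₁} {Z₂} {Z₃} {Z} eq₁ eq₂ eq₃ eq = begin
    coeff · z
      ≡⟨ ·-linearˡ 1ℤ (λ i → α * P.coeff i + β * Q.coeff i) γ R.coeff z ⟩
    1ℤ * ((λ i → α * P.coeff i + β * Q.coeff i) · z) + γ * (R.coeff · z)
      ≡⟨ cong₂ (λ s t → 1ℤ * s + γ * t) (trans (·-linearˡ α P.coeff β Q.coeff z) (cong₂ (λ s t → α * s + β * t) eq₁ eq₂)) eq₃ ⟩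
    1ℤ * (α * (+ p * Z₁) + β * (+ q * Z₂)) + γ * (+ r * Z₃)
      ≡⟨ collect a b c (+ p) (+ q) (+ r) Z₁ Z₂ Z₃ ⟩
    (a * Z₁ + b * Z₂ + c * Z₃) * (+ p * (+ q * + r))
      ≡⟨ cong (_* (+ p * (+ q * + r))) eq ⟩
    + D * Z * (+ p * (+ q * + r))
      ≡⟨ swap (+ D) Z (+ p * (+ q * + r)) ⟩
    + D * (+ p * (+ q * + r)) * Z
      ≡⟨ cong (_* Z) (sym (trans (ℤ.pos-* D E) (cong (+ D *_) (trans (ℤ.pos-* p (q ℕ.* r)) (cong (+ p *_) (ℤ.pos-* q r)))))) ⟩
    + (D ℕ.* E) * Z ∎
    where
    open ≡-Reasoning
    collect : ∀ a b c p q r X Y Z →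
      1ℤ * (a * (q * r) * (p * X) + b * (p * r) * (q * Y)) + c * (p * q) * (r * Z) ≡
      (a * X + b * Y + c * Z) * (p * (q * r))
    collect = solve-∀
    swap : ∀ D Z E → D * Z * E ≡ D * E * Z
    swap = solve-∀

-- With δᵢ = coeffᵢ / denom, the point θᵢ = 1/2 + δᵢ/6 of [1/3 , 2/3] satisfies θ · x ∈ ℤ and θ · y ∈ ℤ.
zonotope⇒circular₃ : ∀ {x y : Vector ℤ m} {X Y} → Zonotope x y (+ 3 * X) (+ 3 * Y) →
                     + 2 ∣ 𝟙 · x + X → + 2 ∣ 𝟙 · y + Y → CircularColoring 3 x y
zonotope⇒circular₃ {x = x} {y} {X} {Y} Z evenX evenY = record
  { unit      = D ℕ.+ D
  ; unit≥1    = ℕ.≤-trans denom≥1 (ℕ.m≤m+n D D)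
  ; weight    = w
  ; weight≥   = lower
  ; weight≤   = upper
  ; ∣weight·u = divisible x evenX coeff·x
  ; ∣weight·v = divisible y evenY coeff·y
  }
  where
  open Zonotope Z renaming (denom to D)
  -- The numerators of θ over 6 D, which is three times `unit`. Then w · z = 3 D (𝟙 · z + Z), and
  -- the parity hypothesis contributes the missing factor 2.
  w : Vector ℤ _
  w i = + (D ℕ.+ D ℕ.+ D) * 1ℤ + 1ℤ * coeff i

  lower : ∀ i → D ℕ.+ D ℕ.≤ ∣ w i ∣
  lower i = ℕ.+-cancelʳ-≤ D _ _ (begin
    D ℕ.+ D ℕ.+ D           ≡⟨ cong ∣_∣ (cancel (+ (D ℕ.+ D ℕ.+ D)) (coeff i)) ⟩
    ∣ w i - coeff i ∣       ≤⟨ ℤ.∣i-j∣≤∣i∣+∣j∣ (w i) (coeff i) ⟩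
    ∣ w i ∣ ℕ.+ ∣ coeff i ∣ ≤⟨ ℕ.+-monoʳ-≤ ∣ w i ∣ (coeff≤ i) ⟩
    ∣ w i ∣ ℕ.+ D           ∎)
    where
    open ℕ.≤-Reasoning
    cancel : ∀ t d → t ≡ t * 1ℤ + 1ℤ * d - d
    cancel = solve-∀

  upper : ∀ i → D ℕ.+ D ℕ.+ ∣ w i ∣ ℕ.≤ 3 ℕ.* (D ℕ.+ D)
  upper i = begin
    D ℕ.+ D ℕ.+ ∣ w i ∣ ≡⟨ cong (λ z → D ℕ.+ D ℕ.+ ∣ z ∣) (cong₂ _+_ (ℤ.*-identityʳ (+ (D ℕ.+ D ℕ.+ D))) (ℤ.*-identityˡ (coeff i))) ⟩
    D ℕ.+ D ℕ.+ ∣ + (D ℕ.+ D ℕ.+ D) + coeff i ∣ ≤⟨ ℕ.+-monoʳ-≤ (D ℕ.+ D) (ℤ.∣i+j∣≤∣i∣+∣j∣ (+ (D ℕ.+ D ℕ.+ D)) (coeff i)) ⟩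
    D ℕ.+ D ℕ.+ (D ℕ.+ D ℕ.+ D ℕ.+ ∣ coeff i ∣) ≤⟨ ℕ.+-monoʳ-≤ (D ℕ.+ D) (ℕ.+-monoʳ-≤ (D ℕ.+ D ℕ.+ D) (coeff≤ i)) ⟩
    D ℕ.+ D ℕ.+ (D ℕ.+ D ℕ.+ D ℕ.+ D) ≡⟨ regroup D ⟩
    3 ℕ.* (D ℕ.+ D) ∎
    where
    open ℕ.≤-Reasoning
    regroup : ∀ D → D ℕ.+ D ℕ.+ (D ℕ.+ D ℕ.+ D ℕ.+ D) ≡ 3 ℕ.* (D ℕ.+ D)
    regroup = ℕ-Solver.solve-∀

  divisible : ∀ z {Z} → + 2 ∣ 𝟙 · z + Z → coeff · z ≡ + D * (+ 3 * Z) → + (3 ℕ.* (D ℕ.+ D)) ∣ w · z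
  divisible z {Z} (divides q eq) coeff·z = divides q (begin
    w · z
      ≡⟨ ·-linearˡ (+ (D ℕ.+ D ℕ.+ D)) 𝟙 1ℤ coeff z ⟩
    + (D ℕ.+ D ℕ.+ D) * (𝟙 · z) + 1ℤ * (coeff · z)
      ≡⟨ cong (λ t → + (D ℕ.+ D ℕ.+ D) * (𝟙 · z) + 1ℤ * t) coeff·z ⟩
    (+ D + + D + + D) * (𝟙 · z) + 1ℤ * (+ D * (+ 3 * Z))
      ≡⟨ collect (+ D) (𝟙 · z) Z ⟩
    + 3 * + D * (𝟙 · z + Z)
      ≡⟨ cong (+ 3 * + D *_) eq ⟩
    + 3 * + D * (q * + 2)
      ≡⟨ double (+ D) q ⟩
    q * (+ 3 * (+ D + + D))
      ≡⟨ cong (q *_) (sym (ℤ.pos-* 3 (D ℕ.+ D))) ⟩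
    q * + (3 ℕ.* (D ℕ.+ D)) ∎)
    where
    open ≡-Reasoning
    collect : ∀ D s Z → (D + D + D) * s + 1ℤ * (D * (+ 3 * Z)) ≡ + 3 * D * (s + Z)
    collect = solve-∀
    double : ∀ D q → + 3 * D * (q * + 2) ≡ q * (+ 3 * (D + D))
    double = solve-∀

-- Bases with a vector of norm 3

·≡ℓ¹ : ∀ (d x z : Vector ℤ m) → (∀ i → d i * x i ≡ + ∣ z i ∣) → d · x ≡ + ℓ¹ z
·≡ℓ¹ {zero}  d x z eq = refl
·≡ℓ¹ {suc m} d x z eq = cong₂ _+_ (eq zero) (·≡ℓ¹ (d ∘ suc) (x ∘ suc) (z ∘ suc) (eq ∘ suc))

·≡0 : ∀ (d x : Vector ℤ m) → (∀ i → d i * x i ≡ 0ℤ) → d · x ≡ 0ℤ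
·≡0 {zero}  d x eq = refl
·≡0 {suc m} d x eq = cong₂ _+_ (eq zero) (·≡0 (d ∘ suc) (x ∘ suc) (eq ∘ suc))

sgn₀ : ℤ → ℤ
sgn₀ +0       = 0ℤ
sgn₀ +[1+ _ ] = 1ℤ
sgn₀ -[1+ _ ] = -1ℤ

sgn₀-* : ∀ z → sgn₀ z * z ≡ + ∣ z ∣
sgn₀-* +0       = refl
sgn₀-* +[1+ n ] = ℤ.*-identityˡ +[1+ n ]
sgn₀-* -[1+ n ] = ℤ.-1*i≡-i -[1+ n ]

-- Singles out the rows of the form (0 , a): on the face where the first coordinate is extremal,
-- only their coefficients remain free.
whenZero : ℤ → ℤ → ℤ
whenZero +0 a = a
whenZero _  a = 0ℤ

whenZero-*ʳ : ∀ z a → whenZero z a * z ≡ 0ℤ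
whenZero-*ʳ +0       a = ℤ.*-zeroʳ a
whenZero-*ʳ +[1+ n ] a = refl
whenZero-*ʳ -[1+ n ] a = refl

whenZero-sgn-* : ∀ z a → whenZero z (sgn a) * a ≡ + ∣ whenZero z a ∣
whenZero-sgn-* +0       a = sgn-* a
whenZero-sgn-* +[1+ n ] a = refl
whenZero-sgn-* -[1+ n ] a = refl

whenZero≡0 : ∀ z {a} → whenZero z a ≡ 0ℤ → z ≡ 0ℤ → a ≡ 0ℤ
whenZero≡0 +0 a≡0 _ = a≡0

∣whenZero∣≡1 : ∀ z {a} → ∣ whenZero z a ∣ ≡ 1 → z ≡ 0ℤ × ∣ a ∣ ≡ 1
∣whenZero∣≡1 +0 eq = refl , eq

-- A nonzero row (z , a) is flipped by its sign so that its first nonzero entry is positive.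
rowSign : ℤ → ℤ → ℤ
rowSign z a = sgn₀ z + whenZero z (sgn a)

∣rowSign∣ : ∀ z a → ∣ rowSign z a ∣ ≡ 1
∣rowSign∣ +0       (+ _)    = refl
∣rowSign∣ +0       -[1+ _ ] = refl
∣rowSign∣ +[1+ _ ] a        = refl
∣rowSign∣ -[1+ _ ] a        = refl

rowSign-*ˡ : ∀ z a → rowSign z a * z ≡ + ∣ z ∣
rowSign-*ˡ z a = begin
  (sgn₀ z + whenZero z (sgn a)) * z       ≡⟨ ℤ.*-distribʳ-+ z (sgn₀ z) (whenZero z (sgn a)) ⟩
  sgn₀ z * z + whenZero z (sgn a) * z     ≡⟨ cong₂ _+_ (sgn₀-* z) (whenZero-*ʳ z (sgn a)) ⟩
  + ∣ z ∣ + 0ℤ                            ≡⟨ ℤ.+-identityʳ (+ ∣ z ∣) ⟩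
  + ∣ z ∣                                 ∎
  where open ≡-Reasoning

rowSign-*ʳ : ∀ z a → rowSign z a * a ≡ sgn₀ z * a + + ∣ whenZero z a ∣
rowSign-*ʳ z a = trans (ℤ.*-distribʳ-+ a (sgn₀ z) (whenZero z (sgn a)))
  (cong (_+_ (sgn₀ z * a)) (whenZero-sgn-* z a))

-- These are the coefficients of a point on that face: rows with z ≠ 0 are pinned at ±K, and the
-- other rows share the free parameter `c`.
∣mix∣≤ : ∀ z a {K c} → ∣ c ∣ ℕ.≤ K → ∣ + K * sgn₀ z + c * whenZero z (sgn a) ∣ ℕ.≤ K
∣mix∣≤ +0 a {K} {c} c≤K = begin
  ∣ + K * 0ℤ + c * sgn a ∣ ≡⟨ cong ∣_∣ (trans (cong (_+ c * sgn a) (ℤ.*-zeroʳ (+ K))) (ℤ.+-identityˡ (c * sgn a))) ⟩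
  ∣ c * sgn a ∣            ≡⟨ ℤ.abs-* c (sgn a) ⟩
  ∣ c ∣ ℕ.* ∣ sgn a ∣      ≡⟨ trans (cong (∣ c ∣ ℕ.*_) (∣sgn∣ a)) (ℕ.*-identityʳ ∣ c ∣) ⟩
  ∣ c ∣                    ≤⟨ c≤K ⟩
  K                        ∎
  where open ℕ.≤-Reasoning
∣mix∣≤ +[1+ _ ] a {K} {c} _ = ℕ.≤-reflexive (cong ∣_∣ (eq (+ K) c))
  where
  eq : ∀ K c → K * 1ℤ + c * 0ℤ ≡ K
  eq = solve-∀
∣mix∣≤ -[1+ _ ] a {K} {c} _ = ℕ.≤-reflexive (trans (cong ∣_∣ (eq (+ K) c)) (ℤ.∣-i∣≡∣i∣ (+ K)))
  where
  eq : ∀ K c → K * -1ℤ + c * 0ℤ ≡ - K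
  eq = solve-∀

length≤sum : ∀ {n} (f : Vector ℕ n) → (∀ i → 1 ℕ.≤ f i) → n ℕ.≤ sumℕ f
length≤sum {zero}  f f≥1 = z≤n
length≤sum {suc n} f f≥1 = ℕ.+-mono-≤ (f≥1 zero) (length≤sum (f ∘ suc) (f≥1 ∘ suc))

sum≡length⇒ones : ∀ {n} (f : Vector ℕ n) → (∀ i → 1 ℕ.≤ f i) → sumℕ f ≡ n → ∀ i → f i ≡ 1
sum≡length⇒ones {suc n} f f≥1 eq = λ where
    zero    → ℕ.≤-antisym f₀≤1 (f≥1 zero)
    (suc i) → sum≡length⇒ones (f ∘ suc) (f≥1 ∘ suc) (ℕ.≤-antisym rest≤n (length≤sum (f ∘ suc) (f≥1 ∘ suc))) i
  where
  f₀≤1 : f zero ℕ.≤ 1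
  f₀≤1 = ℕ.+-cancelʳ-≤ n (f zero) 1 (ℕ.≤-trans (ℕ.+-monoʳ-≤ (f zero) (length≤sum (f ∘ suc) (f≥1 ∘ suc))) (ℕ.≤-reflexive eq))
  rest≤n : sumℕ (f ∘ suc) ℕ.≤ n
  rest≤n = ℕ.s≤s⁻¹ (ℕ.≤-trans (ℕ.+-monoˡ-≤ (sumℕ (f ∘ suc)) (f≥1 zero)) (ℕ.≤-reflexive eq))

sum≡0⇒zeros : ∀ {n} (f : Vector ℕ n) → sumℕ f ≡ 0 → ∀ i → f i ≡ 0
sum≡0⇒zeros f eq zero    = ℕ.m+n≡0⇒m≡0 (f zero) eq
sum≡0⇒zeros f eq (suc i) = sum≡0⇒zeros (f ∘ suc) (ℕ.m+n≡0⇒n≡0 (f zero) eq) i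

sum≡1⇒single : ∀ {n} (f : Vector ℕ n) → sumℕ f ≡ 1 → ∃[ i ] f i ≡ 1 × (∀ j → j ≢ i → f j ≡ 0)
sum≡1⇒single {suc n} f eq with f zero in f₀
... | suc zero = zero , f₀ , λ where
  zero    j≢0 → ⊥-elim (j≢0 refl)
  (suc j) _   → sum≡0⇒zeros (f ∘ suc) (ℕ.suc-injective eq) j
... | zero with sum≡1⇒single (f ∘ suc) eq
...   | i , fi≡1 , rest = suc i , fi≡1 , λ where
  zero    _   → f₀
  (suc j) j≢i → rest j (j≢i ∘ cong suc)

-- Exceptional bases and signed permutations

record ExceptionalBasis (x y : Vector ℤ 4) : Set where
  field
    permutation : Matrix 4 4
    signed : SignedPermutation permutation
    a b c : ℤ
    column₀≡ : ∀ i → permutation i · x ≡ exceptionalMatrix a b c i zero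
    column₁≡ : ∀ i → permutation i · y ≡ exceptionalMatrix a b c i (suc zero)
    3∣a+b+c : + 3 Unsigned.∣ a + b + c

signedMatrix : ∀ {n} → (Fin n → Fin n) → Vector ℤ n → Matrix n n
signedMatrix π σ i j = σ j * e (π i) j

signedMatrix-· : ∀ {n} (π : Fin n → Fin n) (σ x : Vector ℤ n) i →
                 signedMatrix π σ i · x ≡ σ (π i) * x (π i)
signedMatrix-· π σ x i = trans (move (e (π i)) x σ) (·-e (λ j → σ j * x j) (π i))
  where
  swap : ∀ s a b → s * a * b ≡ s * b * a
  swap = solve-∀
  move : ∀ {n} (w x σ : Vector ℤ n) → (λ j → σ j * w j) · x ≡ (λ j → σ j * x j) · w
  move {zero}  w x σ = refl
  move {suc n} w x σ = cong₂ _+_ (swap (σ zero) (w zero) (x zero)) (move (w ∘ suc) (x ∘ suc) (σ ∘ suc))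

signedMatrix-signedPermutation : ∀ {n} (π : Fin n → Fin n) (σ : Vector ℤ n) →
  (∀ i j → π i ≡ π j → i ≡ j) → (∀ j → ∃[ i ] π i ≡ j) → IsSign σ →
  SignedPermutation (signedMatrix π σ)
signedMatrix-signedPermutation π σ injective surjective sign = record
  { row     = λ i → π i , diagonal i , λ {j} → nonzero⇒≡ i j
  ; column  = λ j → column j (surjective j)
  ; nonzero = λ i j nz → ∣z∣≡1⇒unit (σ j * e (π i) j) (trans (cong ∣_∣ (entry (nonzero⇒≡ i j nz))) (sign j))
  }
  where
  entry : ∀ {i j} → i ≡ j → σ j * e i j ≡ σ j
  entry {i} refl = trans (cong (σ i *_) (e-diagonal i)) (ℤ.*-identityʳ (σ i))
  diagonal : ∀ i → signedMatrix π σ i (π i) ≢ 0ℤ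
  diagonal i eq with () ← trans (sym (sign (π i)))
    (cong ∣_∣ (trans (sym (entry {π i} refl)) eq))
  nonzero⇒≡ : ∀ i j → signedMatrix π σ i j ≢ 0ℤ → π i ≡ j
  nonzero⇒≡ i j nz with π i Fin.≟ j
  ... | yes eq = eq
  ... | no  _  = ⊥-elim (nz (ℤ.*-zeroʳ (σ j)))
  column : ∀ j → ∃[ i ] π i ≡ j → ∃! _≡_ (λ i → signedMatrix π σ i j ≢ 0ℤ)
  column .(π i) (i , refl) = i , diagonal i , λ {i′} nz → injective i i′ (sym (nonzero⇒≡ i′ (π i) nz))

-- The row (0 , 1) stands last in the exceptional matrix; `i₀` will be the row (0 , ±1).
lastRow : Fin 4 → Fin 4 → Fin 4
lastRow i₀ = punchIn i₀ zero ∷ punchIn i₀ (suc zero) ∷ punchIn i₀ (suc (suc zero)) ∷ i₀ ∷ []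

lastRow-injective : ∀ i₀ i j → lastRow i₀ i ≡ lastRow i₀ j → i ≡ j
lastRow-injective = from-yes (Fin.all? λ i₀ → Fin.all? λ i → Fin.all? λ j →
  (lastRow i₀ i Fin.≟ lastRow i₀ j) →-dec (i Fin.≟ j))

lastRow-surjective : ∀ i₀ j → ∃[ i ] lastRow i₀ i ≡ j
lastRow-surjective = from-yes (Fin.all? λ i₀ → Fin.all? λ j → Fin.any? λ i → lastRow i₀ i Fin.≟ j)

-- The face of the zonotope at height 3

module _ (x y : Vector ℤ m) (ℓ¹x≡3 : ℓ¹ x ≡ 3) where

  private
    s t y₀ σ : Vector ℤ m
    s i  = sgn₀ (x i)
    t i  = whenZero (x i) (sgn (y i))
    y₀ i = whenZero (x i) (y i)
    σ i  = rowSign (x i) (y i)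
    K = ℓ¹ y₀

    s·x : s · x ≡ + 3
    s·x = trans (·≡ℓ¹ s x x (λ i → sgn₀-* (x i))) (cong +_ ℓ¹x≡3)

    t·x : t · x ≡ 0ℤ
    t·x = ·≡0 t x (λ i → whenZero-*ʳ (x i) (sgn (y i)))

    t·y : t · y ≡ + K
    t·y = ·≡ℓ¹ t y y₀ (λ i → whenZero-sgn-* (x i) (y i))

    σ·y : σ · y ≡ s · y + + K
    σ·y = begin
      σ · y                              ≡⟨ ·-comm σ y ⟩
      y · (λ i → s i + t i)              ≡⟨ ·-+ʳ y s t ⟩
      y · s + y · t                      ≡⟨ cong₂ _+_ (·-comm y s) (trans (·-comm y t) t·y) ⟩
      s · y + + K                        ∎
      where open ≡-Reasoning

  -- Uses the point of the face X = 3 that lies 2r below its upper end (3 , s · y + K).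
  face : ∀ r → 1 ℕ.≤ K → r ℕ.≤ K → + 3 ∣ s · y + + K + + r → CircularColoring 3 x y
  face r K≥1 r≤K (divides q eq) = zonotope⇒circular₃ {X = 1ℤ} {Y = q - + r} (record
    { denom = K ; denom≥1 = K≥1
    ; coeff = λ i → + K * s i + c * t i
    ; coeff≤ = λ i → ∣mix∣≤ (x i) (y i) {K} {c} c≤K
    ; coeff·x = trans (·-linearˡ (+ K) s c t x) (trans (cong₂ (λ a b → + K * a + c * b) s·x t·x) (onX (+ K) c))
    ; coeff·y = trans (·-linearˡ (+ K) s c t y) (trans (cong (λ b → + K * (s · y) + c * b) t·y)
        (trans (onY (+ K) (s · y) (+ r)) (trans (cong (λ z → + K * (z - + 3 * + r)) eq) (factor (+ K) q (+ r)))))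
    }) evenX evenY
    where
    c = + K - + r - + r
    c≤K : ∣ c ∣ ℕ.≤ K
    c≤K = begin
      ∣ + K - + r - + r ∣ ≡⟨ cong (λ z → ∣ z - + r ∣) (trans (ℤ.m-n≡m⊖n K r) (ℤ.⊖-≥ r≤K)) ⟩
      ∣ + (K ℕ.∸ r) - + r ∣ ≡⟨ cong ∣_∣ (ℤ.m-n≡m⊖n (K ℕ.∸ r) r) ⟩
      ∣ (K ℕ.∸ r) ⊖ r ∣ ≤⟨ ℤ.∣m⊝n∣≤m⊔n (K ℕ.∸ r) r ⟩
      (K ℕ.∸ r) ℕ.⊔ r ≤⟨ ℕ.⊔-lub (ℕ.m∸n≤m K r) r≤K ⟩
      K ∎
      where open ℕ.≤-Reasoning
    onX : ∀ K c → K * + 3 + c * 0ℤ ≡ K * + 3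
    onX = solve-∀
    onY : ∀ K a r → K * a + (K - r - r) * K ≡ K * (a + K + r - + 3 * r)
    onY = solve-∀
    factor : ∀ K q r → K * (q * + 3 - + 3 * r) ≡ K * (+ 3 * (q - r))
    factor = solve-∀
    evenX : + 2 ∣ 𝟙 · x + 1ℤ
    evenX = subst (+ 2 ∣_) (trans (cong (λ z → 𝟙 · x + z - + 2) (trans (support x) (cong +_ ℓ¹x≡3))) (ℤ.+-assoc (𝟙 · x) (+ 3) (- + 2)))
      (∣m∣n⇒∣m-n (sign-parity (sgn ∘ x) x (λ i → ∣sgn∣ (x i))) ∣-refl)
    evenY : + 2 ∣ 𝟙 · y + (q - + r)
    evenY = subst (+ 2 ∣_) (trans (cong (λ z → 𝟙 · y + z + - q * + 2) σ·y)
        (trans (shift (𝟙 · y) (s · y) (+ K) (+ r) q) (trans (cong (λ z → 𝟙 · y + z - + 2 * q - + r) eq) (cancel (𝟙 · y) q (+ r)))))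
      (∣m∣n⇒∣m+n (sign-parity σ y (λ i → ∣rowSign∣ (x i) (y i))) (divides (- q) refl))
      where
      shift : ∀ o a K r q → o + (a + K) + - q * + 2 ≡ o + (a + K + r) - + 2 * q - r
      shift = solve-∀
      cancel : ∀ o q r → o + q * + 3 - + 2 * q - r ≡ o + (q - r)
      cancel = solve-∀

  -- Steps of 2 down the face preserve the parity of the ordinate and run through all residues
  -- modulo 3, so some r ≤ 2 is right. It overshoots the face, whose length is 2 K, only if K = 1
  -- and r = 2.
  residue₃ : 1 ℕ.≤ K → CircularColoring 3 x y ⊎ (K ≡ 1 × + 3 ∣ s · y)
  residue₃ K≥1 = byResidue (r ℕ.≤? K)
    where
    open ≡-Reasoning
    r = - (s · y + + K) %ℕ 3
    flip : ∀ a r → - (- a - r) ≡ a + r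
    flip = solve-∀
    3∣ : + 3 ∣ s · y + + K + + r
    3∣ = subst (+ 3 ∣_) (flip (s · y + + K) (+ r)) (∣m⇒∣-m (%ℕ-∣ (- (s · y + + K)) 3))
    r<3 : r ℕ.< 3
    r<3 = ℤ.n%ℕd<d (- (s · y + + K)) 3
    cancel : ∀ a → a + + 1 + + 2 - + 3 ≡ a
    cancel = solve-∀
    byResidue : Dec (r ℕ.≤ K) → CircularColoring 3 x y ⊎ (K ≡ 1 × + 3 ∣ s · y)
    byResidue (yes r≤K) = inj₁ (face r K≥1 r≤K 3∣)
    byResidue (no  r≰K) = inj₂ (K≡1 , subst (+ 3 ∣_) (begin
      s · y + + K + + r - + 3   ≡⟨ cong₂ (λ K r → s · y + + K + + r - + 3) K≡1 r≡2 ⟩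
      s · y + + 1 + + 2 - + 3   ≡⟨ cancel (s · y) ⟩
      s · y                     ∎) (∣m∣n⇒∣m-n 3∣ ∣-refl))
      where
      K<r : K ℕ.< r
      K<r = ℕ.≰⇒> r≰K
      K≡1 : K ≡ 1
      K≡1 = ℕ.≤-antisym (ℕ.s≤s⁻¹ (ℕ.≤-trans K<r (ℕ.s≤s⁻¹ r<3))) K≥1
      r≡2 : r ≡ 2
      r≡2 = ℕ.≤-antisym (ℕ.s≤s⁻¹ r<3) (ℕ.≤-trans (s≤s K≥1) K<r)

-- The face fails only if K = 1. Then exactly one row is (0 , ±1), and the other three share the
-- norm 3 of x; divisibility by 3 of the centre of the face becomes the condition on a + b + c.
norm3⇒circular₃⊎exceptional : ∀ (x y : Vector ℤ 4) → (∀ i → ¬ (x i ≡ 0ℤ × y i ≡ 0ℤ)) → ℓ¹ x ≡ 3 →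
        CircularColoring 3 x y ⊎ ExceptionalBasis x y
norm3⇒circular₃⊎exceptional x y nonzero ℓ¹x≡3 with residue₃ x y ℓ¹x≡3 K≥1
  where
  y₀ : Vector ℤ 4
  y₀ i = whenZero (x i) (y i)
  -- K = 0 would mean that x vanishes in no row, as there are no zero rows; four nonzero entries
  -- have norm at least 4.
  K≥1 : 1 ℕ.≤ ℓ¹ y₀
  K≥1 with ℓ¹ y₀ in eq
  ... | suc _ = s≤s z≤n
  ... | zero  = ⊥-elim (ℕ.<⇒≱ (s≤s (ℕ.≤-reflexive ℓ¹x≡3)) (length≤sum (∣_∣ ∘ x) (λ i → ℕ.n≢0⇒n>0 (λ xi≡0 →
          let xi≡0 = ℤ.∣i∣≡0⇒i≡0 xi≡0 in
          nonzero i (xi≡0 , whenZero≡0 (x i) (ℤ.∣i∣≡0⇒i≡0 (sum≡0⇒zeros (∣_∣ ∘ y₀) eq i)) xi≡0)))))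
... | inj₁ circular = inj₁ circular
... | inj₂ (K≡1 , 3∣) with sum≡1⇒single (λ i → ∣ whenZero (x i) (y i) ∣) K≡1
...   | i₀ , y₀i₀≡1 , others = inj₂ (record
  { permutation = signedMatrix π σ
  ; signed = signedMatrix-signedPermutation π σ (lastRow-injective i₀) (lastRow-surjective i₀)
               (λ i → ∣rowSign∣ (x i) (y i))
  ; a = b zero ; b = b (suc zero) ; c = b (suc (suc zero))
  ; column₀≡ = λ i → trans (signedMatrix-· π σ x i) (trans (rowSign-*ˡ (x (π i)) (y (π i))) (first i))
  ; column₁≡ = λ i → trans (signedMatrix-· π σ y i) (trans (rowSign-*ʳ (x (π i)) (y (π i))) (second i))
  ; 3∣a+b+c = ∣⇒∣ᵤ (subst (+ 3 ∣_) total 3∣)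
  })
  where
  π = lastRow i₀
  σ b : Vector ℤ _
  σ i = rowSign (x i) (y i)
  b j = sgn₀ (x (punchIn i₀ j)) * y (punchIn i₀ j)

  xi₀≡0 : x i₀ ≡ 0ℤ
  xi₀≡0 = proj₁ (∣whenZero∣≡1 (x i₀) y₀i₀≡1)

  -- Outside `i₀` a vanishing entry of x would make a zero row. So three positive numbers have sum
  -- 3.
  ∣x∣≡1 : ∀ j → ∣ x (punchIn i₀ j) ∣ ≡ 1
  ∣x∣≡1 = sum≡length⇒ones (removeAt (∣_∣ ∘ x) i₀)
    (λ j → ℕ.n≢0⇒n>0 (λ x≡0 → let x≡0 = ℤ.∣i∣≡0⇒i≡0 x≡0 in
      nonzero (punchIn i₀ j) (x≡0 , whenZero≡0 _ (ℤ.∣i∣≡0⇒i≡0 (others _ (Fin.punchInᵢ≢i i₀ j))) x≡0)))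
    (begin
      sumℕ (removeAt (∣_∣ ∘ x) i₀)                 ≡⟨ cong (λ z → ∣ z ∣ ℕ.+ sumℕ (removeAt (∣_∣ ∘ x) i₀)) xi₀≡0 ⟨
      ∣ x i₀ ∣ ℕ.+ sumℕ (removeAt (∣_∣ ∘ x) i₀)    ≡⟨ Sum.sum-remove ℕ.+-0-commutativeMonoid {i = i₀} (∣_∣ ∘ x) ⟨
      ℓ¹ x                                         ≡⟨ ℓ¹x≡3 ⟩
      3                                            ∎)
    where open ≡-Reasoning

  first : ∀ i → + ∣ x (π i) ∣ ≡ exceptionalMatrix (b zero) (b (suc zero)) (b (suc (suc zero))) i zero
  first zero                   = cong +_ (∣x∣≡1 zero)
  first (suc zero)             = cong +_ (∣x∣≡1 (suc zero))
  first (suc (suc zero))       = cong +_ (∣x∣≡1 (suc (suc zero)))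
  first (suc (suc (suc zero))) = cong (λ z → + ∣ z ∣) xi₀≡0

  offset : ∀ j → sgn₀ (x (punchIn i₀ j)) * y (punchIn i₀ j) + + ∣ whenZero (x (punchIn i₀ j)) (y (punchIn i₀ j)) ∣ ≡ b j
  offset j = trans (cong (λ n → b j + + n) (others _ (Fin.punchInᵢ≢i i₀ j))) (ℤ.+-identityʳ (b j))

  second : ∀ i → sgn₀ (x (π i)) * y (π i) + + ∣ whenZero (x (π i)) (y (π i)) ∣ ≡
                  exceptionalMatrix (b zero) (b (suc zero)) (b (suc (suc zero))) i (suc zero)
  second zero                   = offset zero
  second (suc zero)             = offset (suc zero)
  second (suc (suc zero))       = offset (suc (suc zero))
  second (suc (suc (suc zero))) = cong₂ (λ z n → sgn₀ z * y i₀ + + n) xi₀≡0 y₀i₀≡1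

  total : (sgn₀ ∘ x) · y ≡ b zero + b (suc zero) + b (suc (suc zero))
  total = begin
    (sgn₀ ∘ x) · y
      ≡⟨ Sum.sum-remove ℤ.+-0-commutativeMonoid {i = i₀} (λ i → sgn₀ (x i) * y i) ⟩
    sgn₀ (x i₀) * y i₀ + (b zero + (b (suc zero) + (b (suc (suc zero)) + 0ℤ)))
      ≡⟨ cong (λ z → sgn₀ z * y i₀ + (b zero + (b (suc zero) + (b (suc (suc zero)) + 0ℤ)))) xi₀≡0 ⟩
    0ℤ + (b zero + (b (suc zero) + (b (suc (suc zero)) + 0ℤ)))
      ≡⟨ regroup (b zero) (b (suc zero)) (b (suc (suc zero))) ⟩
    b zero + b (suc zero) + b (suc (suc zero)) ∎
    where
    open ≡-Reasoning
    regroup : ∀ p q r → 0ℤ + (p + (q + (r + 0ℤ))) ≡ p + q + r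
    regroup = solve-∀

-- Bases with two vectors of norm 5

everyUpTo : ℕ → (ℕ → Bool) → Bool
everyUpTo zero    f = f zero
everyUpTo (suc n) f = f (suc n) ∧ everyUpTo n f

everyUpTo-sound : ∀ n f → T (everyUpTo n f) → ∀ {k} → k ℕ.≤ n → T (f k)
everyUpTo-sound zero    f h z≤n = h
everyUpTo-sound (suc n) f h {k} k≤1+n with Equivalence.to T-∧ h | ℕ.m≤n⇒m<n∨m≡n k≤1+n
... | _   , h′ | inj₁ k<1+n = everyUpTo-sound n f h′ (ℕ.s≤s⁻¹ k<1+n)
... | h₀  , _  | inj₂ refl  = h₀

everyOfNorm : ∀ m → ℕ → (Vec ℤ m → Bool) → Bool
everyOfNorm zero    zero    f = f Vec.[]
everyOfNorm zero    (suc _) f = true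
everyOfNorm (suc m) s       f = everyUpTo s (λ k →
  everyOfNorm m (s ℕ.∸ k) (f ∘ (+ k Vec.∷_)) ∧ everyOfNorm m (s ℕ.∸ k) (f ∘ (- + k Vec.∷_)))

everyOfNorm-sound : ∀ m s f → T (everyOfNorm m s f) → ∀ (x : Vector ℤ m) → ℓ¹ x ≡ s → T (f (tabulate x))
everyOfNorm-sound zero    .0 f h x refl = h
everyOfNorm-sound (suc m) s  f h x refl = signCase (x zero) refl
  where
  halves = Equivalence.to T-∧ (everyUpTo-sound s _ h (ℕ.m≤m+n ∣ x zero ∣ (ℓ¹ (x ∘ suc))))
  rest : ℓ¹ (x ∘ suc) ≡ s ℕ.∸ ∣ x zero ∣
  rest = sym (ℕ.m+n∸m≡n ∣ x zero ∣ (ℓ¹ (x ∘ suc)))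
  signCase : ∀ z → x zero ≡ z → T (f (x zero Vec.∷ tabulate (x ∘ suc)))
  signCase (+ n) eq = subst (λ z → T (f (z Vec.∷ tabulate (x ∘ suc)))) (trans (cong (λ z → + ∣ z ∣) eq) (sym eq))
    (everyOfNorm-sound m _ _ (proj₁ halves) (x ∘ suc) rest)
  signCase -[1+ n ] eq = subst (λ z → T (f (z Vec.∷ tabulate (x ∘ suc)))) (trans (cong (λ z → - + ∣ z ∣) eq) (sym eq))
    (everyOfNorm-sound m _ _ (proj₂ halves) (x ∘ suc) rest)

everyOfNorm-true : ∀ m s f → everyOfNorm m s f ≡ true → ∀ (x : Vector ℤ m) → ℓ¹ x ≡ s → T (f (tabulate x))
everyOfNorm-true m s f eq = everyOfNorm-sound m s f (Equivalence.from T-≡ eq)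

-- Coefficients 0 are tried as well: the corner argument asks for a far point of the zonotope, which
-- may be in its interior.
search : ∀ {m} → Vec ℤ m → Vec ℤ m → ℤ → ℤ → Bool
search Vec.[] Vec.[] X Y = (3 ℕ.≤ᵇ ∣ X ∣) ∧ (3 ℕ.≤ᵇ ∣ Y ∣)
search (x Vec.∷ xs) (y Vec.∷ ys) X Y =
  search xs ys (X + x) (Y + y) ∨ search xs ys (X - x) (Y - y) ∨ search xs ys X Y

SignedSum : ∀ {m} (x y : Vector ℤ m) (X Y : ℤ) → Set
SignedSum {m} x y X Y = ∃ λ (d : Vector ℤ m) →
  (∀ i → ∣ d i ∣ ℕ.≤ 1) × 3 ℕ.≤ ∣ X + d · x ∣ × 3 ℕ.≤ ∣ Y + d · y ∣

signedSum-∷ : ∀ {m} (x y : Vector ℤ (suc m)) c {X Y X′ Y′} → ∣ c ∣ ℕ.≤ 1 →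
              X′ ≡ X + c * x zero → Y′ ≡ Y + c * y zero →
              SignedSum (x ∘ suc) (y ∘ suc) X′ Y′ → SignedSum x y X Y
signedSum-∷ x y c {X} {Y} c≤1 refl refl (d , d≤1 , farX , farY) =
  c ∷ d , (λ { zero → c≤1 ; (suc i) → d≤1 i }) ,
  subst (λ z → 3 ℕ.≤ ∣ z ∣) (ℤ.+-assoc X (c * x zero) (d · (x ∘ suc))) farX ,
  subst (λ z → 3 ℕ.≤ ∣ z ∣) (ℤ.+-assoc Y (c * y zero) (d · (y ∘ suc))) farY

search-sound : ∀ {m} (x y : Vector ℤ m) X Y → T (search (tabulate x) (tabulate y) X Y) → SignedSum x y X Y
search-sound {zero} x y X Y h with Equivalence.to T-∧ h
... | farX , farY = (λ ()) , (λ ()) ,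
  subst (λ z → 3 ℕ.≤ ∣ z ∣) (sym (ℤ.+-identityʳ X)) (ℕ.≤ᵇ⇒≤ 3 _ farX) ,
  subst (λ z → 3 ℕ.≤ ∣ z ∣) (sym (ℤ.+-identityʳ Y)) (ℕ.≤ᵇ⇒≤ 3 _ farY)
search-sound {suc m} x y X Y h with Equivalence.to T-∨ h
... | inj₁ h₊ = signedSum-∷ x y 1ℤ {X} {Y} (s≤s z≤n) (plus X (x zero)) (plus Y (y zero)) (search-sound (x ∘ suc) (y ∘ suc) _ _ h₊)
  where
  plus : ∀ a b → a + b ≡ a + 1ℤ * b
  plus = solve-∀
... | inj₂ h′ with Equivalence.to T-∨ h′
...   | inj₁ h₋ = signedSum-∷ x y -1ℤ {X} {Y} (s≤s z≤n) (minus X (x zero)) (minus Y (y zero)) (search-sound (x ∘ suc) (y ∘ suc) _ _ h₋)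
  where
  minus : ∀ a b → a - b ≡ a + -1ℤ * b
  minus = solve-∀
...   | inj₂ h₀ = signedSum-∷ x y 0ℤ {X} {Y} z≤n (zero-+ X (x zero)) (zero-+ Y (y zero)) (search-sound (x ∘ suc) (y ∘ suc) _ _ h₀)
  where
  zero-+ : ∀ a b → a ≡ a + 0ℤ * b
  zero-+ = solve-∀

hasNegative : ∀ {m} → Vec ℤ m → Bool
hasNegative Vec.[]             = false
hasNegative (+ _ Vec.∷ x)      = hasNegative x
hasNegative (-[1+ _ ] Vec.∷ x) = true

hasZeroRow : ∀ {m} → Vec ℤ m → Vec ℤ m → Bool
hasZeroRow Vec.[]         Vec.[]         = false
hasZeroRow (+0 Vec.∷ x) (+0 Vec.∷ y) = true
hasZeroRow (_  Vec.∷ x) (_  Vec.∷ y) = hasZeroRow x y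

rowsCheck : Vec ℤ 4 → Vec ℤ 4 → Bool
rowsCheck y x = hasZeroRow x y ∨ search x y 0ℤ 0ℤ

-- Changing the sign of a row of M permits a nonnegative y, so all other columns are dismissed
-- before the inner enumeration starts.
columnCheck : Vec ℤ 4 → Bool
columnCheck y = hasNegative y ∨ everyOfNorm 4 5 (rowsCheck y)

-- The finite search itself, carried out by evaluation.
norm5-checked : everyOfNorm 4 5 columnCheck ≡ true
norm5-checked = refl

hasNegative-sound : ∀ {m} (y : Vector ℤ m) → T (hasNegative (tabulate y)) → ¬ (∀ i → 0ℤ ≤ y i)
hasNegative-sound {suc m} y h y≥0 with y zero | y≥0 zero
... | + _ | _ = hasNegative-sound (y ∘ suc) h (y≥0 ∘ suc)

hasZeroRow-sound : ∀ {m} (x y : Vector ℤ m) → T (hasZeroRow (tabulate x) (tabulate y)) →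
                   ¬ (∀ i → ¬ (x i ≡ 0ℤ × y i ≡ 0ℤ))
hasZeroRow-sound {suc m} x y h nonzero with x zero in x₀ | y zero in y₀
... | +0        | +0        = nonzero zero (x₀ , y₀)
... | +0        | +[1+ _ ]  = hasZeroRow-sound (x ∘ suc) (y ∘ suc) h (nonzero ∘ suc)
... | +0        | -[1+ _ ]  = hasZeroRow-sound (x ∘ suc) (y ∘ suc) h (nonzero ∘ suc)
... | +[1+ _ ]  | _         = hasZeroRow-sound (x ∘ suc) (y ∘ suc) h (nonzero ∘ suc)
... | -[1+ _ ]  | _         = hasZeroRow-sound (x ∘ suc) (y ∘ suc) h (nonzero ∘ suc)

norm5-nonneg : ∀ (x y : Vector ℤ 4) → (∀ i → ¬ (x i ≡ 0ℤ × y i ≡ 0ℤ)) → (∀ i → 0ℤ ≤ y i) →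
               ℓ¹ x ≡ 5 → ℓ¹ y ≡ 5 → SignedSum x y 0ℤ 0ℤ
norm5-nonneg x y nonzero y≥0 ℓ¹x ℓ¹y =
  fromColumn (Equivalence.to (T-∨ {hasNegative (tabulate y)} {everyOfNorm 4 5 (rowsCheck (tabulate y))})
    (everyOfNorm-true 4 5 columnCheck norm5-checked y ℓ¹y))
  where
  fromRows : T (hasZeroRow (tabulate x) (tabulate y)) ⊎ T (search (tabulate x) (tabulate y) 0ℤ 0ℤ) →
             SignedSum x y 0ℤ 0ℤ
  fromRows (inj₁ zeroRow) = ⊥-elim (hasZeroRow-sound x y zeroRow nonzero)
  fromRows (inj₂ found)   = search-sound x y 0ℤ 0ℤ found
  fromColumn : T (hasNegative (tabulate y)) ⊎ T (everyOfNorm 4 5 (rowsCheck (tabulate y))) →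
               SignedSum x y 0ℤ 0ℤ
  fromColumn (inj₁ negative) = ⊥-elim (hasNegative-sound y negative y≥0)
  fromColumn (inj₂ h)        =
    fromRows (Equivalence.to (T-∨ {hasZeroRow (tabulate x) (tabulate y)} {search (tabulate x) (tabulate y) 0ℤ 0ℤ})
      (everyOfNorm-sound 4 5 (rowsCheck (tabulate y)) h x ℓ¹x))

-- Multiplying each row by the sign of its y-entry makes y nonnegative and preserves norms and zero
-- rows; the signs are then absorbed into the coefficients d.
norm5⇒far : ∀ (x y : Vector ℤ 4) → (∀ i → ¬ (x i ≡ 0ℤ × y i ≡ 0ℤ)) → ℓ¹ x ≡ 5 → ℓ¹ y ≡ 5 →
        ∃ λ d → (∀ i → ∣ d i ∣ ℕ.≤ 1) × 3 ℕ.≤ ∣ d · x ∣ × 3 ℕ.≤ ∣ d · y ∣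
norm5⇒far x y nonzero ℓ¹x ℓ¹y = unflipped (norm5-nonneg (flip x) (flip y)
    (λ i eqs → nonzero i (unflip i (proj₁ eqs) , unflip i (proj₂ eqs)))
    (λ i → subst (0ℤ ≤_) (sym (sgn-* (y i))) (+≤+ z≤n))
    (trans (ℓ¹-flip x) ℓ¹x) (trans (ℓ¹-flip y) ℓ¹y))
  where
  σ : Vector ℤ 4
  σ i = sgn (y i)
  flip : Vector ℤ 4 → Vector ℤ 4
  flip z i = σ i * z i
  ∣flip∣ : ∀ z i → ∣ flip z i ∣ ≡ ∣ z i ∣
  ∣flip∣ z i = trans (ℤ.abs-* (σ i) (z i)) (trans (cong (ℕ._* ∣ z i ∣) (∣sgn∣ (y i))) (ℕ.*-identityˡ ∣ z i ∣))
  ℓ¹-flip : ∀ z → ℓ¹ (flip z) ≡ ℓ¹ z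
  ℓ¹-flip z = Sum.sum-cong-≗ ℕ.+-0-commutativeMonoid (∣flip∣ z)
  unflip : ∀ i {z} → σ i * z ≡ 0ℤ → z ≡ 0ℤ
  unflip i {z} eq = ℤ.∣i∣≡0⇒i≡0 (trans (sym (∣flip∣ (λ _ → z) i)) (cong ∣_∣ eq))
  regroup : ∀ d z → 0ℤ + d · flip z ≡ (λ i → d i * σ i) · z
  regroup d z = trans (ℤ.+-identityˡ (d · flip z))
    (Sum.sum-cong-≗ ℤ.+-0-commutativeMonoid (λ i → sym (ℤ.*-assoc (d i) (σ i) (z i))))
  unflipped : SignedSum (flip x) (flip y) 0ℤ 0ℤ →
              ∃ λ d → (∀ i → ∣ d i ∣ ℕ.≤ 1) × 3 ℕ.≤ ∣ d · x ∣ × 3 ℕ.≤ ∣ d · y ∣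
  unflipped (d , d≤1 , farX , farY) = (λ i → d i * σ i) ,
    (λ i → subst (ℕ._≤ 1) (sym (trans (ℤ.abs-* (d i) (σ i))
      (trans (cong (∣ d i ∣ ℕ.*_) (∣sgn∣ (y i))) (ℕ.*-identityʳ ∣ d i ∣)))) (d≤1 i)) ,
    subst (λ z → 3 ℕ.≤ ∣ z ∣) (regroup d x) farX ,
    subst (λ z → 3 ℕ.≤ ∣ z ∣) (regroup d y) farY

-- Reduced bases

Even Odd : ℤ → Set
Even z = + 2 ∣ z
Odd  z = + 2 ∣ z + 1ℤ

parity : ∀ n → Even (+ n) ⊎ Odd (+ n)
parity zero    = inj₁ (divides 0ℤ refl)
parity (suc n) with parity n
... | inj₁ even = inj₂ (subst (+ 2 ∣_) (eq (+ n)) (∣m∣n⇒∣m+n even ∣-refl))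
  where
  eq : ∀ n → n + + 2 ≡ 1ℤ + n + 1ℤ
  eq = solve-∀
... | inj₂ odd  = inj₁ (subst (+ 2 ∣_) (ℤ.+-comm (+ n) 1ℤ) odd)

¬odd+even : ∀ z → Odd z → ¬ Even z
¬odd+even z odd even = from-no (2 ℕ.∣? 1) (∣⇒∣ᵤ (∣m+n∣m⇒∣n odd even))

odd⇒oneOrBig : ∀ z → Odd z → OneOrBig z
odd⇒oneOrBig (+ 0)    odd = ⊥-elim (¬odd+even 0ℤ odd (divides 0ℤ refl))
odd⇒oneOrBig (+ 1)    _   = inj₁ refl
odd⇒oneOrBig (+ 2)    odd = ⊥-elim (¬odd+even (+ 2) odd ∣-refl)
odd⇒oneOrBig (+ suc (suc (suc n))) _ = inj₂ (s≤s (s≤s (s≤s z≤n)))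
odd⇒oneOrBig -[1+ 0 ] _   = inj₁ refl
odd⇒oneOrBig -[1+ 1 ] odd = ⊥-elim (¬odd+even -[1+ 1 ] odd (divides -1ℤ refl))
odd⇒oneOrBig -[1+ suc (suc n) ] _ = inj₂ (s≤s (s≤s (s≤s z≤n)))

odd⇒≥5 : ∀ n → Odd (+ n) → n ≢ 1 → n ≢ 3 → 5 ℕ.≤ n
odd⇒≥5 0 odd _ _ = ⊥-elim (¬odd+even 0ℤ odd (divides 0ℤ refl))
odd⇒≥5 1 _ n≢1 _ = ⊥-elim (n≢1 refl)
odd⇒≥5 2 odd _ _ = ⊥-elim (¬odd+even (+ 2) odd ∣-refl)
odd⇒≥5 3 _ _ n≢3 = ⊥-elim (n≢3 refl)
odd⇒≥5 4 odd _ _ = ⊥-elim (¬odd+even (+ 4) odd (divides (+ 2) refl))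
odd⇒≥5 (suc (suc (suc (suc (suc n))))) _ _ _ = s≤s (s≤s (s≤s (s≤s (s≤s z≤n))))

norm-parity : ∀ (x : Vector ℤ m) → + 2 ∣ 𝟙 · x + + ℓ¹ x
norm-parity x = subst (λ z → + 2 ∣ 𝟙 · x + z) (support x) (sign-parity (sgn ∘ x) x (λ i → ∣sgn∣ (x i)))

even-sum : ∀ (x : Vector ℤ m) → Even (+ ℓ¹ x) → + 2 ∣ 𝟙 · x
even-sum x even = ∣m+n∣n⇒∣m (norm-parity x) even

odd-sum : ∀ (x : Vector ℤ m) → Odd (+ ℓ¹ x) → Odd (𝟙 · x)
odd-sum x odd = subst (+ 2 ∣_) (eq (𝟙 · x) (+ ℓ¹ x))
  (∣m∣n⇒∣m+n (∣m∣n⇒∣m-n (norm-parity x) odd) ∣-refl)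
  where
  eq : ∀ a n → (a + n) - (n + 1ℤ) + + 2 ≡ a + 1ℤ
  eq = solve-∀

odd-vertex : ∀ (x σ : Vector ℤ m) → IsSign σ → Odd (+ ℓ¹ x) → Odd (σ · x)
odd-vertex x σ sign odd = subst (+ 2 ∣_) (eq (𝟙 · x) (σ · x))
  (∣m∣n⇒∣m+n (∣m∣n⇒∣m-n (sign-parity σ x sign) (odd-sum x odd)) ∣-refl)
  where
  eq : ∀ a s → (a + s) - (a + 1ℤ) + + 2 ≡ s + 1ℤ
  eq = solve-∀

-- The parity of the coordinate sum is a 2-coloring when it vanishes on both basis vectors.
even⇒circular₂ : ∀ (x y : Vector ℤ m) → Even (+ ℓ¹ x) → Even (+ ℓ¹ y) → CircularColoring 2 x y
even⇒circular₂ x y evenX evenY = record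
  { unit = 1 ; unit≥1 = ℕ.≤-refl ; weight = 𝟙
  ; weight≥ = λ _ → ℕ.≤-refl ; weight≤ = λ _ → ℕ.≤-refl
  ; ∣weight·u = even-sum x evenX ; ∣weight·v = even-sum y evenY }

-- Norms are congruent to coordinate sums modulo 2, so the norms of z and y differ in parity when
-- that of x is odd; equality is therefore excluded.
strict : ∀ (x y z : Vector ℤ m) → + 2 ∣ 𝟙 · z - 𝟙 · x - 𝟙 · y → Odd (+ ℓ¹ x) →
         ℓ¹ y ℕ.≤ ℓ¹ z → suc (ℓ¹ y) ℕ.≤ ℓ¹ z
strict x y z 2∣ odd y≤z = ℕ.≤∧≢⇒< y≤z λ y≡z → ¬odd+even (+ ℓ¹ x) odd
  (subst (+ 2 ∣_) (trans (cong (λ n → (((𝟙 · x + + ℓ¹ x) + (𝟙 · y + + ℓ¹ y)) - (𝟙 · z + + n)) + (𝟙 · z - 𝟙 · x - 𝟙 · y)) (sym y≡z))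
      (eq (𝟙 · x) (𝟙 · y) (𝟙 · z) (+ ℓ¹ x) (+ ℓ¹ y)))
    (∣m∣n⇒∣m+n (∣m∣n⇒∣m-n (∣m∣n⇒∣m+n (norm-parity x) (norm-parity y)) (norm-parity z)) 2∣))
  where
  eq : ∀ a b c p q → (((a + p) + (b + q)) - (c + q)) + (c - a - b) ≡ p
  eq = solve-∀

record Vertex (x y : Vector ℤ m) (X Y : ℤ) : Set where
  field
    inside : Zonotope x y X Y
    ∣X∣≤   : ∣ X ∣ ℕ.≤ ℓ¹ x
    ∣Y∣≤   : ∣ Y ∣ ℕ.≤ ℓ¹ y
    oddX   : Odd (+ ℓ¹ x) → OneOrBig X
    oddY   : Odd (+ ℓ¹ y) → OneOrBig Y

-- The signs of the entries of a x + b y select a point of the zonotope that is extremal in the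
-- direction (a , b), and the norm is the value attained there.
vertex : ∀ (x y : Vector ℤ m) a b z → (∀ i → z i ≡ a * x i + b * y i) →
         ∃₂ λ X Y → Vertex x y X Y × + ℓ¹ z ≡ a * X + b * Y
vertex x y a b z z≡ = σ · x , σ · y , record
    { inside = zonotope-vertex x y σ (λ i → ℕ.≤-reflexive (σ-sign i))
    ; ∣X∣≤ = ∣·∣-sign≤ℓ¹ σ x σ-sign
    ; ∣Y∣≤ = ∣·∣-sign≤ℓ¹ σ y σ-sign
    ; oddX = λ odd → odd⇒oneOrBig (σ · x) (odd-vertex x σ σ-sign odd)
    ; oddY = λ odd → odd⇒oneOrBig (σ · y) (odd-vertex y σ σ-sign odd)
    } , trans (sym (support z)) (trans (·-congʳ σ z≡) (·-linearʳ σ a x b y))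
  where
  σ : Vector ℤ _
  σ i = sgn (z i)
  σ-sign : IsSign σ
  σ-sign i = ∣sgn∣ (z i)

-- The argument works for any number of rows, except that `farAtNorm5` brings in the result of the
-- search for four.
module ReducedBasisColoring {m} (x y : Vector ℤ m) (reduced : Reduced x y)
  (farAtNorm5 : ℓ¹ x ≡ 5 → ℓ¹ y ≡ 5 →
                ∃ λ d → (∀ i → ∣ d i ∣ ℕ.≤ 1) × 3 ℕ.≤ ∣ d · x ∣ × 3 ℕ.≤ ∣ d · y ∣) where
  open Reduced reduced
  open Vertex

  private
    A B : ℕ
    A = ℓ¹ x
    B = ℓ¹ y

    x+y x-y : Vector ℤ m
    x+y i = x i + y i
    x-y i = x i - y i

    convex : ConvexSymmetric (Zonotope x y)
    convex = zonotope-convex x y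

    RightTop RightBottom : Set
    RightTop    = ∃₂ λ X Y → Vertex x y X Y × + ℓ¹ x+y ≡ X + Y
    RightBottom = ∃₂ λ X Y → Vertex x y X Y × + ℓ¹ x-y ≡ X - Y

    right : ∃[ Y ] Vertex x y (+ A) Y
    right = project (vertex x y 1ℤ 0ℤ x (λ i → sym (eq (x i) (y i))))
      where
      eq : ∀ a b → 1ℤ * a + 0ℤ * b ≡ a
      eq = solve-∀
      project : (∃₂ λ X Y → Vertex x y X Y × + A ≡ 1ℤ * X + 0ℤ * Y) → ∃[ Y ] Vertex x y (+ A) Y
      project (X , Y , V , height) = Y , subst (λ X → Vertex x y X Y) (sym (trans height (eq X Y))) V

    top : ∃[ X ] Vertex x y X (+ B)
    top = project (vertex x y 0ℤ 1ℤ y (λ i → sym (eq (x i) (y i))))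
      where
      eq : ∀ a b → 0ℤ * a + 1ℤ * b ≡ b
      eq = solve-∀
      project : (∃₂ λ X Y → Vertex x y X Y × + B ≡ 0ℤ * X + 1ℤ * Y) → ∃[ X ] Vertex x y X (+ B)
      project (X , Y , V , height) = X , subst (Vertex x y X) (sym (trans height (eq X Y))) V

    rightTop : RightTop
    rightTop = project (vertex x y 1ℤ 1ℤ x+y (λ i → sym (eq (x i) (y i))))
      where
      eq : ∀ a b → 1ℤ * a + 1ℤ * b ≡ a + b
      eq = solve-∀
      project : (∃₂ λ X Y → Vertex x y X Y × + ℓ¹ x+y ≡ 1ℤ * X + 1ℤ * Y) → RightTop
      project (X , Y , V , height) = X , Y , V , trans height (eq X Y)

    rightBottom : RightBottom
    rightBottom = project (vertex x y 1ℤ -1ℤ x-y (λ i → sym (eq (x i) (y i))))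
      where
      eq : ∀ a b → 1ℤ * a + -1ℤ * b ≡ a - b
      eq = solve-∀
      project : (∃₂ λ X Y → Vertex x y X Y × + ℓ¹ x-y ≡ 1ℤ * X + -1ℤ * Y) → RightBottom
      project (X , Y , V , height) = X , Y , V , trans height (eq X Y)

    strict₊ : Odd (+ A) → suc B ℕ.≤ ℓ¹ x+y
    strict₊ odd = strict x y x+y (divides 0ℤ (trans (cong (λ z → z - 𝟙 · x - 𝟙 · y) (·-+ʳ 𝟙 x y)) (eq (𝟙 · x) (𝟙 · y)))) odd sum≥
      where
      eq : ∀ a b → a + b - a - b ≡ 0ℤ
      eq = solve-∀

    strict₋ : Odd (+ A) → suc B ℕ.≤ ℓ¹ x-y
    strict₋ odd = strict x y x-y (divides (- (𝟙 · y)) (trans (cong (λ z → z - 𝟙 · x - 𝟙 · y) (·-subʳ 𝟙 x y)) (eq (𝟙 · x) (𝟙 · y)))) odd diff≥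
      where
      eq : ∀ a b → a - b - a - b ≡ - b * + 2
      eq = solve-∀

    above : ∀ {s n z} → s ℕ.≤ n → + n ≡ z → + s ≤ z
    above s≤n refl = +≤+ s≤n

    axis₁ : 5 ℕ.≤ A → Odd (+ A) → Zonotope x y (+ 3) (+ 0)
    axis₁ 5≤A odd = go right rightTop rightBottom
      where
      5≤B = ℕ.≤-trans 5≤A ordered
      widen : ∀ {n} → n ℕ.≤ A → n ℕ.≤ suc B
      widen n≤A = ℕ.m≤n⇒m≤1+n (ℕ.≤-trans n≤A ordered)
      go : ∃[ Y ] Vertex x y (+ A) Y → RightTop → RightBottom → Zonotope x y (+ 3) (+ 0)
      go (_ , V) (_ , _ , V₁ , h₁) (_ , _ , V₂ , h₂) = axis convex {b = B} 5≤A (ℕ.≤-trans (s≤s (s≤s z≤n)) 5≤B)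
        (inside V) (∣Y∣≤ V)
        (inside V₁) (widen (∣X∣≤ V₁)) (∣Y∣≤ V₁) (above (strict₊ odd) h₁)
        (inside V₂) (widen (∣X∣≤ V₂)) (∣Y∣≤ V₂) (above (strict₋ odd) h₂)

    -- The parameter `b` must bound A and stay below both diagonal norms. If A is odd, strictness
    -- admits b = B; if A is even and B odd, then A < B and b = B - 1 works without strictness.
    axis₂ : ∀ b → 5 ℕ.≤ B → A ℕ.≤ b → B ℕ.≤ suc b → suc b ℕ.≤ ℓ¹ x+y → suc b ℕ.≤ ℓ¹ x-y →
            Zonotope x y (+ 0) (+ 3)
    axis₂ b 5≤B A≤b B≤1+b b<₊ b<₋ = go top rightTop rightBottom
      where
      2≤b = ℕ.≤-trans (s≤s (s≤s z≤n)) (ℕ.s≤s⁻¹ (ℕ.≤-trans 5≤B B≤1+b))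
      eq : ∀ a b → a - b ≡ - b - - a
      eq = solve-∀
      go : ∃[ X ] Vertex x y X (+ B) → RightTop → RightBottom → Zonotope x y (+ 0) (+ 3)
      go (_ , V) (X₁ , Y₁ , V₁ , h₁) (X₂ , Y₂ , V₂ , h₂) = axis (transpose convex) {b = b} 5≤B 2≤b
        (inside V) (ℕ.≤-trans (∣X∣≤ V) A≤b)
        (inside V₁) (ℕ.≤-trans (∣Y∣≤ V₁) B≤1+b) (ℕ.≤-trans (∣X∣≤ V₁) A≤b)
        (above b<₊ (trans h₁ (ℤ.+-comm X₁ Y₁)))
        -- Exchanging the coordinates turns X - Y into its negative, so the opposite vertex is
        -- taken.
        (negate convex (inside V₂))
        (ℕ.≤-trans (ℕ.≤-reflexive (ℤ.∣-i∣≡∣i∣ Y₂)) (ℕ.≤-trans (∣Y∣≤ V₂) B≤1+b))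
        (ℕ.≤-trans (ℕ.≤-reflexive (ℤ.∣-i∣≡∣i∣ X₂)) (ℕ.≤-trans (∣X∣≤ V₂) A≤b))
        (above b<₋ (trans h₂ (eq X₂ Y₂)))

    diagonal : 5 ℕ.≤ A → Odd (+ A) → 5 ℕ.≤ B → Odd (+ B) → Diagonal (Zonotope x y)
    diagonal 5≤A oddA 5≤B oddB = byOrder (ℕ.m≤n⇒m<n∨m≡n ordered)
      where
      P₁ : Zonotope x y (+ 3) (+ 0)
      P₁ = axis₁ 5≤A oddA
      P₂ : Zonotope x y (+ 0) (+ 3)
      P₂ = axis₂ B 5≤B ordered (ℕ.n≤1+n B) (strict₊ oddA) (strict₋ oddA)

      oddPoint : ∀ {X Y} → Vertex x y X Y → OddPoint (Zonotope x y) X Y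
      oddPoint V = record { inside = inside V ; oddX = oddX V oddA ; oddY = oddY V oddB }

      oddPoint⁻ : ∀ {X Y} → Vertex x y X Y → OddPoint (Reflected (Zonotope x y)) X (- Y)
      oddPoint⁻ {X} {Y} V = record
        { inside = subst (Zonotope x y X) (sym (ℤ.neg-involutive Y)) (inside V)
        ; oddX = oddX V oddA
        ; oddY = subst (λ n → n ≡ 1 ⊎ 3 ℕ.≤ n) (sym (ℤ.∣-i∣≡∣i∣ Y)) (oddY V oddB) }

      norm5⇒diagonal : 5 ≡ A → 5 ≡ B → Diagonal (Zonotope x y)
      norm5⇒diagonal A≡5 B≡5 with farAtNorm5 (sym A≡5) (sym B≡5)
      ... | d , d≤1 , farX , farY = corner convex P₁ P₂ farX farY (zonotope-vertex x y d d≤1)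

      below : A ℕ.< B → ∃[ Y ] Vertex x y (+ A) Y → RightTop → RightBottom → Diagonal (Zonotope x y)
      below A<B (_ , V) (_ , _ , V₁ , h₁) (_ , Y₂ , V₂ , h₂) = diagonal-< convex P₁ P₂ 5≤A A<B (oddPoint V)
        (oddPoint V₁) (∣X∣≤ V₁) (∣Y∣≤ V₁) (above (strict₊ oddA) h₁)
        (oddPoint⁻ V₂) (∣X∣≤ V₂) (subst (ℕ._≤ B) (sym (ℤ.∣-i∣≡∣i∣ Y₂)) (∣Y∣≤ V₂)) (above (strict₋ oddA) h₂)

      level : A ≡ B → 5 ℕ.< A ⊎ 5 ≡ A → ∃[ Y ] Vertex x y (+ A) Y → ∃[ X ] Vertex x y X (+ B) → Diagonal (Zonotope x y)
      level A≡B (inj₁ 6≤A) (_ , V) (X , W) = diagonal-≡ convex P₁ P₂ 6≤A (oddPoint V)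
        (oddPoint (subst (λ n → Vertex x y X (+ n)) (sym A≡B) W))
      level A≡B (inj₂ 5≡A) _ _ = norm5⇒diagonal 5≡A (trans 5≡A A≡B)

      byOrder : A ℕ.< B ⊎ A ≡ B → Diagonal (Zonotope x y)
      byOrder (inj₁ A<B) = below A<B right rightTop rightBottom
      byOrder (inj₂ A≡B) = level A≡B (ℕ.m≤n⇒m<n∨m≡n 5≤A) right top

  circular₃ : A ≢ 1 → A ≢ 3 → B ≢ 1 → B ≢ 3 → ¬ CircularColoring 2 x y → CircularColoring 3 x y
  circular₃ A≢1 A≢3 B≢1 B≢3 nonbipartite with parity A | parity B
  ... | inj₁ evenA | inj₁ evenB = ⊥-elim (nonbipartite (even⇒circular₂ x y evenA evenB))
  ... | inj₂ oddA  | inj₁ evenB = zonotope⇒circular₃ {X = 1ℤ} {Y = 0ℤ} (axis₁ (odd⇒≥5 A oddA A≢1 A≢3) oddA)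
    (odd-sum x oddA) (subst (+ 2 ∣_) (sym (ℤ.+-identityʳ (𝟙 · y))) (even-sum y evenB))
  ... | inj₁ evenA | inj₂ oddB  = zonotope⇒circular₃ {X = 0ℤ} {Y = 1ℤ}
    (axis₂ (ℕ.pred B) 5≤B (ℕ.<⇒≤pred A<B) (ℕ.≤-reflexive (sym B≡)) (ℕ.≤-trans (ℕ.≤-reflexive B≡) sum≥) (ℕ.≤-trans (ℕ.≤-reflexive B≡) diff≥))
    (subst (+ 2 ∣_) (sym (ℤ.+-identityʳ (𝟙 · x))) (even-sum x evenA)) (odd-sum y oddB)
    where
    5≤B = odd⇒≥5 B oddB B≢1 B≢3
    B≡ : suc (ℕ.pred B) ≡ B
    B≡ = ℕ.suc-pred B {{ℕ.>-nonZero (ℕ.≤-trans (s≤s z≤n) 5≤B)}}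
    A<B : A ℕ.< B
    A<B = ℕ.≤∧≢⇒< ordered (λ A≡B → ¬odd+even (+ B) oddB (subst (λ n → Even (+ n)) A≡B evenA))
  ... | inj₂ oddA  | inj₂ oddB  = fromDiagonal (diagonal (odd⇒≥5 A oddA A≢1 A≢3) oddA (odd⇒≥5 B oddB B≢1 B≢3) oddB)
    where
    fromDiagonal : Diagonal (Zonotope x y) → CircularColoring 3 x y
    fromDiagonal (inj₁ P) = zonotope⇒circular₃ {X = 1ℤ} {Y = 1ℤ}  P (odd-sum x oddA) (odd-sum y oddB)
    fromDiagonal (inj₂ P) = zonotope⇒circular₃ {X = 1ℤ} {Y = -1ℤ} P (odd-sum x oddA)
      (subst (+ 2 ∣_) (eq (𝟙 · y)) (∣m∣n⇒∣m-n (odd-sum y oddB) ∣-refl))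
      where
      eq : ∀ a → a + 1ℤ - + 2 ≡ a + -1ℤ
      eq = solve-∀

ExceptionalColumns : (u v : Vector ℤ 4) → Set
ExceptionalColumns u v = ∃₂ λ x y → BasisChange u v x y × ExceptionalBasis x y

circular₃⊎exceptional : ∀ (u v : Vector ℤ 4) → (∀ i → ¬ (u i ≡ 0ℤ × v i ≡ 0ℤ)) →
  (∀ {x y} → BasisChange u v x y → ℓ¹ x ≢ 1) → ¬ CircularColoring 2 u v →
  CircularColoring 3 u v ⊎ ExceptionalColumns u v
circular₃⊎exceptional u v nonzero loopless nonbipartite =
  byNorm (reduce (suc (ℓ¹ u ℕ.+ ℓ¹ v)) u v ℕ.≤-refl)
  where
  viaNorm3 : ∀ {x y} → BasisChange u v x y → ℓ¹ x ≡ 3 → CircularColoring 3 u v ⊎ ExceptionalColumns u v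
  viaNorm3 {x} {y} basis ℓ¹x≡3 = ⊎.map (circular-basis basis) (λ E → x , y , basis , E)
    (norm3⇒circular₃⊎exceptional x y (nonzeroRows-basis basis nonzero) ℓ¹x≡3)

  viaReduced : ∀ {x y} → BasisChange u v x y → Reduced x y → ℓ¹ x ≢ 3 → ℓ¹ y ≢ 3 → CircularColoring 3 u v
  viaReduced {x} {y} basis reduced A≢3 B≢3 = circular-basis basis
    (ReducedBasisColoring.circular₃ x y reduced (norm5⇒far x y (nonzeroRows-basis basis nonzero))
      (loopless basis) A≢3 (loopless (basis-trans basis basis-swap)) B≢3
      (nonbipartite ∘ circular-basis basis))

  byNorm : ReducedBasis u v → CircularColoring 3 u v ⊎ ExceptionalColumns u v
  byNorm (x , y , basis , reduced) with ℓ¹ x ℕ.≟ 3 | ℓ¹ y ℕ.≟ 3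
  ... | yes A≡3 | _       = viaNorm3 basis A≡3
  ... | no  _   | yes B≡3 = viaNorm3 (basis-trans basis basis-swap) B≡3
  ... | no A≢3  | no B≢3  = inj₁ (viaReduced basis reduced A≢3 B≢3)

-- Exceptional matrices

module _ (H : Subgroup (ℤ^ m) 0ℓ) where
  open Subgroup H

  subgroup-multiple⁺ : ∀ n {z} → Member z → Member (λ i → + n * z i)
  subgroup-multiple⁺ zero    {z} z∈H = resp (λ i → sym (ℤ.*-zeroˡ (z i))) 0-closed
  subgroup-multiple⁺ (suc n) {z} z∈H =
    resp (λ i → eq (z i) (+ n)) (+-closed z∈H (subgroup-multiple⁺ n z∈H))
    where
    eq : ∀ z n → z + n * z ≡ (1ℤ + n) * z
    eq = solve-∀

  subgroup-multiple : ∀ c {z} → Member z → Member (λ i → c * z i)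
  subgroup-multiple (+ n)     z∈H = subgroup-multiple⁺ n z∈H
  subgroup-multiple -[1+ n ]  {z} z∈H =
    resp (λ i → ℤ.neg-distribˡ-* (+ suc n) (z i)) (neg-closed (subgroup-multiple⁺ (suc n) z∈H))

  subgroup-combination : ∀ (c d : ℤ) {z w} → Member z → Member w → Member (λ i → c * z i + d * w i)
  subgroup-combination c d z∈H w∈H = +-closed (subgroup-multiple c z∈H) (subgroup-multiple d w∈H)

-- Unit vectors and signed permutation matrices

IsUnitVector : Vector ℤ m → Set
IsUnitVector z = ∃[ j ] ((∀ i → z i ≡ e j i) ⊎ (∀ i → z i ≡ - e j i))

unitVector : ∀ (z : Vector ℤ m) j → IsUnit (z j) → (∀ i → i ≢ j → z i ≡ 0ℤ) → IsUnitVector z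
unitVector z j (inj₁ zj≡1) others = j , inj₁ entry
  where
  entry : ∀ i → z i ≡ e j i
  entry i with i Fin.≟ j
  ... | yes refl = trans zj≡1 (sym (e-diagonal j))
  ... | no  i≢j  = trans (others i i≢j) (sym (e-off-diagonal i≢j))
unitVector z j (inj₂ zj≡-1) others = j , inj₂ entry
  where
  entry : ∀ i → z i ≡ - e j i
  entry i with i Fin.≟ j
  ... | yes refl = trans zj≡-1 (cong -_ (sym (e-diagonal j)))
  ... | no  i≢j  = trans (others i i≢j) (cong -_ (sym (e-off-diagonal i≢j)))

ℓ¹≡1⇒unitVector : ∀ (z : Vector ℤ m) → ℓ¹ z ≡ 1 → IsUnitVector z
ℓ¹≡1⇒unitVector z ℓ¹z≡1 with sum≡1⇒single (∣_∣ ∘ z) ℓ¹z≡1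
... | j , ∣zj∣≡1 , others =
  unitVector z j (∣z∣≡1⇒unit (z j) ∣zj∣≡1) (λ i i≢j → ℤ.∣i∣≡0⇒i≡0 (others i i≢j))

·-collapse : ∀ (w x : Vector ℤ m) j → (∀ i → i ≢ j → w i ≡ 0ℤ) → w · x ≡ w j * x j
·-collapse w x j others =
  trans (Sum.sum-cong-≗ ℤ.+-0-commutativeMonoid entry) (·-e (λ _ → w j * x j) j)
  where
  entry : ∀ i → w i * x i ≡ w j * x j * e j i
  entry i with i Fin.≟ j
  ... | yes refl = sym (trans (cong (w i * x i *_) (e-diagonal i)) (ℤ.*-identityʳ (w i * x i)))
  ... | no  i≢j  = trans (cong (_* x i) (others i i≢j))
    (sym (trans (cong (w j * x j *_) (e-off-diagonal i≢j)) (ℤ.*-zeroʳ (w j * x j))))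

module _ {n} {P : Matrix n n} (signed : SignedPermutation P) where
  open SignedPermutation signed

  row-others : ∀ i → ∃[ j ] IsUnit (P i j) × (∀ j′ → j′ ≢ j → P i j′ ≡ 0ℤ)
  row-others i with row i
  ... | j , Pij≢0 , unique = j , nonzero i j Pij≢0 , others
    where
    others : ∀ j′ → j′ ≢ j → P i j′ ≡ 0ℤ
    others j′ j′≢j with P i j′ ℤ.≟ 0ℤ
    ... | yes Pij′≡0 = Pij′≡0
    ... | no  Pij′≢0 = ⊥-elim (j′≢j (sym (unique Pij′≢0)))

  column-others : ∀ j → ∃[ i ] IsUnit (P i j) × (∀ i′ → i′ ≢ i → P i′ j ≡ 0ℤ)
  column-others j with column j
  ... | i , Pij≢0 , unique = i , nonzero i j Pij≢0 , others
    where
    others : ∀ i′ → i′ ≢ i → P i′ j ≡ 0ℤ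
    others i′ i′≢i with P i′ j ℤ.≟ 0ℤ
    ... | yes Pi′j≡0 = Pi′j≡0
    ... | no  Pi′j≢0 = ⊥-elim (i′≢i (sym (unique Pi′j≢0)))

  rowUnitVector : ∀ i → IsUnitVector (P i)
  rowUnitVector i with row-others i
  ... | j , unit , others = unitVector (P i) j unit others

  -- The only nonzero entry of column j is also the only one of its row, and its square is 1. Hence
  -- a vector can be recovered from its image as a combination of the rows of P.
  signedPermutation-orthogonal : ∀ x j → (λ i → P i j) · (λ i → P i · x) ≡ x j
  signedPermutation-orthogonal x j with column-others j
  ... | i , unit , others = begin
    (λ i → P i j) · (λ i → P i · x) ≡⟨ ·-collapse (λ i → P i j) (λ i → P i · x) i others ⟩
    P i j * (P i · x)               ≡⟨ cong (P i j *_) Pi·x ⟩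
    P i j * (P i j * x j)           ≡⟨ square unit ⟩
    x j                             ∎
    where
    open ≡-Reasoning
    square : ∀ {s} → IsUnit s → s * (s * x j) ≡ x j
    square (inj₁ refl) = eq (x j)
      where
      eq : ∀ a → 1ℤ * (1ℤ * a) ≡ a
      eq = solve-∀
    square (inj₂ refl) = eq (x j)
      where
      eq : ∀ a → -1ℤ * (-1ℤ * a) ≡ a
      eq = solve-∀
    unit≢0 : ∀ {s} → IsUnit s → s ≢ 0ℤ
    unit≢0 (inj₁ refl) ()
    unit≢0 (inj₂ refl) ()
    Pi·x : P i · x ≡ P i j * x j
    Pi·x with row-others i
    ... | j₀ , _ , rowOthers with j Fin.≟ j₀
    ...   | yes refl = ·-collapse (P i) x j rowOthers
    ...   | no  j≢j₀ = ⊥-elim (unit≢0 unit (rowOthers j j≢j₀))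

  ∣column·∣ : ∀ ω j → ∃[ i ] ∣ (λ i → P i j) · ω ∣ ≡ ∣ ω i ∣
  ∣column·∣ ω j with column-others j
  ... | i , unit , others = i , trans (cong ∣_∣ (·-collapse (λ i → P i j) ω i others)) (∣unit*∣ unit)
    where
    ∣unit*∣ : ∀ {s} → IsUnit s → ∣ s * ω i ∣ ≡ ∣ ω i ∣
    ∣unit*∣ (inj₁ refl) = cong ∣_∣ (ℤ.*-identityˡ (ω i))
    ∣unit*∣ (inj₂ refl) = trans (cong ∣_∣ (ℤ.-1*i≡-i (ω i))) (ℤ.∣-i∣≡∣i∣ (ω i))

·-adjoint : ∀ {n} (P : Matrix n m) (ω : Vector ℤ n) (x : Vector ℤ m) →
            (λ j → (λ i → P i j) · ω) · x ≡ ω · (λ i → P i · x)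
·-adjoint {n = zero}  P ω x = trans (·-comm (λ _ → 0ℤ) x) (·-zeroʳ x)
·-adjoint {n = suc n} P ω x = begin
  (λ j → P zero j * ω zero + rest j) · x       ≡⟨ Sum.sum-cong-≗ ℤ.+-0-commutativeMonoid (λ j → cong (_* x j) (eq (P zero j) (ω zero) (rest j))) ⟩
  (λ j → ω zero * P zero j + 1ℤ * rest j) · x  ≡⟨ ·-linearˡ (ω zero) (P zero) 1ℤ rest x ⟩
  ω zero * (P zero · x) + 1ℤ * (rest · x)      ≡⟨ cong (_+_ (ω zero * (P zero · x))) (trans (ℤ.*-identityˡ (rest · x)) (·-adjoint (P ∘ suc) (ω ∘ suc) x)) ⟩
  ω · (λ i → P i · x)                          ∎
  where
  open ≡-Reasoning
  rest : Vector ℤ _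
  rest j = (λ i → P (suc i) j) · (ω ∘ suc)
  eq : ∀ p w r → p * w + r ≡ w * p + 1ℤ * r
  eq = solve-∀

module _ (M : Matrix 4 2) where

  exceptional⇒columns : Exceptional M → ExceptionalColumns (column₀ M) (column₁ M)
  exceptional⇒columns (P , U , a , b , c , signed , unimodular , PMU≈ , 3∣) = x , y , record
      -- Since x and y are the columns of M U, the coefficients of each are read off a column of U.
      { p = U zero zero ; q = U (suc zero) zero ; r = U zero (suc zero) ; s = U (suc zero) (suc zero)
      ; invertible = subst IsUnit (det₂ (U zero zero) (U zero (suc zero)) (U (suc zero) zero) (U (suc zero) (suc zero))) unimodular
      ; x≡ = λ _ → refl ; y≡ = λ _ → refl } , record
      { permutation = P ; signed = signed ; a = a ; b = b ; c = c
      ; column₀≡ = λ i → trans (entry i zero) (PMU≈ i zero)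
      ; column₁≡ = λ i → trans (entry i (suc zero)) (PMU≈ i (suc zero))
      ; 3∣a+b+c = 3∣ }
    where
    combination : Fin 2 → Vector ℤ 4
    combination k j = U zero k * M j zero + U (suc zero) k * M j (suc zero)
    x = combination zero
    y = combination (suc zero)
    det₂ : ∀ a b c d → 1ℤ * a * (1ℤ * d * 1ℤ + 0ℤ) + (-1ℤ * b * (1ℤ * c * 1ℤ + 0ℤ) + 0ℤ) ≡ a * d - c * b
    det₂ = solve-∀
    entry : ∀ i k → P i · combination k ≡ (P *ᴹ M *ᴹ U) i k
    entry i k = trans (·-linearʳ (P i) (U zero k) (column₀ M) (U (suc zero) k) (column₁ M))
      (eq (U zero k) (P i · column₀ M) (U (suc zero) k) (P i · column₁ M))
      where
      eq : ∀ a s b t → a * s + b * t ≡ s * a + (t * b + 0ℤ)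
      eq = solve-∀

  columns⇒exceptional : ExceptionalColumns (column₀ M) (column₁ M) → Exceptional M
  columns⇒exceptional (x , y , B , E) = permutation , U , a , b , c , signed ,
      subst IsUnit (det₂ p q r s) invertible , PMU≈ , 3∣a+b+c
    where
    open BasisChange B
    open ExceptionalBasis E
    U : Matrix 2 2
    U = (p ∷ r ∷ []) ∷ (q ∷ s ∷ []) ∷ []
    det₂ : ∀ p q r s → p * s - q * r ≡ 1ℤ * p * (1ℤ * s * 1ℤ + 0ℤ) + (-1ℤ * r * (1ℤ * q * 1ℤ + 0ℤ) + 0ℤ)
    det₂ = solve-∀
    eq : ∀ a s b t → s * a + (t * b + 0ℤ) ≡ a * s + b * t
    eq = solve-∀
    PMU≈ : permutation *ᴹ M *ᴹ U ≈ᴹ exceptionalMatrix a b c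
    PMU≈ i zero       = trans (eq p _ q _) (trans (sym (·x (permutation i))) (column₀≡ i))
    PMU≈ i (suc zero) = trans (eq r _ s _) (trans (sym (·y (permutation i))) (column₁≡ i))

module _ {x y : Vector ℤ 4} (E : ExceptionalBasis x y) where
  open ExceptionalBasis E renaming (permutation to P)

  private
    g₀ g₁ g₂ g₃ : Vector ℤ 4
    g₀ = P zero
    g₁ = P (suc zero)
    g₂ = P (suc (suc zero))
    g₃ = P (suc (suc (suc zero)))

  exceptional-x : ∀ j → x j ≡ g₀ j + g₁ j + g₂ j
  exceptional-x j = begin
    x j                                   ≡⟨ signedPermutation-orthogonal signed x j ⟨
    (λ i → P i j) · (λ i → P i · x)       ≡⟨ ·-congʳ (λ i → P i j) column₀≡ ⟩
    g₀ j * 1ℤ + (g₁ j * 1ℤ + (g₂ j * 1ℤ + (g₃ j * 0ℤ + 0ℤ))) ≡⟨ eq (g₀ j) (g₁ j) (g₂ j) (g₃ j) ⟩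
    g₀ j + g₁ j + g₂ j                    ∎
    where
    open ≡-Reasoning
    eq : ∀ p q r s → p * 1ℤ + (q * 1ℤ + (r * 1ℤ + (s * 0ℤ + 0ℤ))) ≡ p + q + r
    eq = solve-∀

  exceptional-y : ∀ j → y j ≡ a * g₀ j + b * g₁ j + c * g₂ j + g₃ j
  exceptional-y j = begin
    y j                                   ≡⟨ signedPermutation-orthogonal signed y j ⟨
    (λ i → P i j) · (λ i → P i · y)       ≡⟨ ·-congʳ (λ i → P i j) column₁≡ ⟩
    g₀ j * a + (g₁ j * b + (g₂ j * c + (g₃ j * 1ℤ + 0ℤ))) ≡⟨ eq (g₀ j) (g₁ j) (g₂ j) (g₃ j) a b c ⟩
    a * g₀ j + b * g₁ j + c * g₂ j + g₃ j ∎
    where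
    open ≡-Reasoning
    eq : ∀ p q r s a b c → p * a + (q * b + (r * c + (s * 1ℤ + 0ℤ))) ≡ a * p + b * q + c * r + s
    eq = solve-∀

-- Weights for four colors

record Weights₄ (a b c : ℤ) : Set where
  field
    unit   : ℕ
    unit≥1 : 1 ℕ.≤ unit
    ω      : Vector ℕ 4
    ω≥     : ∀ i → unit ℕ.≤ ω i
    ω≤     : ∀ i → unit ℕ.+ ω i ℕ.≤ 4 ℕ.* unit
    ∣sum   : + (4 ℕ.* unit) ∣ + ω zero + + ω (suc zero) + + ω (suc (suc zero))
    ∣combination : + (4 ℕ.* unit) ∣
      + ω zero * a + + ω (suc zero) * b + + ω (suc (suc zero)) * c + + ω (suc (suc (suc zero)))

-- The transpose of P carries the weights back to the original generators. It only permutes them and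
-- changes signs, so the bounds on absolute values persist.
weights₄⇒circular₄ : ∀ {x y} (E : ExceptionalBasis x y) → let open ExceptionalBasis E in
                     Weights₄ a b c → CircularColoring 4 x y
weights₄⇒circular₄ {x} {y} E W = record
  { unit = unit ; unit≥1 = unit≥1
  ; weight = λ j → (λ i → P i j) · (+_ ∘ ω)
  ; weight≥ = λ j → via j (unit ℕ.≤_) ω≥
  ; weight≤ = λ j → via j (λ t → unit ℕ.+ t ℕ.≤ 4 ℕ.* unit) ω≤
  ; ∣weight·u = subst (+ (4 ℕ.* unit) ∣_) (sym (trans (·-adjoint P (+_ ∘ ω) x) (trans (·-congʳ (+_ ∘ ω) column₀≡)
      (onX (+ ω zero) (+ ω (suc zero)) (+ ω (suc (suc zero))) (+ ω (suc (suc (suc zero)))))))) ∣sum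
  ; ∣weight·v = subst (+ (4 ℕ.* unit) ∣_) (sym (trans (·-adjoint P (+_ ∘ ω) y) (trans (·-congʳ (+_ ∘ ω) column₁≡)
      (onY (+ ω zero) (+ ω (suc zero)) (+ ω (suc (suc zero))) (+ ω (suc (suc (suc zero)))) a b c)))) ∣combination
  }
  where
  open ExceptionalBasis E renaming (permutation to P)
  open Weights₄ W
  via : ∀ j (Q : ℕ → Set) → (∀ i → Q (ω i)) → Q ∣ (λ i → P i j) · (+_ ∘ ω) ∣
  via j Q holds with ∣column·∣ signed (+_ ∘ ω) j
  ... | i , eq = subst Q (sym eq) (holds i)
  onX : ∀ p q r s → p * 1ℤ + (q * 1ℤ + (r * 1ℤ + (s * 0ℤ + 0ℤ))) ≡ p + q + r
  onX = solve-∀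
  onY : ∀ p q r s a b c → p * a + (q * b + (r * c + (s * 1ℤ + 0ℤ))) ≡ p * a + q * b + r * c + s
  onY = solve-∀

weights₄-swap : ∀ {a b c} → Weights₄ a c b → Weights₄ a b c
weights₄-swap {a} {b} {c} W = record
  { unit = unit ; unit≥1 = unit≥1 ; ω = ω ∘ σ ; ω≥ = ω≥ ∘ σ ; ω≤ = ω≤ ∘ σ
  ; ∣sum = subst (+ (4 ℕ.* unit) ∣_) (sumEq (+ ω zero) (+ ω (suc zero)) (+ ω (suc (suc zero)))) ∣sum
  ; ∣combination = subst (+ (4 ℕ.* unit) ∣_)
      (combinationEq (+ ω zero * a) (+ ω (suc zero) * c) (+ ω (suc (suc zero)) * b) (+ ω (suc (suc (suc zero))))) ∣combination
  }
  where
  open Weights₄ W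
  σ : Fin 4 → Fin 4
  σ = zero ∷ suc (suc zero) ∷ suc zero ∷ suc (suc (suc zero)) ∷ []
  sumEq : ∀ p q r → p + q + r ≡ p + r + q
  sumEq = solve-∀
  combinationEq : ∀ p q r s → p + q + r + s ≡ p + r + q + s
  combinationEq = solve-∀

weights₄-rotate : ∀ {a b c} → Weights₄ b c a → Weights₄ a b c
weights₄-rotate {a} {b} {c} W = record
  { unit = unit ; unit≥1 = unit≥1 ; ω = ω ∘ σ ; ω≥ = ω≥ ∘ σ ; ω≤ = ω≤ ∘ σ
  ; ∣sum = subst (+ (4 ℕ.* unit) ∣_) (sumEq (+ ω zero) (+ ω (suc zero)) (+ ω (suc (suc zero)))) ∣sum
  ; ∣combination = subst (+ (4 ℕ.* unit) ∣_)
      (combinationEq (+ ω zero * b) (+ ω (suc zero) * c) (+ ω (suc (suc zero)) * a) (+ ω (suc (suc (suc zero))))) ∣combination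
  }
  where
  open Weights₄ W
  σ : Fin 4 → Fin 4
  σ = suc (suc zero) ∷ zero ∷ suc zero ∷ suc (suc (suc zero)) ∷ []
  sumEq : ∀ p q r → p + q + r ≡ r + p + q
  sumEq = solve-∀
  combinationEq : ∀ p q r s → p + q + r + s ≡ r + p + q + s
  combinationEq = solve-∀

-- θ = (1/2 , 1/4 , 1/4) on the first three generators leaves a multiple of 1/4 for the fourth one.
quarterWeights : ∀ a b c → ¬ (+ 4 ∣ + 2 * a + + 1 * b + + 1 * c) → Weights₄ a b c
quarterWeights a b c 4∤ = record
  { unit = 1 ; unit≥1 = ℕ.≤-refl
  ; ω = 2 ∷ 1 ∷ 1 ∷ r ∷ []
  ; ω≥ = λ { zero → s≤s z≤n ; (suc zero) → s≤s z≤n ; (suc (suc zero)) → s≤s z≤n ; (suc (suc (suc zero))) → r≥1 }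
  ; ω≤ = λ { zero → s≤s (s≤s (s≤s z≤n)) ; (suc zero) → s≤s (s≤s z≤n) ; (suc (suc zero)) → s≤s (s≤s z≤n) ; (suc (suc (suc zero))) → r<4 }
  ; ∣sum = divides 1ℤ refl
  ; ∣combination = 4∣
  }
  where
  t = + 2 * a + + 1 * b + + 1 * c
  r = - t %ℕ 4
  r<4 : r ℕ.< 4
  r<4 = ℤ.n%ℕd<d (- t) 4
  flip : ∀ a r → - (- a - r) ≡ a + r
  flip = solve-∀
  4∣ : + 4 ∣ t + + r
  4∣ = subst (+ 4 ∣_) (flip t (+ r)) (∣m⇒∣-m (%ℕ-∣ (- t) 4))
  r≥1 : 1 ℕ.≤ r
  r≥1 = ℕ.n≢0⇒n>0 λ r≡0 → 4∤ (subst (+ 4 ∣_) (trans (cong (λ r → t + + r) r≡0) (ℤ.+-identityʳ t)) 4∣)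

-- A small perturbation of θ = (1/2 , 1/4 , 1/4) along (-1 , 1 , 0) moves the value on the fourth generator to 1/2.
perturbedWeights : ∀ a q r h → ∣ q ∣ ≡ suc h → Weights₄ a (a + q * + 4) (a + r * + 4)
perturbedWeights a q r h ∣q∣≡ = record
  { unit = unit ; unit≥1 = s≤s z≤n
  ; ω = ω
  ; ω≥ = λ where
      zero → ℕ.≤-trans (ℕ.m≤m+n _ (h ℕ.+ h ℕ.+ 1)) (ℕ.≤-reflexive (ω₀≥ h))
      (suc zero) → ℕ.≤-trans (ℕ.m≤m+n _ 1) (ℕ.≤-reflexive (ω₁≥ h))
      (suc (suc zero)) → ℕ.≤-refl
      (suc (suc (suc zero))) → ℕ.≤-trans (ℕ.m≤m+n _ (h ℕ.+ h ℕ.+ 2)) (ℕ.≤-reflexive (ω₃≥ h))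
  ; ω≤ = λ where
      zero → ℕ.≤-trans (ℕ.m≤m+n _ (h ℕ.+ h ℕ.+ 3)) (ℕ.≤-reflexive (ω₀≤ h))
      (suc zero) → ℕ.≤-trans (ℕ.m≤m+n _ (h ℕ.+ h ℕ.+ h ℕ.+ h ℕ.+ 3)) (ℕ.≤-reflexive (ω₁≤ h))
      (suc (suc zero)) → ℕ.≤-trans (ℕ.m≤m+n _ (h ℕ.+ h ℕ.+ h ℕ.+ h ℕ.+ 4)) (ℕ.≤-reflexive (ω₂≤ h))
      (suc (suc (suc zero))) → ℕ.≤-trans (ℕ.m≤m+n _ (h ℕ.+ h ℕ.+ 2)) (ℕ.≤-reflexive (ω₃≤ h))
  ; ∣sum = divides 1ℤ (trans (sumEq (+ h)) (cong (1ℤ *_) (sym 4unit≡)))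
  ; ∣combination = combination q ∣q∣≡
  }
  where
  -- The modulus 4 unit is 8 |q|. At (1/2 , 1/4 , 1/4) the combination of a, b, c vanishes; moving
  -- weight 1 from the first generator to the second adds b - a = 4 q, half the modulus, and the
  -- fourth weight 4 |q| cancels it.
  unit = 2 ℕ.+ h ℕ.+ h
  ω : Vector ℕ 4
  ω = 3 ℕ.+ h ℕ.+ h ℕ.+ h ℕ.+ h ∷ 3 ℕ.+ h ℕ.+ h ∷ 2 ℕ.+ h ℕ.+ h ∷ 4 ℕ.+ h ℕ.+ h ℕ.+ h ℕ.+ h ∷ []
  4unit≡ : + (4 ℕ.* unit) ≡ + 4 * (+ 2 + + h + + h)
  4unit≡ = ℤ.pos-* 4 unit
  ω₀≥ : ∀ h → 2 ℕ.+ h ℕ.+ h ℕ.+ (h ℕ.+ h ℕ.+ 1) ≡ 3 ℕ.+ h ℕ.+ h ℕ.+ h ℕ.+ h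
  ω₀≥ = ℕ-Solver.solve-∀
  ω₁≥ : ∀ h → 2 ℕ.+ h ℕ.+ h ℕ.+ 1 ≡ 3 ℕ.+ h ℕ.+ h
  ω₁≥ = ℕ-Solver.solve-∀
  ω₃≥ : ∀ h → 2 ℕ.+ h ℕ.+ h ℕ.+ (h ℕ.+ h ℕ.+ 2) ≡ 4 ℕ.+ h ℕ.+ h ℕ.+ h ℕ.+ h
  ω₃≥ = ℕ-Solver.solve-∀
  ω₀≤ : ∀ h → 2 ℕ.+ h ℕ.+ h ℕ.+ (3 ℕ.+ h ℕ.+ h ℕ.+ h ℕ.+ h) ℕ.+ (h ℕ.+ h ℕ.+ 3) ≡ 4 ℕ.* (2 ℕ.+ h ℕ.+ h)
  ω₀≤ = ℕ-Solver.solve-∀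
  ω₁≤ : ∀ h → 2 ℕ.+ h ℕ.+ h ℕ.+ (3 ℕ.+ h ℕ.+ h) ℕ.+ (h ℕ.+ h ℕ.+ h ℕ.+ h ℕ.+ 3) ≡ 4 ℕ.* (2 ℕ.+ h ℕ.+ h)
  ω₁≤ = ℕ-Solver.solve-∀
  ω₂≤ : ∀ h → 2 ℕ.+ h ℕ.+ h ℕ.+ (2 ℕ.+ h ℕ.+ h) ℕ.+ (h ℕ.+ h ℕ.+ h ℕ.+ h ℕ.+ 4) ≡ 4 ℕ.* (2 ℕ.+ h ℕ.+ h)
  ω₂≤ = ℕ-Solver.solve-∀
  ω₃≤ : ∀ h → 2 ℕ.+ h ℕ.+ h ℕ.+ (4 ℕ.+ h ℕ.+ h ℕ.+ h ℕ.+ h) ℕ.+ (h ℕ.+ h ℕ.+ 2) ≡ 4 ℕ.* (2 ℕ.+ h ℕ.+ h)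
  ω₃≤ = ℕ-Solver.solve-∀
  sumEq : ∀ h → (+ 3 + h + h + h + h) + (+ 3 + h + h) + (+ 2 + h + h) ≡ 1ℤ * (+ 4 * (+ 2 + h + h))
  sumEq = solve-∀
  combination : ∀ q → ∣ q ∣ ≡ suc h → + (4 ℕ.* unit) ∣
    + ω zero * a + + ω (suc zero) * (a + q * + 4) + + ω (suc (suc zero)) * (a + r * + 4) + + ω (suc (suc (suc zero)))
  combination (+ .(suc h)) refl = divides (a + (1ℤ + + h) + r + 1ℤ) (trans (eq (+ h) a r) (cong ((a + (1ℤ + + h) + r + 1ℤ) *_) (sym 4unit≡)))
    where
    eq : ∀ h a r → (+ 3 + h + h + h + h) * a + (+ 3 + h + h) * (a + (1ℤ + h) * + 4) + (+ 2 + h + h) * (a + r * + 4) + (+ 4 + h + h + h + h) ≡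
      (a + (1ℤ + h) + r + 1ℤ) * (+ 4 * (+ 2 + h + h))
    eq = solve-∀
  combination -[1+ .h ] refl = divides (a - (1ℤ + + h) + r) (trans (eq (+ h) a r) (cong ((a - (1ℤ + + h) + r) *_) (sym 4unit≡)))
    where
    eq : ∀ h a r → (+ 3 + h + h + h + h) * a + (+ 3 + h + h) * (a + - (1ℤ + h) * + 4) + (+ 2 + h + h) * (a + r * + 4) + (+ 4 + h + h + h + h) ≡
      (a - (1ℤ + h) + r) * (+ 4 * (+ 2 + h + h))
    eq = solve-∀

-- If the quarter weights fail in all three rotations, differences of the three sums show that 4
-- divides b - a and c - a. The perturbation then works along whichever difference is nonzero.
weights₄ : ∀ a b c → ¬ (a ≡ b × a ≡ c) → Weights₄ a b c
weights₄ a b c distinct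
  with + 4 ∣? + 2 * a + + 1 * b + + 1 * c | + 4 ∣? + 2 * b + + 1 * c + + 1 * a | + 4 ∣? + 2 * c + + 1 * a + + 1 * b
... | no 4∤ | _     | _     = quarterWeights a b c 4∤
... | yes _ | no 4∤ | _     = weights₄-rotate (quarterWeights b c a 4∤)
... | yes _ | yes _ | no 4∤ = weights₄-rotate (weights₄-rotate (quarterWeights c a b 4∤))
... | yes 4∣a | yes 4∣b | yes 4∣c = subst₂ (Weights₄ a) (sym b≡) (sym c≡) (byQuotient (q ℤ.≟ 0ℤ) (r ℤ.≟ 0ℤ))
  where
  open _∣_ (∣m∣n⇒∣m-n 4∣b 4∣a) renaming (quotient to q; equality to b-a≡)
  open _∣_ (∣m∣n⇒∣m-n 4∣c 4∣a) renaming (quotient to r; equality to c-a≡)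
  b≡ : b ≡ a + q * + 4
  b≡ = trans (eq a b c) (cong (_+_ a) b-a≡)
    where
    eq : ∀ a b c → b ≡ a + ((+ 2 * b + + 1 * c + + 1 * a) - (+ 2 * a + + 1 * b + + 1 * c))
    eq = solve-∀
  c≡ : c ≡ a + r * + 4
  c≡ = trans (eq a b c) (cong (_+_ a) c-a≡)
    where
    eq : ∀ a b c → c ≡ a + ((+ 2 * c + + 1 * a + + 1 * b) - (+ 2 * a + + 1 * b + + 1 * c))
    eq = solve-∀
  nonzero : ∀ {z} → z ≢ 0ℤ → ∣ z ∣ ≡ suc (ℕ.pred ∣ z ∣)
  nonzero {z} z≢0 = sym (ℕ.suc-pred ∣ z ∣ {{ℕ.≢-nonZero (z≢0 ∘ ℤ.∣i∣≡0⇒i≡0)}})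
  byQuotient : Dec (q ≡ 0ℤ) → Dec (r ≡ 0ℤ) → Weights₄ a (a + q * + 4) (a + r * + 4)
  byQuotient (no q≢0)  _         = perturbedWeights a q r _ (nonzero q≢0)
  byQuotient (yes _)   (no r≢0)  = weights₄-swap (perturbedWeights a r q _ (nonzero r≢0))
  byQuotient (yes q≡0) (yes r≡0) = ⊥-elim (distinct (collapse q≡0 b≡ , collapse r≡0 c≡))
    where
    collapse : ∀ {q b} → q ≡ 0ℤ → b ≡ a + q * + 4 → a ≡ b
    collapse refl b≡ = sym (trans b≡ (ℤ.+-identityʳ a))

-- Adjacency and periods of a coloring

module _ (M : Matrix m 2) where

  inColumns-basis : ∀ {x y} → BasisChange (column₀ M) (column₁ M) x y → InColumns M x × InColumns M y
  inColumns-basis B =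
    respects (λ i → sym (x≡ i)) (subgroup-combination (columnSubgroup M) p q (generator zero) (generator (suc zero))) ,
    respects (λ i → sym (y≡ i)) (subgroup-combination (columnSubgroup M) r s (generator zero) (generator (suc zero)))
    where open BasisChange B

  unitVector-adjacent : ∀ v {z} → IsUnitVector z → Graph.Adj (SACG M) v (λ i → v i + z i)
  unitVector-adjacent v {z} (j , inj₁ z≡)  = j , inj₁ (respects (λ i → eq (v i) (z≡ i)) zeroᴳ)
    where
    eq : ∀ v {z e} → z ≡ e → 0ℤ ≡ (v + z) + - v + - e
    eq v {z} refl = cancel v z
      where
      cancel : ∀ v z → 0ℤ ≡ (v + z) + - v + - z
      cancel = solve-∀
  unitVector-adjacent v {z} (j , inj₂ z≡) = j , inj₂ (respects (λ i → eq (v i) (e j i) (z≡ i)) zeroᴳ)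
    where
    eq : ∀ v e {z} → z ≡ - e → 0ℤ ≡ (v + z) + - v + - - e
    eq v e refl = cancel v e
      where
      cancel : ∀ v e → 0ℤ ≡ (v + - e) + - v + - - e
      cancel = solve-∀

  -- A unit vector in the column lattice would identify 0 with one of its neighbours.
  loopless⇒∉columns : Loopless (SACG M) → ∀ {z} → IsUnitVector z → ¬ InColumns M z
  loopless⇒∉columns loopless {z} unit z∈H = loopless (λ _ → 0ℤ)
    (proj₁ (Graph.adj-resp (SACG M)) {λ _ → 0ℤ} {λ i → 0ℤ + z i} {λ _ → 0ℤ}
      (respects (λ i → eq (z i)) z∈H) (unitVector-adjacent (λ _ → 0ℤ) unit))
    where
    eq : ∀ z → z ≡ 0ℤ + z + - 0ℤ
    eq = solve-∀

  module _ (coloring : ProperColoring (SACG M) k) where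
    open ProperColoring coloring renaming (cong to color-respects)

    color-cong : ∀ {v w} → (∀ i → v i ≡ w i) → color v ≡ color w
    color-cong {v} {w} v≡w = color-respects (respects (λ i → eq (v≡w i)) zeroᴳ)
      where
      eq : ∀ {a b} → a ≡ b → 0ℤ ≡ a + - b
      eq {a} refl = sym (ℤ.+-inverseʳ a)

    -- Translations that preserve the coloring are collected into a subgroup so that integer
    -- combinations of known periods are periods at once.
    periods : Subgroup (ℤ^ m) 0ℓ
    periods = record
      { Member = λ z → ∀ v → color (λ i → v i + z i) ≡ color v
      ; resp = λ z≡w period v → trans (color-cong (λ i → sym (+-congʳ (v i) (z≡w i)))) (period v)
      ; 0-closed = λ v → color-cong (λ i → ℤ.+-identityʳ (v i))
      ; +-closed = λ {z} {w} pz pw v → trans (color-cong (λ i → sym (ℤ.+-assoc (v i) (z i) (w i))))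
          (trans (pw (λ i → v i + z i)) (pz v))
      ; neg-closed = λ {z} pz v → trans (sym (pz (λ i → v i + - z i))) (color-cong (λ i → cancel (v i) (z i)))
      }
      where
      +-congʳ : ∀ a {b c} → b ≡ c → a + b ≡ a + c
      +-congʳ a refl = refl
      cancel : ∀ a b → a + - b + b ≡ a
      cancel = solve-∀

    open Subgroup periods using () renaming (Member to Period)

    inColumns⇒period : ∀ {z} → InColumns M z → Period z
    inColumns⇒period {z} z∈H v = color-respects (respects (λ i → sym (cancel (v i) (z i))) z∈H)
      where
      cancel : ∀ a b → a + b + - a ≡ b
      cancel = solve-∀

    unitVector⇒¬period : ∀ {z} → IsUnitVector z → ¬ Period z
    unitVector⇒¬period unit period = proper (unitVector-adjacent (λ _ → 0ℤ) unit) (sym (period (λ _ → 0ℤ)))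

thirdColor : ∀ (p q r s : Fin 3) → p ≢ q → q ≢ r → r ≢ p → p ≢ s → s ≢ r → s ≡ q
thirdColor = from-yes (Fin.all? λ (p : Fin 3) → Fin.all? λ q → Fin.all? λ r → Fin.all? λ s →
  ¬? (p Fin.≟ q) →-dec ¬? (q Fin.≟ r) →-dec ¬? (r Fin.≟ p) →-dec ¬? (p Fin.≟ s) →-dec ¬? (s Fin.≟ r) →-dec (s Fin.≟ q))

-- The triangles v, v + f, v + f + g and v, v + g, v + f + g share an edge, so f and g shift colors alike.
triangle-period : ∀ (M : Matrix m 2) (coloring : ProperColoring (SACG M) 3) {f g h} →
  IsUnitVector f → IsUnitVector g → IsUnitVector h →
  Subgroup.Member (periods M coloring) (λ i → f i + g i + h i) →
  Subgroup.Member (periods M coloring) (λ i → g i - f i)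
triangle-period {m} M coloring {f} {g} {h} unitF unitG unitH period v = begin
  color (λ i → v i + (g i - f i))  ≡⟨ color-cong M coloring (λ i → shift (v i) (f i) (g i)) ⟩
  color (w ⊕ g)                    ≡⟨ thirdColor (color w) (color (w ⊕ f)) (color (w ⊕ f ⊕ g)) (color (w ⊕ g))
                                        (step w unitF) (step (w ⊕ f) unitG) closing (step w unitG) crossing ⟩
  color (w ⊕ f)                    ≡⟨ color-cong M coloring (λ i → cancel (v i) (f i)) ⟩
  color v                          ∎
  where
  open ≡-Reasoning
  open ProperColoring coloring using (color; proper)
  infixl 6 _⊕_
  _⊕_ : Vector ℤ m → Vector ℤ m → Vector ℤ m
  (a ⊕ b) i = a i + b i
  -- Based at v - f, the two triangles have v and v + (g - f) as the vertices off their common edge.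
  w : Vector ℤ m
  w i = v i - f i
  step : ∀ a {z} → IsUnitVector z → color a ≢ color (a ⊕ z)
  step a unit = proper (unitVector-adjacent M a unit)
  closing : color (w ⊕ f ⊕ g) ≢ color w
  closing eq = step (w ⊕ f ⊕ g) unitH (trans eq (trans (sym (period w))
    (color-cong M coloring (λ i → regroup (w i) (f i) (g i) (h i)))))
    where
    regroup : ∀ a f g h → a + (f + g + h) ≡ a + f + g + h
    regroup = solve-∀
  crossing : color (w ⊕ g) ≢ color (w ⊕ f ⊕ g)
  crossing eq = step (w ⊕ g) unitF (trans eq (color-cong M coloring (λ i → swap (w i) (f i) (g i))))
    where
    swap : ∀ a f g → a + f + g ≡ a + g + f
    swap = solve-∀
  shift : ∀ v f g → v + (g - f) ≡ (v - f) + g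
  shift = solve-∀
  cancel : ∀ v f → (v - f) + f ≡ v
  cancel = solve-∀

-- Colorings in the exceptional case

module _ (M : Matrix 4 2) {x y : Vector ℤ 4} (B : BasisChange (column₀ M) (column₁ M) x y)
         (E : ExceptionalBasis x y) where
  open ExceptionalBasis E renaming (permutation to P)

  private
    g₀ g₁ g₂ g₃ : Vector ℤ 4
    g₀ = P zero
    g₁ = P (suc zero)
    g₂ = P (suc (suc zero))
    g₃ = P (suc (suc (suc zero)))

  exceptional⇒¬3colorable : ¬ ProperColoring (SACG M) 3
  exceptional⇒¬3colorable coloring = unitVector⇒¬period M coloring (rowUnitVector signed (suc (suc (suc zero)))) period₃
    where
    H = periods M coloring
    open Subgroup H using (resp; +-closed; neg-closed) renaming (Member to Period)
    periodX : Period x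
    periodX = inColumns⇒period M coloring (proj₁ (inColumns-basis M B))
    periodY : Period y
    periodY = inColumns⇒period M coloring (proj₂ (inColumns-basis M B))
    period₀₁ : Period (λ i → g₁ i - g₀ i)
    period₀₁ = triangle-period M coloring (rowUnitVector signed zero) (rowUnitVector signed (suc zero))
      (rowUnitVector signed (suc (suc zero))) (resp (exceptional-x E) periodX)
    period₀₂ : Period (λ i → g₂ i - g₀ i)
    period₀₂ = triangle-period M coloring (rowUnitVector signed zero) (rowUnitVector signed (suc (suc zero)))
      (rowUnitVector signed (suc zero))
      (resp (λ i → trans (exceptional-x E i) (swap (g₀ i) (g₁ i) (g₂ i))) periodX)
      where
      swap : ∀ a b c → a + b + c ≡ a + c + b
      swap = solve-∀
    3∣ : + 3 ∣ a + b + c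
    3∣ = ∣ᵤ⇒∣ 3∣a+b+c
    open _∣_ 3∣ renaming (quotient to t; equality to sum≡)
    -- With a + b + c = 3t, g₃ = y - t x - (b - t) (g₁ - g₀) - (c - t) (g₂ - g₀).
    period₃ : Period g₃
    period₃ = resp (λ i → sym (decompose i))
      (+-closed (subgroup-combination H 1ℤ (- t) periodY periodX)
                (subgroup-combination H (t - b) (t - c) period₀₁ period₀₂))
      where
      decompose : ∀ i → g₃ i ≡ (1ℤ * y i + - t * x i) + ((t - b) * (g₁ i - g₀ i) + (t - c) * (g₂ i - g₀ i))
      -- The vanishing multiple (a + b + c - 3t) g₀ is added, after which the decomposition is an
      -- identity in free variables.
      decompose i = begin
        g₃ i
          ≡⟨ ℤ.+-identityʳ (g₃ i) ⟨
        g₃ i + 0ℤ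
          ≡⟨ cong (λ z → g₃ i + z * g₀ i) (ℤ.+-inverseʳ (a + b + c)) ⟨
        g₃ i + ((a + b + c) - (a + b + c)) * g₀ i
          ≡⟨ cong (λ z → g₃ i + ((a + b + c) - z) * g₀ i) sum≡ ⟩
        g₃ i + ((a + b + c) - t * + 3) * g₀ i
          ≡⟨ expand a b c t (g₀ i) (g₁ i) (g₂ i) (g₃ i) ⟩
        (1ℤ * (a * g₀ i + b * g₁ i + c * g₂ i + g₃ i) + - t * (g₀ i + g₁ i + g₂ i)) +
          ((t - b) * (g₁ i - g₀ i) + (t - c) * (g₂ i - g₀ i))
          ≡⟨ cong₂ (λ y x → (1ℤ * y + - t * x) + ((t - b) * (g₁ i - g₀ i) + (t - c) * (g₂ i - g₀ i)))
               (sym (exceptional-y E i)) (sym (exceptional-x E i)) ⟩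
        (1ℤ * y i + - t * x i) + ((t - b) * (g₁ i - g₀ i) + (t - c) * (g₂ i - g₀ i)) ∎
        where
        open ≡-Reasoning
        expand : ∀ a b c t p q r s → s + ((a + b + c) - t * + 3) * p ≡
          (1ℤ * (a * p + b * q + c * r + s) + - t * (p + q + r)) + ((t - b) * (q - p) + (t - c) * (r - p))
        expand = solve-∀

  exceptional⇒4colorable : Loopless (SACG M) → ProperColoring (SACG M) 4
  exceptional⇒4colorable loopless = circular⇒proper M (s≤s z≤n)
    (circular-basis B (weights₄⇒circular₄ E (weights₄ a b c distinct)))
    where
    distinct : ¬ (a ≡ b × a ≡ c)
    -- If a = b = c, then g₃ = y - a x lies in the column lattice although it is plus or minus a
    -- generator, which gives a loop.
    distinct (a≡b , a≡c) = loopless⇒∉columns M loopless (rowUnitVector signed (suc (suc (suc zero))))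
      (respects (λ i → sym (decompose i)) (subgroup-combination (columnSubgroup M) 1ℤ (- a)
        (proj₂ (inColumns-basis M B)) (proj₁ (inColumns-basis M B))))
      where
      expand : ∀ a p q r s → s ≡ 1ℤ * (a * p + a * q + a * r + s) + - a * (p + q + r)
      expand = solve-∀
      decompose : ∀ i → g₃ i ≡ 1ℤ * y i + - a * x i
      decompose i = begin
        g₃ i
          ≡⟨ expand a (g₀ i) (g₁ i) (g₂ i) (g₃ i) ⟩
        1ℤ * (a * g₀ i + a * g₁ i + a * g₂ i + g₃ i) + - a * (g₀ i + g₁ i + g₂ i)
          ≡⟨ cong₂ (λ b c → 1ℤ * (a * g₀ i + b * g₁ i + c * g₂ i + g₃ i) + - a * (g₀ i + g₁ i + g₂ i)) a≡b a≡c ⟩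
        1ℤ * (a * g₀ i + b * g₁ i + c * g₂ i + g₃ i) + - a * (g₀ i + g₁ i + g₂ i)
          ≡⟨ cong₂ (λ y x → 1ℤ * y + - a * x) (sym (exceptional-y E i)) (sym (exceptional-x E i)) ⟩
        1ℤ * y i + - a * x i ∎
        where open ≡-Reasoning

-- Chromatic numbers

module _ (M : Matrix m 2) (i : Fin m) where

  -- The index `i` provides a generator and with it an edge at 0, which one color cannot handle.
  colors≥2 : ∀ j → ProperColoring (SACG M) j → 2 ℕ.≤ j
  colors≥2 zero          coloring with () ← ProperColoring.color coloring (λ _ → 0ℤ)
  colors≥2 (suc zero)    coloring = ⊥-elim (ProperColoring.proper coloring {λ _ → 0ℤ} {λ j → 0ℤ + e i j}
    (unitVector-adjacent M (λ _ → 0ℤ) (i , inj₁ (λ _ → refl))) (one _ _))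
    where
    one : ∀ (p q : Fin 1) → p ≡ q
    one zero zero = refl
  colors≥2 (suc (suc j)) coloring = s≤s (s≤s z≤n)

  -- `Bipartite` asks for chromatic number exactly 2; the lower bound holds because an edge exists.
  nonbipartite⇒¬2colorable : ¬ Bipartite (SACG M) → ¬ ProperColoring (SACG M) 2
  nonbipartite⇒¬2colorable nonbipartite coloring = nonbipartite (coloring , colors≥2)

  chromaticNumber-suc : ∀ {k} → (∀ j → ProperColoring (SACG M) j → k ℕ.≤ j) → ¬ ProperColoring (SACG M) k →
                        ∀ j → ProperColoring (SACG M) j → suc k ℕ.≤ j
  chromaticNumber-suc k≤ ¬k j coloring = ℕ.≤∧≢⇒< (k≤ j coloring) λ where refl → ¬k coloring

theorem1p2 : (M : Matrix 4 2) →
    ¬ Bipartite (SACG M) → Loopless (SACG M) → NoZeroRows M →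
    (Exceptional M → HasChromaticNumber (SACG M) 4) ×
    (¬ Exceptional M → HasChromaticNumber (SACG M) 3) ×
    (HasChromaticNumber (SACG M) 4 ⇔ Exceptional M)
theorem1p2 M nonbipartite loopless nonzeroRows =
  exceptional⇒4 , nonexceptional⇒3 , mk⇔ 4⇒exceptional exceptional⇒4
  where
  colors≥3 : ∀ j → ProperColoring (SACG M) j → 3 ℕ.≤ j
  colors≥3 = chromaticNumber-suc M zero (colors≥2 M zero) (nonbipartite⇒¬2colorable M zero nonbipartite)

  -- One of the two alternatives is constructed outright, without excluded middle, so the converse
  -- direction also yields explicit matrices P and U.
  dichotomy : ProperColoring (SACG M) 3 ⊎ Exceptional M
  dichotomy = ⊎.map (circular⇒proper M (s≤s z≤n)) (columns⇒exceptional M)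
    (circular₃⊎exceptional (column₀ M) (column₁ M)
      (λ i (u≡0 , v≡0) → nonzeroRows i λ { zero → u≡0 ; (suc zero) → v≡0 })
      (λ {x} B ℓ¹x≡1 → loopless⇒∉columns M loopless (ℓ¹≡1⇒unitVector x ℓ¹x≡1) (proj₁ (inColumns-basis M B)))
      (nonbipartite⇒¬2colorable M zero nonbipartite ∘ circular⇒proper M (s≤s z≤n)))

  columns⇒4 : ExceptionalColumns (column₀ M) (column₁ M) → HasChromaticNumber (SACG M) 4
  columns⇒4 (x , y , B , E) = exceptional⇒4colorable M B E loopless ,
    chromaticNumber-suc M zero colors≥3 (exceptional⇒¬3colorable M B E)

  exceptional⇒4 : Exceptional M → HasChromaticNumber (SACG M) 4
  exceptional⇒4 = columns⇒4 ∘ exceptional⇒columns M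

  nonexceptional⇒3 : ¬ Exceptional M → HasChromaticNumber (SACG M) 3
  nonexceptional⇒3 nonexceptional = ⊎.[ id , ⊥-elim ∘ nonexceptional ]′ dichotomy , colors≥3

  4⇒exceptional : HasChromaticNumber (SACG M) 4 → Exceptional M
  4⇒exceptional (_ , minimal) =
    ⊎.[ (λ coloring → ⊥-elim (ℕ.<⇒≱ (ℕ.n<1+n 3) (minimal 3 coloring))) , id ]′ dichotomy
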